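{- Let $d>3$ be an integer and fix $C>0$. For a finite ring $R$ let $H=\{(x_1,\dots,x_d)\in R^d : x_1x_2\cdots x_d=1\}$. Then, up to isomorphism, there are only finitely many finite simple rings $R$ (including finite fields) for which $H\subseteq R^d$ is a $C$-Salem set.
   Context: Rings are unital with $1\neq 0$ and not necessarily commutative. The finite simple rings are exactly the matrix rings $M_{n\times n}(F)$ with $F$ a finite field and $n\ge 1$. For a finite ring $R$, a set $S\subseteq R^d$ and a character $\psi$ of the additive group of $R^d$, put $\widehat{S}(\psi)=\frac{1}{|R|^d}\sum_{x\in S}\psi(x)$. The set $S$ is called $C$-Salem if $|\widehat{S}(\psi)|\le C\,|R|^{ -d}\,|S|^{1/2}$ for all nontrivial additive characters $\psi$ of $R^d$. -}

module Defs where

open import Algebra.Bundles using (Ring; AbelianGroup)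
open import Algebra.Bundles.Raw using (RawMonoid)
open import Algebra.Construct.Pointwise using (abelianGroup)
open import Algebra.Morphism.Structures using (IsMonoidHomomorphism; IsRingIsomorphism)
import Algebra.Properties.Monoid.Sum as MonoidSum
open import Data.Bool.Base using (if_then_else_)
open import Data.Fin.Base using (Fin)
import Data.Fin.Properties as Fin
open import Data.Integer.Base as ℤ using (+_)
import Data.Integer.Properties as ℤ
open import Data.List.Base using (List; _∷_; []; map; allFin; filter; foldr; length; cartesianProductWith)
open import Data.List.Relation.Unary.Any using (Any)
open import Data.Nat.Base as ℕ using (ℕ; zero; suc)
import Data.Nat.Properties as ℕ
open import Data.Product.Base using (Σ-syntax; ∃-syntax; _×_; _,_)
open import Data.Rational.Base using (ℚ; 0ℚ; 1ℚ; ½; ↥_; mkℚ) hiding (module ℚ)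
import Data.Rational.Properties
open import Data.Rational.Solver using (module +-*-Solver)
import Data.Rational.Unnormalised.Base as ℚᵘ
import Data.Rational.Unnormalised.Properties as ℚᵘ
open import Data.Sum.Base using (inj₁; inj₂)
import Data.Vec.Functional as Vector
open import Function.Bundles using (Inverse)
open import Function.Properties.Inverse using (Inverse⇒Injection)
import Function.Construct.Symmetry as Symmetry
open import Level using (Level; _⊔_; 0ℓ) renaming (suc to lsuc)
open import Relation.Binary.Core using (Rel)
open import Relation.Binary.Definitions using (_Respects_)
import Relation.Binary.Definitions as B
open import Relation.Binary.PropositionalEquality as ≡ using (_≡_; refl; sym; trans; cong; cong₂; subst)
open import Relation.Nullary using (¬_; Dec; does; yes; no; contradiction)
open import Relation.Nullary.Decidable using (via-injection)
open import Relation.Unary using (Pred; Decidable; _∈_)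

private
  module ℚ where
    open Data.Rational.Base public
      using (_+_; _*_; _-_; -_; ∣_∣; _<_; _≤_; _⊔_; _/_; 1/_; toℚᵘ; positive; nonNegative; >-nonZero)
    open Data.Rational.Properties public

  variable
    c ℓ c′ ℓ′ κ : Level

module Estimates where
  open ℚ using (_+_; _*_; _-_; -_; ∣_∣; _<_; _≤_)
  open +-*-Solver

  half-pos : ∀ {ε} → 0ℚ < ε → 0ℚ < ½ * ε
  half-pos {ε} 0<ε = subst (_< ½ * ε) (ℚ.*-zeroʳ ½) (ℚ.*-monoʳ-<-pos ½ 0<ε)

  half+half : ∀ ε → ½ * ε + ½ * ε ≡ ε
  half+half ε = trans (sym (ℚ.*-distribʳ-+ ε ½ ½)) (ℚ.*-identityˡ ε)

  *-pos : ∀ {x y} → 0ℚ < x → 0ℚ < y → 0ℚ < x * y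
  *-pos {x} {y} 0<x 0<y = ℚ.positive⁻¹ (x * y)
    {{ℚ.pos*pos⇒pos x {{ℚ.positive 0<x}} y {{ℚ.positive 0<y}}}}

  square-mono : ∀ {x y} → 0ℚ ≤ x → x ≤ y → x * x ≤ y * y
  square-mono {x} {y} 0≤x x≤y = ℚ.≤-trans
    (ℚ.*-monoʳ-≤-nonNeg x {{ℚ.nonNegative 0≤x}} x≤y)
    (ℚ.*-monoˡ-≤-nonNeg y {{ℚ.nonNegative (ℚ.≤-trans 0≤x x≤y)}} x≤y)

  sum-dist : ∀ {ε} a b c d → ∣ a - c ∣ < ½ * ε → ∣ b - d ∣ < ½ * ε →
             ∣ (a + b) - (c + d) ∣ < ε
  sum-dist {ε} a b c d p q = begin-strict
    ∣ (a + b) - (c + d) ∣     ≡⟨ cong ∣_∣ (solve 4 (λ a b c d →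
                                 (a :+ b) :- (c :+ d) := (a :- c) :+ (b :- d)) refl a b c d) ⟩
    ∣ (a - c) + (b - d) ∣     ≤⟨ ℚ.∣p+q∣≤∣p∣+∣q∣ (a - c) (b - d) ⟩
    ∣ a - c ∣ + ∣ b - d ∣     <⟨ ℚ.+-mono-< p q ⟩
    ½ * ε + ½ * ε             ≡⟨ half+half ε ⟩
    ε                         ∎
    where open ℚ.≤-Reasoning

  neg-dist : ∀ a b → ∣ - a - - b ∣ ≡ ∣ a - b ∣
  neg-dist a b = trans
    (cong ∣_∣ (solve 2 (λ a b → :- a :- :- b := :- (a :- b)) refl a b))
    (ℚ.∣-p∣≡∣p∣ (a - b))

  cancel-recip : ∀ B (0<B : 0ℚ < B) t → B * (t * (ℚ.1/ B) {{ℚ.>-nonZero 0<B}}) ≡ t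
  cancel-recip B 0<B t = trans
    (solve 3 (λ B t r → B :* (t :* r) := t :* (B :* r)) refl B t r)
    (trans (cong (t *_) (ℚ.*-inverseʳ B {{ℚ.>-nonZero 0<B}})) (ℚ.*-identityʳ t))
    where r = (ℚ.1/ B) {{ℚ.>-nonZero 0<B}}

  recip-pos : ∀ B (0<B : 0ℚ < B) → 0ℚ < (ℚ.1/ B) {{ℚ.>-nonZero 0<B}}
  recip-pos B 0<B = ℚ.positive⁻¹ _ {{ℚ.1/pos⇒pos B {{ℚ.positive 0<B}}}}

  prod-dist : ∀ {ε B C} (0<B : 0ℚ < B) (0<C : 0ℚ < C) a b c d → ∣ a ∣ ≤ B → ∣ d ∣ ≤ C →
              ∣ b - d ∣ < ½ * ε * (ℚ.1/ B) {{ℚ.>-nonZero 0<B}} →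
              ∣ a - c ∣ < ½ * ε * (ℚ.1/ C) {{ℚ.>-nonZero 0<C}} →
              ∣ a * b - c * d ∣ < ε
  prod-dist {ε} {B} {C} 0<B 0<C a b c d a≤B d≤C p q = begin-strict
    ∣ a * b - c * d ∣                       ≡⟨ cong ∣_∣ (solve 4 (λ a b c d →
                                               a :* b :- c :* d := a :* (b :- d) :+ d :* (a :- c)) refl a b c d) ⟩
    ∣ a * (b - d) + d * (a - c) ∣           ≤⟨ ℚ.∣p+q∣≤∣p∣+∣q∣ (a * (b - d)) (d * (a - c)) ⟩
    ∣ a * (b - d) ∣ + ∣ d * (a - c) ∣       ≡⟨ cong₂ _+_ (ℚ.∣p*q∣≡∣p∣*∣q∣ a (b - d)) (ℚ.∣p*q∣≡∣p∣*∣q∣ d (a - c)) ⟩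
    ∣ a ∣ * ∣ b - d ∣ + ∣ d ∣ * ∣ a - c ∣   <⟨ ℚ.+-mono-< (bound 0<B a≤B p) (bound 0<C d≤C q) ⟩
    ½ * ε + ½ * ε                           ≡⟨ half+half ε ⟩
    ε                                       ∎
    where
    open ℚ.≤-Reasoning
    bound : ∀ {D s t} (0<D : 0ℚ < D) → ∣ s ∣ ≤ D →
            ∣ t ∣ < ½ * ε * (ℚ.1/ D) {{ℚ.>-nonZero 0<D}} → ∣ s ∣ * ∣ t ∣ < ½ * ε
    bound {D} {s} {t} 0<D s≤D t< = begin-strict
      ∣ s ∣ * ∣ t ∣   ≤⟨ ℚ.*-monoʳ-≤-nonNeg ∣ t ∣ {{ℚ.∣-∣-nonNeg t}} s≤D ⟩
      D * ∣ t ∣       <⟨ ℚ.*-monoʳ-<-pos D {{ℚ.positive 0<D}} t< ⟩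
      D * (½ * ε * (ℚ.1/ D) {{ℚ.>-nonZero 0<D}}) ≡⟨ cancel-recip D 0<D (½ * ε) ⟩
      ½ * ε           ∎

  ∣∣<⁻ : ∀ {a b ε} → a < b + ε → b < a + ε → ∣ a - b ∣ < ε
  ∣∣<⁻ {a} {b} {ε} p q with ℚ.∣p∣≡p∨∣p∣≡-p (a - b)
  ... | inj₁ e = begin-strict
    ∣ a - b ∣     ≡⟨ e ⟩
    a - b         <⟨ ℚ.+-monoˡ-< (- b) p ⟩
    (b + ε) - b   ≡⟨ solve 2 (λ b ε → (b :+ ε) :- b := ε) refl b ε ⟩
    ε             ∎
    where open ℚ.≤-Reasoning
  ... | inj₂ e = begin-strict
    ∣ a - b ∣     ≡⟨ e ⟩
    - (a - b)     ≡⟨ solve 2 (λ a b → :- (a :- b) := b :- a) refl a b ⟩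
    b - a         <⟨ ℚ.+-monoˡ-< (- a) q ⟩
    (a + ε) - a   ≡⟨ solve 2 (λ b ε → (b :+ ε) :- b := ε) refl a ε ⟩
    ε             ∎
    where open ℚ.≤-Reasoning

  ∣∣<⇒< : ∀ {a b ε} → ∣ a - b ∣ < ε → a < b + ε
  ∣∣<⇒< {a} {b} {ε} p = begin-strict
    a             ≡⟨ solve 2 (λ a b → a := b :+ (a :- b)) refl a b ⟩
    b + (a - b)   ≤⟨ ℚ.+-monoʳ-≤ b (p≤∣p∣ (a - b)) ⟩
    b + ∣ a - b ∣ <⟨ ℚ.+-monoʳ-< b p ⟩
    b + ε         ∎
    where
    open ℚ.≤-Reasoning
    p≤∣p∣ : ∀ p → p ≤ ∣ p ∣
    p≤∣p∣ p with ℚ.≤-total 0ℚ p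
    ... | inj₁ 0≤p = ℚ.≤-reflexive (sym (ℚ.0≤p⇒∣p∣≡p 0≤p))
    ... | inj₂ p≤0 = ℚ.≤-trans p≤0 (ℚ.0≤∣p∣ p)

  dist-sym : ∀ a b → ∣ a - b ∣ ≡ ∣ b - a ∣
  dist-sym a b = trans (sym (ℚ.∣-p∣≡∣p∣ (a - b)))
    (cong ∣_∣ (solve 2 (λ a b → :- (a :- b) := b :- a) refl a b))

-- The largest k ≤ b with (k / (n + 1))² ≤ q, and 0 if there is none.
gridRoot : ℕ → ℚ → ℕ → ℕ
gridRoot n q zero    = zero
gridRoot n q (suc b) = if does ((+ suc b ℚ./ suc n) ℚ.* (+ suc b ℚ./ suc n) ℚ.≤? q)
  then suc b
  else gridRoot n q b

-- For q ≥ 0 this is the largest multiple of 1 / (n + 1) not exceeding √q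
-- (the numerator of q bounds √q from above); for q < 0 it is 0.
approxRoot : ℕ → ℚ → ℚ
approxRoot n q = + gridRoot n q (ℤ.∣ ↥ q ∣ ℕ.* suc n) ℚ./ suc n

module ApproxRoot where
  open ℚ using (_+_; _*_; _-_; -_; ∣_∣; _<_; _≤_; _/_)
  open +-*-Solver
  open Estimates

  approxRoot-nonNeg : ∀ n q → 0ℚ ≤ approxRoot n q
  approxRoot-nonNeg n q = ℚ.nonNegative⁻¹ (approxRoot n q)
    {{ℚ.normalize-nonNeg (gridRoot n q (ℤ.∣ ↥ q ∣ ℕ.* suc n)) (suc n)}}

  private
    if-intro : ∀ {A : Set} (P : ℕ → Set) (a? : Dec A) {j k} →
               (A → P j) → (¬ A → P k) → P (if does a? then j else k)
    if-intro P (yes a) f g = f a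
    if-intro P (no ¬a) f g = g ¬a

  approxRoot-lower : ∀ n q → approxRoot n q * approxRoot n q ≤ q ℚ.⊔ 0ℚ
  approxRoot-lower n q = go (ℤ.∣ ↥ q ∣ ℕ.* suc n)
    where
    Bound : ℕ → Set
    Bound k = (+ k / suc n) * (+ k / suc n) ≤ q ℚ.⊔ 0ℚ
    go : ∀ b → Bound (gridRoot n q b)
    go zero    = subst (λ z → z * z ≤ q ℚ.⊔ 0ℚ) (sym (ℚ.0/n≡0 (suc n))) (ℚ.p≤q⊔p q 0ℚ)
    go (suc b) = if-intro Bound ((+ suc b / suc n) * (+ suc b / suc n) ℚ.≤? q)
      (λ le → ℚ.≤-trans le (ℚ.p≤p⊔q q 0ℚ))
      (λ _ → go b)

  step : ∀ k n → + suc k / suc n ≡ + k / suc n + + 1 / suc n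
  step k n = ℚ.toℚᵘ-injective (begin
    ℚ.toℚᵘ (+ suc k / suc n)                         ≈⟨ ℚ.toℚᵘ-fromℚᵘ (ℚᵘ.mkℚᵘ (+ suc k) n) ⟩
    ℚᵘ.mkℚᵘ (+ suc k) n                              ≈⟨ ℚᵘ.*≡* eq ⟩
    ℚᵘ.mkℚᵘ (+ k) n ℚᵘ.+ ℚᵘ.mkℚᵘ (+ 1) n             ≈⟨ ℚᵘ.+-cong
        (ℚᵘ.≃-sym {ℚ.toℚᵘ (+ k / suc n)} (ℚ.toℚᵘ-fromℚᵘ (ℚᵘ.mkℚᵘ (+ k) n)))
        (ℚᵘ.≃-sym {ℚ.toℚᵘ (+ 1 / suc n)} (ℚ.toℚᵘ-fromℚᵘ (ℚᵘ.mkℚᵘ (+ 1) n))) ⟩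
    ℚ.toℚᵘ (+ k / suc n) ℚᵘ.+ ℚ.toℚᵘ (+ 1 / suc n)   ≈⟨ ℚᵘ.≃-sym (ℚ.toℚᵘ-homo-+ (+ k / suc n) (+ 1 / suc n)) ⟩
    ℚ.toℚᵘ (+ k / suc n + + 1 / suc n)               ∎)
    where
    open ℚᵘ.≃-Reasoning
    eq : + suc k ℤ.* (+ suc n ℤ.* + suc n) ≡ (+ k ℤ.* + suc n ℤ.+ + 1 ℤ.* + suc n) ℤ.* + suc n
    eq = trans (sym (ℤ.*-assoc (+ suc k) (+ suc n) (+ suc n)))
      (cong (ℤ._* + suc n) (trans (cong (ℤ._* + suc n) (cong +_ (ℕ.+-comm 1 k)))
        (ℤ.*-distribʳ-+ (+ suc n) (+ k) (+ 1))))

  unit-pos : ∀ n → 0ℚ < + 1 / suc n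
  unit-pos n = ℚ.positive⁻¹ _ {{ℚ.normalize-pos 1 (suc n)}}


  whole : ∀ m n → + (m ℕ.* suc n) / suc n ≡ + m / 1
  whole m n = trans (cong (λ i → i / suc n) (ℤ.pos-* m (suc n)))
    (ℚ.fromℚᵘ-cong {ℚᵘ.mkℚᵘ (+ m ℤ.* + suc n) n} {ℚᵘ.mkℚᵘ (+ m) 0}
      (ℚᵘ.*≡* (ℤ.*-identityʳ (+ m ℤ.* + suc n))))

  below-numerator : ∀ q → q ≤ + ℤ.∣ ↥ q ∣ / 1
  below-numerator q@(mkℚ i d _) = ℚ.toℚᵘ-cancel-≤ (ℚᵘ.≤-respʳ-≃
    (ℚᵘ.≃-sym {ℚ.toℚᵘ (+ ℤ.∣ i ∣ / 1)} {ℚᵘ.mkℚᵘ (+ ℤ.∣ i ∣) 0} (ℚ.toℚᵘ-fromℚᵘ (ℚᵘ.mkℚᵘ (+ ℤ.∣ i ∣) 0)))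
    (ℚᵘ.*≤* (le i)))
    where
    le : ∀ i → i ℤ.* + 1 ℤ.≤ + ℤ.∣ i ∣ ℤ.* + suc d
    le (+ n)      = ℤ.≤-trans (ℤ.≤-reflexive (ℤ.*-identityʳ (+ n)))
      (subst (+ n ℤ.≤_) (ℤ.pos-* n (suc d)) (ℤ.+≤+ (ℕ.m≤m*n n (suc d))))
    le (ℤ.-[1+ n ]) = subst (ℤ._≤ + suc n ℤ.* + suc d) (sym (ℤ.*-identityʳ ℤ.-[1+ n ]))
      (subst (ℤ.-[1+ n ] ℤ.≤_) (ℤ.pos-* (suc n) (suc d)) ℤ.-≤+)

  below-square : ∀ m → + m / 1 ≤ (+ m / 1) * (+ m / 1)
  below-square zero      = ℚ.≤-refl
  below-square m@(suc k) = subst (_≤ (+ m / 1) * (+ m / 1)) (ℚ.*-identityʳ (+ m / 1))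
    (ℚ.*-monoˡ-≤-nonNeg (+ m / 1) {{ℚ.normalize-nonNeg m 1}} 1≤m)
    where
    1≤m : 1ℚ ≤ + m / 1
    1≤m = ℚ.toℚᵘ-cancel-≤ (ℚᵘ.≤-respʳ-≃
      (ℚᵘ.≃-sym {ℚ.toℚᵘ (+ m / 1)} {ℚᵘ.mkℚᵘ (+ m) 0} (ℚ.toℚᵘ-fromℚᵘ (ℚᵘ.mkℚᵘ (+ m) 0)))
      (ℚᵘ.*≤* (subst (+ 1 ℤ.≤_) (sym (ℤ.*-identityʳ (+ m))) (ℤ.+≤+ (ℕ.s≤s ℕ.z≤n)))))

  approxRoot-upper : ∀ n q → q < (approxRoot n q + + 1 / suc n) * (approxRoot n q + + 1 / suc n)
  approxRoot-upper n q = go (M ℕ.* suc n) start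
    where
    M = ℤ.∣ ↥ q ∣
    u = + 1 / suc n
    Bound : ℕ → Set
    Bound k = q < (+ k / suc n + u) * (+ k / suc n + u)

    start : Bound (M ℕ.* suc n)
    start = subst (λ z → q < (z + u) * (z + u)) (sym (whole M n)) (begin-strict
      q                         ≤⟨ below-numerator q ⟩
      m                         ≤⟨ below-square M ⟩
      m * m                     ≤⟨ ℚ.*-monoˡ-≤-nonNeg m {{ℚ.nonNegative 0≤m}} (ℚ.<⇒≤ m<m+u) ⟩
      m * (m + u)               <⟨ ℚ.*-monoˡ-<-pos (m + u) {{ℚ.positive (ℚ.≤-<-trans 0≤m m<m+u)}} m<m+u ⟩
      (m + u) * (m + u)         ∎)
      where
      open ℚ.≤-Reasoning
      m = + M / 1
      0≤m : 0ℚ ≤ m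
      0≤m = ℚ.nonNegative⁻¹ m {{ℚ.normalize-nonNeg M 1}}
      m<m+u : m < m + u
      m<m+u = subst (_< m + u) (ℚ.+-identityʳ m) (ℚ.+-monoʳ-< m (unit-pos n))

    go : ∀ b → Bound b → Bound (gridRoot n q b)
    go zero    q< = q<
    go (suc b) q< = if-intro Bound ((+ suc b / suc n) * (+ suc b / suc n) ℚ.≤? q)
      (λ _ → q<)
      (λ ≰ → go b (subst (λ z → q < z * z) (step b n) (ℚ.≰⇒> ≰)))

  unit-small : ∀ {η} → 0ℚ < η → ∃[ N ] ∀ n → N ℕ.≤ n → + 1 / suc n ≤ η
  unit-small {η@(mkℚ i d _)} 0<η = d , λ n d≤n → ℚ.toℚᵘ-cancel-≤ (ℚᵘ.≤-respˡ-≃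
    (ℚᵘ.≃-sym {ℚ.toℚᵘ (+ 1 / suc n)} {ℚᵘ.mkℚᵘ (+ 1) n} (ℚ.toℚᵘ-fromℚᵘ (ℚᵘ.mkℚᵘ (+ 1) n)))
    (ℚᵘ.*≤* (le i (ℚ.positive 0<η) n d≤n)))
    where
    le : ∀ i → ℤ.Positive i → ∀ n → d ℕ.≤ n → + 1 ℤ.* + suc d ℤ.≤ i ℤ.* + suc n
    le (+ suc k) _ n d≤n = subst (ℤ._≤ + suc k ℤ.* + suc n) (sym (ℤ.*-identityˡ (+ suc d)))
      (subst (+ suc d ℤ.≤_) (ℤ.pos-* (suc k) (suc n))
        (ℤ.+≤+ (ℕ.≤-trans (ℕ.s≤s d≤n) (ℕ.m≤n*m (suc n) (suc k)))))

  private
    dist< : ∀ {ε} m n q r → 0ℚ < ε → q < r + (½ * ε) * (½ * ε) →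
            + 1 / suc n ≤ ½ * ε → approxRoot m q < approxRoot n r + ε
    dist< {ε} m n q r 0<ε q<r u≤η = ℚ.≰⇒> λ b+ε≤a →
      contradiction (ℚ.≤-<-trans (ℚ.≤-trans (square-mono 0≤b+ε b+ε≤a) (approxRoot-lower m q))
                                 q⊔0<) (ℚ.<-irrefl refl)
      where
      open ℚ.≤-Reasoning
      a = approxRoot m q
      b = approxRoot n r
      u = + 1 / suc n
      η = ½ * ε
      0<η = half-pos 0<ε
      0≤b = approxRoot-nonNeg n r
      0≤b+η : 0ℚ ≤ b + η
      0≤b+η = ℚ.+-mono-≤ 0≤b (ℚ.<⇒≤ 0<η)
      0≤b+ε : 0ℚ ≤ b + ε
      0≤b+ε = ℚ.+-mono-≤ 0≤b (ℚ.<⇒≤ 0<ε)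
      0<b+ε : 0ℚ < b + ε
      0<b+ε = ℚ.+-mono-≤-< 0≤b 0<ε
      q< : q < (b + ε) * (b + ε)
      q< = begin-strict
        q                                   <⟨ q<r ⟩
        r + η * η                           <⟨ ℚ.+-monoˡ-< (η * η) (approxRoot-upper n r) ⟩
        (b + u) * (b + u) + η * η           ≤⟨ ℚ.+-monoˡ-≤ (η * η) (square-mono
                                                (ℚ.+-mono-≤ 0≤b (ℚ.<⇒≤ (unit-pos n))) (ℚ.+-monoʳ-≤ b u≤η)) ⟩
        (b + η) * (b + η) + η * η           ≡⟨ ℚ.+-identityʳ _ ⟨
        (b + η) * (b + η) + η * η + 0ℚ      ≤⟨ ℚ.+-monoʳ-≤ ((b + η) * (b + η) + η * η) cross ⟩
        (b + η) * (b + η) + η * η + ((b + η) * η + (b + η) * η)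
                                            ≡⟨ solve 2 (λ b η → (b :+ η) :* (b :+ η) :+ η :* η
                                                 :+ ((b :+ η) :* η :+ (b :+ η) :* η)
                                                 := (b :+ (η :+ η)) :* (b :+ (η :+ η))) refl b η ⟩
        (b + (η + η)) * (b + (η + η))       ≡⟨ cong (λ z → (b + z) * (b + z)) (half+half ε) ⟩
        (b + ε) * (b + ε)                   ∎
        where
        p : 0ℚ ≤ (b + η) * η
        p = subst (_≤ (b + η) * η) (ℚ.*-zeroˡ η)
              (ℚ.*-monoʳ-≤-nonNeg η {{ℚ.nonNegative (ℚ.<⇒≤ 0<η)}} 0≤b+η)
        cross : 0ℚ ≤ (b + η) * η + (b + η) * η
        cross = ℚ.+-mono-≤ p p
      q⊔0< : q ℚ.⊔ 0ℚ < (b + ε) * (b + ε)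
      q⊔0< with ℚ.⊔-sel q 0ℚ
      ... | inj₁ e = subst (_< (b + ε) * (b + ε)) (sym e) q<
      ... | inj₂ e = subst (_< (b + ε) * (b + ε)) (sym e) (*-pos 0<b+ε 0<b+ε)

  approxRoot-dist : ∀ {ε} m n q r → 0ℚ < ε → ∣ q - r ∣ < (½ * ε) * (½ * ε) →
                    + 1 / suc m ≤ ½ * ε → + 1 / suc n ≤ ½ * ε →
                    ∣ approxRoot m q - approxRoot n r ∣ < ε
  approxRoot-dist {ε} m n q r 0<ε q~r um un = ∣∣<⁻
    (dist< m n q r 0<ε (∣∣<⇒< q~r) un)
    (dist< n m r q 0<ε (∣∣<⇒< (subst (_< (½ * ε) * (½ * ε)) (dist-sym q r) q~r)) um)

-- Cauchy sequences of rationals; equality of reals is Real._≈_.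
record ℝ : Set where
  constructor mkℝ
  field
    seq    : ℕ → ℚ
    cauchy : ∀ ε → 0ℚ ℚ.< ε →
             ∃[ N ] ∀ m n → N ℕ.≤ m → N ℕ.≤ n → ℚ.∣ seq m ℚ.- seq n ∣ ℚ.< ε

module Real where
  open ℝ public
  open Estimates

  infix  4 _≈_ _≤_ _<_
  infixl 6 _+_ _-_
  infixl 7 _*_
  infix  8 -_

  _≈_ : Rel ℝ 0ℓ
  x ≈ y = ∀ ε → 0ℚ ℚ.< ε → ∃[ N ] ∀ n → N ℕ.≤ n → ℚ.∣ seq x n ℚ.- seq y n ∣ ℚ.< ε

  _≤_ : Rel ℝ 0ℓ
  x ≤ y = ∀ ε → 0ℚ ℚ.< ε → ∃[ N ] ∀ n → N ℕ.≤ n → seq x n ℚ.< seq y n ℚ.+ ε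

  _<_ : Rel ℝ 0ℓ
  x < y = ∃[ ε ] 0ℚ ℚ.< ε × ∃[ N ] ∀ n → N ℕ.≤ n → seq x n ℚ.+ ε ℚ.< seq y n

  fromℚ : ℚ → ℝ
  fromℚ q = mkℝ (λ _ → q) λ ε 0<ε → 0 , λ _ _ _ _ →
    subst (ℚ._< ε) (cong ℚ.∣_∣ (sym (ℚ.+-inverseʳ q))) 0<ε

  fromℕ : ℕ → ℝ
  fromℕ n = fromℚ (+ n ℚ./ 1)

  0ℝ 1ℝ : ℝ
  0ℝ = fromℚ 0ℚ
  1ℝ = fromℚ 1ℚ

  _+_ : ℝ → ℝ → ℝ
  x + y = mkℝ (λ n → seq x n ℚ.+ seq y n) λ ε 0<ε →
    let N₁ , p = cauchy x (½ ℚ.* ε) (half-pos 0<ε)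
        N₂ , q = cauchy y (½ ℚ.* ε) (half-pos 0<ε)
    in N₁ ℕ.⊔ N₂ , λ m n N≤m N≤n →
         sum-dist (seq x m) (seq y m) (seq x n) (seq y n)
           (p m n (ℕ.m⊔n≤o⇒m≤o N₁ N₂ N≤m) (ℕ.m⊔n≤o⇒m≤o N₁ N₂ N≤n))
           (q m n (ℕ.m⊔n≤o⇒n≤o N₁ N₂ N≤m) (ℕ.m⊔n≤o⇒n≤o N₁ N₂ N≤n))

  -_ : ℝ → ℝ
  - x = mkℝ (λ n → ℚ.- seq x n) λ ε 0<ε →
    let N , p = cauchy x ε 0<ε
    in N , λ m n N≤m N≤n →
         subst (ℚ._< ε) (sym (neg-dist (seq x m) (seq x n))) (p m n N≤m N≤n)

  _-_ : ℝ → ℝ → ℝ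
  x - y = x + (- y)

  eventually-bounded : ∀ x → ∃[ B ] 0ℚ ℚ.< B × ∃[ N ] ∀ n → N ℕ.≤ n → ℚ.∣ seq x n ∣ ℚ.≤ B
  eventually-bounded x with N , p ← cauchy x 1ℚ (ℚ.positive⁻¹ 1ℚ) =
    ℚ.∣ seq x N ∣ ℚ.+ 1ℚ ,
    ℚ.+-mono-≤-< (ℚ.0≤∣p∣ (seq x N)) (ℚ.positive⁻¹ 1ℚ) ,
    N , λ n N≤n → bound (seq x N) (seq x n) (p n N N≤n ℕ.≤-refl)
    where
    bound : ∀ a b → ℚ.∣ b ℚ.- a ∣ ℚ.< 1ℚ → ℚ.∣ b ∣ ℚ.≤ ℚ.∣ a ∣ ℚ.+ 1ℚ
    bound a b p = begin
      ℚ.∣ b ∣                           ≡⟨ cong ℚ.∣_∣ (solve 2 (λ a b → b := a :+ (b :- a)) refl a b) ⟩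
      ℚ.∣ a ℚ.+ (b ℚ.- a) ∣             ≤⟨ ℚ.∣p+q∣≤∣p∣+∣q∣ a (b ℚ.- a) ⟩
      ℚ.∣ a ∣ ℚ.+ ℚ.∣ b ℚ.- a ∣         ≤⟨ ℚ.+-monoʳ-≤ ℚ.∣ a ∣ (ℚ.<⇒≤ p) ⟩
      ℚ.∣ a ∣ ℚ.+ 1ℚ                    ∎
      where
      open ℚ.≤-Reasoning
      open +-*-Solver

  _*_ : ℝ → ℝ → ℝ
  x * y = mkℝ (λ n → seq x n ℚ.* seq y n) λ ε 0<ε →
    let B , 0<B , N₁ , x≤B = eventually-bounded x
        C , 0<C , N₂ , y≤C = eventually-bounded y
        N₃ , p = cauchy x _ (*-pos (half-pos 0<ε) (recip-pos C 0<C))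
        N₄ , q = cauchy y _ (*-pos (half-pos 0<ε) (recip-pos B 0<B))
        N  = (N₁ ℕ.⊔ N₂) ℕ.⊔ (N₃ ℕ.⊔ N₄)
        l₁ : ∀ {k} → N ℕ.≤ k → N₁ ℕ.≤ k
        l₁ N≤k = ℕ.m⊔n≤o⇒m≤o N₁ N₂ (ℕ.m⊔n≤o⇒m≤o _ (N₃ ℕ.⊔ N₄) N≤k)
        l₂ : ∀ {k} → N ℕ.≤ k → N₂ ℕ.≤ k
        l₂ N≤k = ℕ.m⊔n≤o⇒n≤o N₁ N₂ (ℕ.m⊔n≤o⇒m≤o _ (N₃ ℕ.⊔ N₄) N≤k)
        l₃ : ∀ {k} → N ℕ.≤ k → N₃ ℕ.≤ k
        l₃ N≤k = ℕ.m⊔n≤o⇒m≤o N₃ N₄ (ℕ.m⊔n≤o⇒n≤o (N₁ ℕ.⊔ N₂) _ N≤k)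
        l₄ : ∀ {k} → N ℕ.≤ k → N₄ ℕ.≤ k
        l₄ N≤k = ℕ.m⊔n≤o⇒n≤o N₃ N₄ (ℕ.m⊔n≤o⇒n≤o (N₁ ℕ.⊔ N₂) _ N≤k)
    in N , λ m n N≤m N≤n →
         prod-dist 0<B 0<C (seq x m) (seq y m) (seq x n) (seq y n)
           (x≤B m (l₁ N≤m)) (y≤C n (l₂ N≤n))
           (q m n (l₄ N≤m) (l₄ N≤n)) (p m n (l₃ N≤m) (l₃ N≤n))

  -- The square root of the positive part of x.
  √_ : ℝ → ℝ
  √ x = mkℝ (λ n → approxRoot n (seq x n)) λ ε 0<ε →
    let η      = ½ ℚ.* ε
        N₁ , p = cauchy x (η ℚ.* η) (*-pos (half-pos 0<ε) (half-pos 0<ε))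
        N₂ , q = ApproxRoot.unit-small (half-pos 0<ε)
    in N₁ ℕ.⊔ N₂ , λ m n N≤m N≤n →
         ApproxRoot.approxRoot-dist m n (seq x m) (seq x n) 0<ε
           (p m n (ℕ.m⊔n≤o⇒m≤o N₁ N₂ N≤m) (ℕ.m⊔n≤o⇒m≤o N₁ N₂ N≤n))
           (q m (ℕ.m⊔n≤o⇒n≤o N₁ N₂ N≤m))
           (q n (ℕ.m⊔n≤o⇒n≤o N₁ N₂ N≤n))

record ℂ : Set where
  constructor _+i_
  field
    re im : ℝ

module Complex where
  open ℂ public
  open Real using (0ℝ; 1ℝ; √_)

  infix  4 _≈_
  infixl 6 _+_
  infixl 7 _*_

  _≈_ : Rel ℂ 0ℓ
  z ≈ w = (re z Real.≈ re w) × (im z Real.≈ im w)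

  fromℝ : ℝ → ℂ
  fromℝ x = x +i 0ℝ

  0ℂ 1ℂ : ℂ
  0ℂ = fromℝ 0ℝ
  1ℂ = fromℝ 1ℝ

  _+_ : ℂ → ℂ → ℂ
  z + w = (re z Real.+ re w) +i (im z Real.+ im w)

  _*_ : ℂ → ℂ → ℂ
  z * w = (re z Real.* re w Real.- im z Real.* im w) +i
          (re z Real.* im w Real.+ im z Real.* re w)

  ∣_∣ : ℂ → ℝ
  ∣ z ∣ = √ (re z Real.* re z Real.+ im z Real.* im z)

  sum : List ℂ → ℂ
  sum = foldr _+_ 0ℂ

  *-rawMonoid : RawMonoid 0ℓ 0ℓ
  *-rawMonoid = record { Carrier = ℂ ; _≈_ = _≈_ ; _∙_ = _*_ ; ε = 1ℂ }

-- A homomorphism from a group to the monoid (ℂ, ·) takes invertible values,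
-- so this is a homomorphism to ℂˣ.
record Character (G : AbelianGroup c ℓ) : Set (c ⊔ ℓ) where
  open AbelianGroup G using (Carrier; rawMonoid)
  field
    ⟦_⟧                  : Carrier → ℂ
    isMonoidHomomorphism : IsMonoidHomomorphism rawMonoid Complex.*-rawMonoid ⟦_⟧

Nontrivial : {G : AbelianGroup c ℓ} → Character G → Set c
Nontrivial ψ = ¬ (∀ x → Character.⟦ ψ ⟧ x Complex.≈ Complex.1ℂ)

record FiniteRing c ℓ : Set (lsuc (c ⊔ ℓ)) where
  field
    ring : Ring c ℓ
  open Ring ring public
  field
    1≉0         : ¬ (1# ≈ 0#)
    size        : ℕ
    enumeration : Inverse (≡.setoid (Fin size)) setoid

  size≢0 : ℕ.NonZero size
  size≢0 = Fin.nonZeroIndex (Inverse.from enumeration 0#)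

  infix 4 _≈?_
  _≈?_ : B.Decidable _≈_
  _≈?_ = via-injection (Inverse⇒Injection (Symmetry.inverse enumeration)) Fin._≟_

  elements : List Carrier
  elements = map (Inverse.to enumeration) (allFin size)

_≅_ : FiniteRing c ℓ → FiniteRing c′ ℓ′ → Set _
R ≅ S = Σ[ f ∈ (R.Carrier → S.Carrier) ] IsRingIsomorphism R.rawRing S.rawRing f
  where
  module R = FiniteRing R
  module S = FiniteRing S

record TwoSidedIdeal (R : Ring c ℓ) κ : Set (c ⊔ ℓ ⊔ lsuc κ) where
  open Ring R
  field
    member    : Pred Carrier κ
    resp      : member Respects _≈_
    0-closed  : 0# ∈ member
    +-closed  : ∀ {x y} → x ∈ member → y ∈ member → x + y ∈ member
    *-closedˡ : ∀ a {x} → x ∈ member → a * x ∈ member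
    *-closedʳ : ∀ a {x} → x ∈ member → x * a ∈ member

-- Every two-sided ideal with a nonzero element is the whole ring. (A disjunction
-- "zero or everything" for arbitrary ideals would imply excluded middle.) The
-- level c ⊔ ℓ accommodates the ideal generated by an element; 1 ≉ 0 is part of
-- FiniteRing.
IsSimple : FiniteRing c ℓ → Set (lsuc (c ⊔ ℓ))
IsSimple {c} {ℓ} R = (I : TwoSidedIdeal ring (c ⊔ ℓ)) →
  ∀ x → x ∈ TwoSidedIdeal.member I → ¬ (x ≈ 0#) → ∀ y → y ∈ TwoSidedIdeal.member I
  where open FiniteRing R

FinitelyManyUpToIso : (FiniteRing c ℓ → Set κ) → Set _
FinitelyManyUpToIso P =
  Σ[ Ss ∈ List (FiniteRing 0ℓ 0ℓ) ] ∀ R → P R → Any (R ≅_) Ss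

-- Subsets of Rᵈ, given by decidable predicates so that finite sums over them make
-- sense, and their Fourier transforms.
module Salem (R : FiniteRing c ℓ) (d : ℕ) where
  open FiniteRing R

  Rᵈ : AbelianGroup c ℓ
  Rᵈ = abelianGroup (Fin d) +-abelianGroup

  open AbelianGroup Rᵈ public using () renaming (Carrier to Point; _≈_ to _≋_)

  points : List Point
  points = go d
    where
    go : ∀ k → List (Fin k → Carrier)
    go zero    = Vector.[] ∷ []
    go (suc k) = cartesianProductWith Vector._∷_ elements (go k)

  record Subset κ : Set (c ⊔ ℓ ⊔ lsuc κ) where
    field
      member : Pred Point κ
      resp   : member Respects _≋_
      dec    : Decidable member

    members : List Point
    members = filter dec points

    card : ℕ
    card = length members

  ∣R∣ᵈ : ℕ
  ∣R∣ᵈ = size ℕ.^ d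

  1/∣R∣ᵈ : ℝ
  1/∣R∣ᵈ = Real.fromℚ ((+ 1 ℚ./ ∣R∣ᵈ) {{ℕ.m^n≢0 size d {{size≢0}}}})

  fourier : Subset κ → Character Rᵈ → ℂ
  fourier S ψ = Complex.fromℝ 1/∣R∣ᵈ Complex.* Complex.sum (map ⟦_⟧ members)
    where
    open Character ψ
    open Subset S

  IsSalem : ℝ → Subset κ → Set (c ⊔ ℓ)
  IsSalem C S = (ψ : Character Rᵈ) → Nontrivial ψ →
    Complex.∣ fourier S ψ ∣ Real.≤ C Real.* 1/∣R∣ᵈ Real.* Real.√ Real.fromℕ (Subset.card S)

  open MonoidSum *-monoid using () renaming (sum to product; sum-cong-≋ to product-cong)

  -- product x is x₁ * (x₂ * (⋯ * (x_d * 1))).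
  H : Subset ℓ
  H = record
    { member = λ x → product x ≈ 1#
    ; resp   = λ x≋y px≈1 → Ring.trans ring (Ring.sym ring (product-cong x≋y)) px≈1
    ; dec    = λ x → product x ≈? 1#
    }

-- Let e be a primitive idempotent of R, J = e R the minimal right ideal it generates, U the group of
-- units and χ an additive character with χ(e) ≠ 1. For nonzero a ∈ J the character
-- ψ_a(x) = χ(a x₁) of Rᵈ is nontrivial, and its sum over H is |U|^(d-2) f(a) with
-- f(a) = Σ_{v ∈ U} χ(a v). Since J v = J for every unit v and χ is nontrivial on J, the sum of f
-- over J vanishes, while f(0) = |U|. If H is C-Salem, this yields |U|^(d-1) ≤ |J| C |U|^((d-1)/2).
-- On the other hand |J| ≤ 2 |U|, because 1 - e + y is a unit for every y ∈ J with y e ≠ 0. For d > 3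
-- this bounds |U|, hence |J|, hence |R|, as R embeds into the maps J → J.
--
-- The ring is a vector space over 𝔽_p for a prime p, so χ can be taken with values in the p-th roots of
-- unity. These are the powers of (t + i) / (t - i), where t = cot (π / p) is found by bisection.

module Submission where

open import Defs
open import Algebra.Bundles using (CommutativeRing)
import Algebra.Properties.CommutativeMonoid.Sum as CommutativeMonoidSum
import Algebra.Properties.Monoid.Sum as MonoidSum
import Algebra.Properties.Ring as RingProperties
import Algebra.Properties.Semiring.Mult as SemiringMult
import Algebra.Properties.Semiring.Sum as SemiringSum
open import Data.Fin.Base as Fin using (Fin; toℕ; fromℕ<; finToFun; funToFin)
import Data.Fin.Permutation as Perm
import Data.Fin.Properties as Fin
open import Data.Integer.Base as ℤ using ()
open import Data.List.Base
  using (List; []; _∷_; _++_; map; allFin; tabulate; filter; length; lookup; upTo; concatMap;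
         cartesianProduct; cartesianProductWith)
open import Data.List.Membership.Propositional using (lose) renaming (_∈_ to _∈ᴸ_)
open import Data.List.Membership.Propositional.Properties
  using (∈-allFin; ∈-cartesianProduct⁺; ∈-upTo⁺; ∈-filter⁺; ∈-filter⁻; ∈-lookup)
import Data.List.Properties as List
open import Data.List.Relation.Unary.All as All using (All; []; _∷_)
import Data.List.Relation.Unary.All.Properties as All
open import Data.List.Relation.Unary.Any as Any using (Any; here)
import Data.List.Relation.Unary.Any.Properties as Any
open import Data.Nat.Base as ℕ using (ℕ; zero; suc)
open import Data.Nat.Coprimality using (coprime-Bézout; prime⇒coprime)
open import Data.Nat.DivMod using (_%_; m≡m%n+[m/n]*n; m%n<n)
open import Data.Nat.GCD using (module Bézout)
import Data.Nat.ListAction as ℕ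
open import Data.Nat.Primality using (Prime; prime⇒nonZero; prime⇒nonTrivial)
open import Data.Nat.Primality.Factorisation using (factorise; module PrimeFactorisation)
import Data.Nat.Properties as ℕ
import Data.Nat.Solver
open import Data.Product.Base using (Σ-syntax; ∃-syntax; _×_; _,_; proj₁; proj₂)
open import Data.Rational.Base as ℚ using (ℚ; 0ℚ; 1ℚ; ½; ↥_)
import Data.Rational.Properties as ℚ
open import Data.Rational.Solver using (module +-*-Solver)
open import Data.Sum.Base using (_⊎_; inj₁; inj₂)
import Data.Vec.Functional as Vector
open import Function.Base using (_∘_)
open import Function.Bundles using (Inverse)
import Function.Construct.Identity as Identity
open import Level using (Level; _⊔_; Lift; lift; lower; 0ℓ)
open import Relation.Binary.Core using (Rel)
open import Relation.Binary.Definitions using (_Respects_; tri<; tri≈; tri>)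
open import Relation.Binary.PropositionalEquality as ≡ using (_≡_; _≗_; cong; cong₂; subst; subst₂)
open import Relation.Nullary using (¬_; Dec; yes; no; contradiction; ¬?; _×-dec_)
open import Relation.Nullary.Decidable using (decidable-stable; map′)
open import Relation.Unary using (Pred; Decidable)

-- A real number is a Cauchy sequence of rationals, and equalities and signs of reals are
-- undecidable. The estimate is therefore carried out on rationals at one sufficiently late stage n,
-- with explicit error terms. The form (t + i) / (t - i) suits this: for rational t it has modulus
-- exactly 1, and the conditions Im (t + i)ʲ > 0 that steer the bisection can be decided. What fails
-- at finite stages is ζᵖ = 1. So the sum Z of χ over J does not vanish there; translation by e
-- gives (ζ - 1) Z = m (ζᵖ - 1), where m counts the a ∈ J whose exponent wraps around, and Z tends
-- to 0.
--
-- Only lower bounds on real parts are used: the sum of -Re f(a) over nonzero a ∈ J tends to f(0) =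
-- |U|, and every term is bounded by the Salem condition. With h = |H| = |U|^(d-1) and Ĉ a natural
-- number above C this gives h ≤ 2 |U| Ĉ √h + 1, where the 1 absorbs two errors of ½; hence h ≤ 4
-- |U|² Ĉ² + 2. For d > 3 the left side is at least |U|³, so |U| ≤ 4 Ĉ² + 2.

private
  variable
    c ℓ κ κ′ : Level
    A B : Set κ

-- Inequalities in ℚ and the embedding of ℕ.

module RationalLemmas where
  open ≡ using (refl; sym; trans)
  open import Data.Rational.Base using (_+_; _*_; _-_; -_; ∣_∣; _<_; _≤_; _/_)
  open +-*-Solver

  0≤+ : ∀ {a b} → 0ℚ ≤ a → 0ℚ ≤ b → 0ℚ ≤ a + b
  0≤+ = ℚ.+-mono-≤

  0≤* : ∀ {a b} → 0ℚ ≤ a → 0ℚ ≤ b → 0ℚ ≤ a * b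
  0≤* {a} {b} 0≤a 0≤b = subst (_≤ a * b) (ℚ.*-zeroʳ a) (ℚ.*-monoˡ-≤-nonNeg a {{ℚ.nonNegative 0≤a}} 0≤b)

  0≤square : ∀ a → 0ℚ ≤ a * a
  0≤square a with ℚ.≤-total 0ℚ a
  ... | inj₁ 0≤a = 0≤* 0≤a 0≤a
  ... | inj₂ a≤0 = subst (0ℚ ≤_) (solve 1 (λ a → :- a :* :- a := a :* a) refl a)
    (0≤* (ℚ.neg-antimono-≤ a≤0) (ℚ.neg-antimono-≤ a≤0))

  ≤⇒0≤- : ∀ {a b} → a ≤ b → 0ℚ ≤ b - a
  ≤⇒0≤- {a} {b} a≤b = subst (_≤ b - a) (ℚ.+-inverseʳ a) (ℚ.+-monoˡ-≤ (- a) a≤b)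

  ≤-by : ∀ {a b} s → 0ℚ ≤ s → b ≡ a + s → a ≤ b
  ≤-by {a} {b} s 0≤s b≡ = subst₂ _≤_ (ℚ.+-identityʳ a) (sym b≡) (ℚ.+-monoʳ-≤ a 0≤s)

  <-by : ∀ {a b} s → 0ℚ < s → b ≡ a + s → a < b
  <-by {a} {b} s 0<s b≡ = subst₂ _<_ (ℚ.+-identityʳ a) (sym b≡) (ℚ.+-monoʳ-< a 0<s)

  *-mono-≤ : ∀ {a b c d} → 0ℚ ≤ a → a ≤ b → 0ℚ ≤ c → c ≤ d → a * c ≤ b * d
  *-mono-≤ {a} {b} {c} {d} 0≤a a≤b 0≤c c≤d = ℚ.≤-trans
    (ℚ.*-monoˡ-≤-nonNeg a {{ℚ.nonNegative 0≤a}} c≤d)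
    (ℚ.*-monoʳ-≤-nonNeg d {{ℚ.nonNegative (ℚ.≤-trans 0≤c c≤d)}} a≤b)

  ∣∣≤ : ∀ {a b} → a ≤ b → - a ≤ b → ∣ a ∣ ≤ b
  ∣∣≤ {a} p q with ℚ.∣p∣≡p∨∣p∣≡-p a
  ... | inj₁ e = subst (_≤ _) (sym e) p
  ... | inj₂ e = subst (_≤ _) (sym e) q

  p≤∣p∣ : ∀ p → p ≤ ∣ p ∣
  p≤∣p∣ p with ℚ.≤-total 0ℚ p
  ... | inj₁ 0≤p = ℚ.≤-reflexive (sym (ℚ.0≤p⇒∣p∣≡p 0≤p))
  ... | inj₂ p≤0 = ℚ.≤-trans p≤0 (ℚ.0≤∣p∣ p)

  -p≤∣p∣ : ∀ p → - p ≤ ∣ p ∣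
  -p≤∣p∣ p = subst (- p ≤_) (ℚ.∣-p∣≡∣p∣ p) (p≤∣p∣ (- p))

  square-<⁻ : ∀ {a b} → 0ℚ ≤ b → a * a < b * b → a < b
  square-<⁻ {a} {b} 0≤b a²<b² = ℚ.≰⇒> λ b≤a →
    contradiction (ℚ.<-≤-trans a²<b² (Estimates.square-mono 0≤b b≤a)) (ℚ.<-irrefl refl)

  square≤1⇒∣∣≤1 : ∀ {a} → a * a ≤ 1ℚ → ∣ a ∣ ≤ 1ℚ
  square≤1⇒∣∣≤1 {a} a²≤1 = ℚ.≮⇒≥ λ 1<∣a∣ → contradiction
    (ℚ.<-≤-trans (begin-strict
      1ℚ              <⟨ 1<∣a∣ ⟩
      ∣ a ∣           ≡⟨ ℚ.*-identityʳ ∣ a ∣ ⟨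
      ∣ a ∣ * 1ℚ      ≤⟨ ℚ.*-monoˡ-≤-nonNeg ∣ a ∣ {{ℚ.∣-∣-nonNeg a}} (ℚ.<⇒≤ 1<∣a∣) ⟩
      ∣ a ∣ * ∣ a ∣   ≡⟨ ℚ.∣p*q∣≡∣p∣*∣q∣ a a ⟨
      ∣ a * a ∣       ≡⟨ ℚ.0≤p⇒∣p∣≡p (0≤square a) ⟩
      a * a           ∎) a²≤1)
    (ℚ.<-irrefl refl)
    where open ℚ.≤-Reasoning

  -- Abstract, because unfolding the gcd inside _/_ makes conversion checking explode.
  abstract
    fromℕ : ℕ → ℚ
    fromℕ n = ℤ.+ n / 1

    fromℕ≡ : ∀ n → fromℕ n ≡ ℤ.+ n / 1
    fromℕ≡ n = refl

    fromℕ-0 : fromℕ 0 ≡ 0ℚ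
    fromℕ-0 = refl

    fromℕ-suc : ∀ n → fromℕ (suc n) ≡ fromℕ n + 1ℚ
    fromℕ-suc n = ApproxRoot.step n 0

    0≤fromℕ : ∀ n → 0ℚ ≤ fromℕ n
    0≤fromℕ n = ℚ.nonNegative⁻¹ (ℤ.+ n / 1) {{ℚ.normalize-nonNeg n 1}}

    below-fromℕ : ∀ q → q ≤ fromℕ ℤ.∣ ↥ q ∣
    below-fromℕ = ApproxRoot.below-numerator

  fromℕ-1 : fromℕ 1 ≡ 1ℚ
  fromℕ-1 = trans (fromℕ-suc 0) (cong (_+ 1ℚ) fromℕ-0)

  fromℕ-+ : ∀ m n → fromℕ (m ℕ.+ n) ≡ fromℕ m + fromℕ n
  fromℕ-+ zero    n = sym (trans (cong (_+ fromℕ n) fromℕ-0) (ℚ.+-identityˡ (fromℕ n)))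
  fromℕ-+ (suc m) n = trans (fromℕ-suc (m ℕ.+ n)) (trans (cong (_+ 1ℚ) (fromℕ-+ m n))
    (trans (solve 2 (λ a b → a :+ b :+ con 1ℚ := (a :+ con 1ℚ) :+ b) refl (fromℕ m) (fromℕ n))
      (cong (_+ fromℕ n) (sym (fromℕ-suc m)))))

  fromℕ-* : ∀ m n → fromℕ (m ℕ.* n) ≡ fromℕ m * fromℕ n
  fromℕ-* zero    n = trans fromℕ-0 (sym (trans (cong (_* fromℕ n) fromℕ-0) (ℚ.*-zeroˡ (fromℕ n))))
  fromℕ-* (suc m) n = trans (fromℕ-+ n (m ℕ.* n)) (trans (cong (fromℕ n +_) (fromℕ-* m n))
    (trans (solve 2 (λ a b → b :+ a :* b := (a :+ con 1ℚ) :* b) refl (fromℕ m) (fromℕ n))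
      (cong (_* fromℕ n) (sym (fromℕ-suc m)))))

  fromℕ-mono-≤ : ∀ {m n} → m ℕ.≤ n → fromℕ m ≤ fromℕ n
  fromℕ-mono-≤ {m} m≤n with k , refl ← ℕ.m≤n⇒∃[o]m+o≡n m≤n =
    ≤-by (fromℕ k) (0≤fromℕ k) (fromℕ-+ m k)

  fromℕ-cancel-≤ : ∀ {m n} → fromℕ m ≤ fromℕ n → m ℕ.≤ n
  fromℕ-cancel-≤ {m} {n} le = ℕ.≮⇒≥ λ n<m → contradiction
    (ℚ.<-≤-trans (<-by 1ℚ (ℚ.positive⁻¹ 1ℚ) (fromℕ-suc n)) (ℚ.≤-trans (fromℕ-mono-≤ n<m) le))
    (ℚ.<-irrefl refl)

-- Null sequences of rationals.

module Sequences where
  open ≡ using (refl; sym; trans)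
  open import Data.Rational.Base using (_+_; _*_; ∣_∣; _<_; _≤_)
  open RationalLemmas
  open Estimates using (half-pos; half+half; *-pos; recip-pos; cancel-recip)

  -- A record and not the bare Σ-type that occurs in `Real._≤_`, so that unification can recover the
  -- predicate.
  record Eventually (P : ℕ → Set κ) : Set κ where
    constructor after
    field
      start : ℕ
      holds : ∀ n → start ℕ.≤ n → P n

  eventually-map : ∀ {P : ℕ → Set κ} {Q : ℕ → Set κ′} → (∀ n → P n → Q n) → Eventually P → Eventually Q
  eventually-map f (after N p) = after N λ n N≤n → f n (p n N≤n)

  eventually-× : ∀ {P : ℕ → Set κ} {Q : ℕ → Set κ′} → Eventually P → Eventually Q → Eventually (λ n → P n × Q n)
  eventually-× (after M p) (after N q) = after (M ℕ.⊔ N) λ n le →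
    p n (ℕ.m⊔n≤o⇒m≤o M N le) , q n (ℕ.m⊔n≤o⇒n≤o M N le)

  -- Finitely many starting stages have a maximum. The index sets in use are the exponents up to p
  -- and the elements of R.
  eventually-∀ : ∀ {k} {P : Fin k → ℕ → Set κ} → (∀ i → Eventually (P i)) →
                 Eventually (λ n → ∀ i → P i n)
  eventually-∀ {k = zero}  _ = after 0 λ _ _ ()
  eventually-∀ {k = suc k} p = eventually-map
    (λ { n (h , t) Fin.zero → h ; n (h , t) (Fin.suc i) → t i })
    (eventually-× (p Fin.zero) (eventually-∀ (λ i → p (Fin.suc i))))

  Null : (ℕ → ℚ) → Set
  Null u = ∀ ε → 0ℚ < ε → Eventually (λ n → ∣ u n ∣ < ε)

  null-squeeze : ∀ {u v} → (∀ n → ∣ v n ∣ ≤ ∣ u n ∣) → Null u → Null v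
  null-squeeze le null ε 0<ε = eventually-map (λ n → ℚ.≤-<-trans (le n)) (null ε 0<ε)

  null-cong : ∀ {u v} → (∀ n → v n ≡ u n) → Null u → Null v
  null-cong eq = null-squeeze (λ n → ℚ.≤-reflexive (cong ∣_∣ (eq n)))

  null-0 : Null (λ _ → 0ℚ)
  null-0 ε 0<ε = after 0 λ _ _ → 0<ε

  null-+ : ∀ {u v} → Null u → Null v → Null (λ n → u n + v n)
  null-+ {u} {v} p q ε 0<ε = eventually-map
    (λ n (a , b) → ℚ.≤-<-trans (ℚ.∣p+q∣≤∣p∣+∣q∣ (u n) (v n))
      (subst (∣ u n ∣ + ∣ v n ∣ <_) (half+half ε) (ℚ.+-mono-< a b)))
    (eventually-× (p _ (half-pos 0<ε)) (q _ (half-pos 0<ε)))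

  null-* : ∀ {u} (b : ℕ → ℚ) (B : ℚ) → 0ℚ < B → (∀ n → ∣ b n ∣ ≤ B) → Null u → Null (λ n → b n * u n)
  null-* {u} b B 0<B b≤B null ε 0<ε = eventually-map
    (λ n u< → begin-strict
      ∣ b n * u n ∣         ≡⟨ ℚ.∣p*q∣≡∣p∣*∣q∣ (b n) (u n) ⟩
      ∣ b n ∣ * ∣ u n ∣     ≤⟨ ℚ.*-monoʳ-≤-nonNeg ∣ u n ∣ {{ℚ.∣-∣-nonNeg (u n)}} (b≤B n) ⟩
      B * ∣ u n ∣           <⟨ ℚ.*-monoʳ-<-pos B {{ℚ.positive 0<B}} u< ⟩
      B * (ε * 1/B)         ≡⟨ cancel-recip B 0<B ε ⟩
      ε                     ∎)
    (null (ε * 1/B) (*-pos 0<ε (recip-pos B 0<B)))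
    where
    open ℚ.≤-Reasoning
    1/B = (ℚ.1/ B) {{ℚ.>-nonZero 0<B}}

  null-*-const : ∀ {u} c → Null u → Null (λ n → c * u n)
  null-*-const c = null-* (λ _ → c) (∣ c ∣ + 1ℚ)
    (ℚ.+-mono-≤-< (ℚ.0≤∣p∣ c) (ℚ.positive⁻¹ 1ℚ))
    (λ _ → ≤-by 1ℚ (ℚ.nonNegative⁻¹ 1ℚ) refl)

  abstract
    archimedean : ∀ {ε} T → 0ℚ < ε → ∃[ m ] T ≤ ε * fromℕ m
    -- The witness is the absolute value of the numerator of T / ε.
    archimedean {ε} T 0<ε = _ , subst (_≤ ε * fromℕ ℤ.∣ ↥ (T * (ℚ.1/ ε) {{ℚ.>-nonZero 0<ε}}) ∣) (cancel-recip ε 0<ε T)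
      (ℚ.*-monoˡ-≤-nonNeg ε {{ℚ.nonNegative (ℚ.<⇒≤ 0<ε)}} (below-fromℕ _))

  -- Decay like 1 / (n + 1) is enough and spares powers of 2: a factor ½ outweighs the passage from
  -- n + 1 to n + 2.
  halving-bound : ∀ {w : ℕ → ℚ} → 0ℚ ≤ w 0 → (∀ n → w (suc n) ≡ ½ * w n) →
                  ∀ n → 0ℚ ≤ w n × w n * fromℕ (suc n) ≤ w 0
  halving-bound {w} 0≤w halve zero = 0≤w , ℚ.≤-reflexive (trans (cong (w 0 *_) fromℕ-1) (ℚ.*-identityʳ (w 0)))
  halving-bound {w} 0≤w halve (suc n) with 0≤wn , wn≤ ← halving-bound {w} 0≤w halve n =
    subst (0ℚ ≤_) (sym (halve n)) (0≤* (ℚ.nonNegative⁻¹ ½) 0≤wn) ,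
    ℚ.≤-trans (≤-by (½ * (w n * k)) (0≤* (ℚ.nonNegative⁻¹ ½) (0≤* 0≤wn (0≤fromℕ n))) eq) wn≤
    where
    open +-*-Solver
    k = fromℕ n
    eq : w n * fromℕ (suc n) ≡ w (suc n) * fromℕ (suc (suc n)) + ½ * (w n * k)
    eq = trans (cong (w n *_) (fromℕ-suc n)) (trans
      (solve 2 (λ w k → w :* (k :+ con 1ℚ) := con ½ :* w :* (k :+ con 1ℚ :+ con 1ℚ) :+ con ½ :* (w :* k))
        refl (w n) k)
      (cong₂ (λ x y → x * y + ½ * (w n * k)) (sym (halve n))
        (sym (trans (fromℕ-suc (suc n)) (cong (_+ 1ℚ) (fromℕ-suc n))))))

  null-halving : ∀ {w : ℕ → ℚ} → 0ℚ ≤ w 0 → (∀ n → w (suc n) ≡ ½ * w n) → Null w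
  null-halving {w} 0≤w halve ε 0<ε with m , T≤ ← archimedean (w 0) 0<ε = after m λ n m≤n →
    let 0≤wn , wn≤ = halving-bound {w} 0≤w halve n in
    subst (_< ε) (sym (ℚ.0≤p⇒∣p∣≡p 0≤wn)) (ℚ.≰⇒> λ ε≤wn → ℚ.<-irrefl refl (begin-strict
      w 0                   ≤⟨ T≤ ⟩
      ε * fromℕ m           ≤⟨ ℚ.*-monoˡ-≤-nonNeg ε {{ℚ.nonNegative (ℚ.<⇒≤ 0<ε)}} (fromℕ-mono-≤ m≤n) ⟩
      ε * fromℕ n           <⟨ ℚ.*-monoʳ-<-pos ε {{ℚ.positive 0<ε}}
                               (<-by 1ℚ (ℚ.positive⁻¹ 1ℚ) (fromℕ-suc n)) ⟩
      ε * fromℕ (suc n)     ≤⟨ ℚ.*-monoʳ-≤-nonNeg (fromℕ (suc n)) {{ℚ.nonNegative (0≤fromℕ (suc n))}} ε≤wn ⟩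
      w n * fromℕ (suc n)   ≤⟨ wn≤ ⟩
      w 0                   ∎))
    where open ℚ.≤-Reasoning

-- Powers of Gaussian rationals.

module GaussianPowers where
  open ≡ using (refl; sym; trans)
  open import Data.Rational.Base using (_+_; _*_; _-_; -_; ∣_∣; _≤_)
  open RationalLemmas
  open +-*-Solver

  -- The real and imaginary parts of (a + bi)ᵏ.
  reᴾ imᴾ : (a b : ℚ) → ℕ → ℚ
  reᴾ a b zero    = 1ℚ
  reᴾ a b (suc k) = a * reᴾ a b k - b * imᴾ a b k
  imᴾ a b zero    = 0ℚ
  imᴾ a b (suc k) = a * imᴾ a b k + b * reᴾ a b k

  norm : ℚ → ℚ → ℚ
  norm x y = x * x + y * y

  norm-suc : ∀ a b k → norm (reᴾ a b (suc k)) (imᴾ a b (suc k)) ≡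
                       norm a b * norm (reᴾ a b k) (imᴾ a b k)
  norm-suc a b k = solve 4 (λ a b x y →
      (a :* x :- b :* y) :* (a :* x :- b :* y) :+ (a :* y :+ b :* x) :* (a :* y :+ b :* x)
      := (a :* a :+ b :* b) :* (x :* x :+ y :* y))
    refl a b (reᴾ a b k) (imᴾ a b k)

  1≤norm : ∀ {a b} → 1ℚ ≤ norm a b → ∀ k → 1ℚ ≤ norm (reᴾ a b k) (imᴾ a b k)
  1≤norm 1≤ zero = ℚ.≤-refl
  1≤norm {a} {b} 1≤ (suc k) = subst (1ℚ ≤_) (sym (norm-suc a b k))
    (*-mono-≤ (ℚ.nonNegative⁻¹ 1ℚ) 1≤ (ℚ.nonNegative⁻¹ 1ℚ) (1≤norm {a} {b} 1≤ k))

  norm≡1 : ∀ {a b} → norm a b ≡ 1ℚ → ∀ k → norm (reᴾ a b k) (imᴾ a b k) ≡ 1ℚ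
  norm≡1 ≡1 zero = refl
  norm≡1 {a} {b} ≡1 (suc k) = trans (norm-suc a b k) (cong₂ _*_ ≡1 (norm≡1 {a} {b} ≡1 k))

  norm≤1⇒re≤1 : ∀ {x y} → norm x y ≤ 1ℚ → ∣ x ∣ ≤ 1ℚ
  norm≤1⇒re≤1 {x} {y} le = square≤1⇒∣∣≤1 {x} (ℚ.≤-trans (≤-by (y * y) (0≤square y) refl) le)

  norm≤1⇒im≤1 : ∀ {x y} → norm x y ≤ 1ℚ → ∣ y ∣ ≤ 1ℚ
  norm≤1⇒im≤1 {x} {y} le = square≤1⇒∣∣≤1 {y}
    (ℚ.≤-trans (≤-by (x * x) (0≤square x) (ℚ.+-comm (x * x) (y * y))) le)

  reᴾ-+ : ∀ a b j k → reᴾ a b (j ℕ.+ k) ≡ reᴾ a b j * reᴾ a b k - imᴾ a b j * imᴾ a b k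
  imᴾ-+ : ∀ a b j k → imᴾ a b (j ℕ.+ k) ≡ reᴾ a b j * imᴾ a b k + imᴾ a b j * reᴾ a b k
  reᴾ-+ a b zero k = solve 2 (λ x y → x := con 1ℚ :* x :- con 0ℚ :* y) refl (reᴾ a b k) (imᴾ a b k)
  reᴾ-+ a b (suc j) k = trans (cong₂ (λ x y → a * x - b * y) (reᴾ-+ a b j k) (imᴾ-+ a b j k))
    (solve 6 (λ a b x y u v → a :* (x :* u :- y :* v) :- b :* (x :* v :+ y :* u)
       := (a :* x :- b :* y) :* u :- (a :* y :+ b :* x) :* v)
      refl a b (reᴾ a b j) (imᴾ a b j) (reᴾ a b k) (imᴾ a b k))
  imᴾ-+ a b zero k = solve 2 (λ x y → y := con 1ℚ :* y :+ con 0ℚ :* x) refl (reᴾ a b k) (imᴾ a b k)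
  imᴾ-+ a b (suc j) k = trans (cong₂ (λ x y → a * y + b * x) (reᴾ-+ a b j k) (imᴾ-+ a b j k))
    (solve 6 (λ a b x y u v → a :* (x :* v :+ y :* u) :+ b :* (x :* u :- y :* v)
       := (a :* x :- b :* y) :* v :+ (a :* y :+ b :* x) :* u)
      refl a b (reᴾ a b j) (imᴾ a b j) (reᴾ a b k) (imᴾ a b k))

  -- The powers of w (t + i)², expressed by those of t + i.
  record SquarePower (w t : ℚ) (k : ℕ) : Set where
    private
      X = reᴾ t 1ℚ k
      Y = imᴾ t 1ℚ k
    field
      scale   : ℚ
      0≤scale : 0ℚ ≤ scale
      unit    : scale * norm X Y ≡ 1ℚ
      re≡     : reᴾ (w * (t * t - 1ℚ)) (w * (t + t)) k ≡ scale * (X * X - Y * Y)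
      im≡     : imᴾ (w * (t * t - 1ℚ)) (w * (t + t)) k ≡ scale * (X * Y + X * Y)

  -- As w is the reciprocal of t² + 1, the number w (t + i)² is (t + i) / (t - i); `scale` is w to
  -- the power k.
  squarePower : ∀ {w t} → 0ℚ ≤ w → w * norm t 1ℚ ≡ 1ℚ → ∀ k → SquarePower w t k
  squarePower 0≤w unit zero = record
    { scale = 1ℚ ; 0≤scale = ℚ.nonNegative⁻¹ 1ℚ ; unit = refl ; re≡ = refl ; im≡ = refl }
  squarePower {w} {t} 0≤w unit (suc k) = record
    { scale   = w * W
    ; 0≤scale = 0≤* 0≤w S.0≤scale
    ; unit    = trans (cong (w * W *_) (norm-suc t 1ℚ k)) (trans
        (solve 4 (λ w W n m → w :* W :* (n :* m) := (w :* n) :* (W :* m)) refl w W (norm t 1ℚ) (norm X Y))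
        (cong₂ _*_ unit S.unit))
    ; re≡     = trans (cong₂ (λ x y → w * (t * t - 1ℚ) * x - w * (t + t) * y) S.re≡ S.im≡)
        (solve 5 (λ w t W X Y →
            w :* (t :* t :- con 1ℚ) :* (W :* (X :* X :- Y :* Y)) :- w :* (t :+ t) :* (W :* (X :* Y :+ X :* Y))
            := w :* W :* ((t :* X :- con 1ℚ :* Y) :* (t :* X :- con 1ℚ :* Y)
                 :- (t :* Y :+ con 1ℚ :* X) :* (t :* Y :+ con 1ℚ :* X)))
          refl w t W X Y)
    ; im≡     = trans (cong₂ (λ x y → w * (t * t - 1ℚ) * y + w * (t + t) * x) S.re≡ S.im≡)
        (solve 5 (λ w t W X Y →
            w :* (t :* t :- con 1ℚ) :* (W :* (X :* Y :+ X :* Y)) :+ w :* (t :+ t) :* (W :* (X :* X :- Y :* Y))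
            := w :* W :* ((t :* X :- con 1ℚ :* Y) :* (t :* Y :+ con 1ℚ :* X)
                 :+ (t :* X :- con 1ℚ :* Y) :* (t :* Y :+ con 1ℚ :* X)))
          refl w t W X Y)
    }
    where
    module S = SquarePower (squarePower {w} {t} 0≤w unit k)
    open S using () renaming (scale to W)
    X = reᴾ t 1ℚ k
    Y = imᴾ t 1ℚ k

-- Lipschitz constants on [0, T] for the parts of (t + i)ᵏ.

module Lipschitz (T : ℚ) where
  open ≡ using (refl; sym; trans)
  open import Data.Rational.Base using (_+_; _*_; _-_; -_; ∣_∣; _≤_)
  open RationalLemmas
  open +-*-Solver

  -- The bound `M` accompanies the Lipschitz constant `L` because the constant of a product involves
  -- both.
  record Lip (f : ℚ → ℚ) : Set where
    field
      M L : ℚ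
      0≤M : 0ℚ ≤ M
      0≤L : 0ℚ ≤ L
      bounded   : ∀ a → 0ℚ ≤ a → a ≤ T → ∣ f a ∣ ≤ M
      lipschitz : ∀ a b → 0ℚ ≤ a → a ≤ T → 0ℚ ≤ b → b ≤ T → ∣ f a - f b ∣ ≤ L * ∣ a - b ∣

  open Lip

  lip-const : ∀ c → Lip (λ _ → c)
  lip-const c = record
    { M = ∣ c ∣ ; L = 0ℚ ; 0≤M = ℚ.0≤∣p∣ c ; 0≤L = ℚ.≤-refl
    ; bounded = λ _ _ _ → ℚ.≤-refl
    ; lipschitz = λ a b _ _ _ _ → ℚ.≤-reflexive
        (trans (cong ∣_∣ (ℚ.+-inverseʳ c)) (sym (ℚ.*-zeroˡ ∣ a - b ∣)))
    }

  lip-id : 0ℚ ≤ T → Lip (λ a → a)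
  lip-id 0≤T = record
    { M = T ; L = 1ℚ ; 0≤M = 0≤T ; 0≤L = ℚ.nonNegative⁻¹ 1ℚ
    ; bounded = λ a 0≤a a≤T → subst (_≤ T) (sym (ℚ.0≤p⇒∣p∣≡p 0≤a)) a≤T
    ; lipschitz = λ a b _ _ _ _ → ℚ.≤-reflexive (sym (ℚ.*-identityˡ ∣ a - b ∣))
    }

  lip-+ : ∀ {f g} → Lip f → Lip g → Lip (λ a → f a + g a)
  lip-+ {f} {g} F G = record
    { M = M F + M G ; L = L F + L G ; 0≤M = 0≤+ (0≤M F) (0≤M G) ; 0≤L = 0≤+ (0≤L F) (0≤L G)
    ; bounded = λ a p q → ℚ.≤-trans (ℚ.∣p+q∣≤∣p∣+∣q∣ (f a) (g a))
        (ℚ.+-mono-≤ (bounded F a p q) (bounded G a p q))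
    ; lipschitz = λ a b p q r s → begin
        ∣ (f a + g a) - (f b + g b) ∣         ≡⟨ cong ∣_∣ (solve 4 (λ x y z w →
            (x :+ y) :- (z :+ w) := (x :- z) :+ (y :- w)) refl (f a) (g a) (f b) (g b)) ⟩
        ∣ (f a - f b) + (g a - g b) ∣         ≤⟨ ℚ.∣p+q∣≤∣p∣+∣q∣ (f a - f b) (g a - g b) ⟩
        ∣ f a - f b ∣ + ∣ g a - g b ∣         ≤⟨ ℚ.+-mono-≤ (lipschitz F a b p q r s) (lipschitz G a b p q r s) ⟩
        L F * ∣ a - b ∣ + L G * ∣ a - b ∣     ≡⟨ ℚ.*-distribʳ-+ ∣ a - b ∣ (L F) (L G) ⟨
        (L F + L G) * ∣ a - b ∣               ∎
    }
    where open ℚ.≤-Reasoning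

  lip-* : ∀ {f g} → Lip f → Lip g → Lip (λ a → f a * g a)
  lip-* {f} {g} F G = record
    { M = M F * M G ; L = M F * L G + M G * L F
    ; 0≤M = 0≤* (0≤M F) (0≤M G) ; 0≤L = 0≤+ (0≤* (0≤M F) (0≤L G)) (0≤* (0≤M G) (0≤L F))
    ; bounded = λ a p q → subst (_≤ M F * M G) (sym (ℚ.∣p*q∣≡∣p∣*∣q∣ (f a) (g a)))
        (*-mono-≤ (ℚ.0≤∣p∣ (f a)) (bounded F a p q) (ℚ.0≤∣p∣ (g a)) (bounded G a p q))
    ; lipschitz = λ a b p q r s → begin
        ∣ f a * g a - f b * g b ∣                       ≡⟨ cong ∣_∣ (solve 4 (λ x y z w →
            x :* y :- z :* w := x :* (y :- w) :+ w :* (x :- z)) refl (f a) (g a) (f b) (g b)) ⟩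
        ∣ f a * (g a - g b) + g b * (f a - f b) ∣       ≤⟨ ℚ.∣p+q∣≤∣p∣+∣q∣ (f a * (g a - g b)) (g b * (f a - f b)) ⟩
        ∣ f a * (g a - g b) ∣ + ∣ g b * (f a - f b) ∣   ≡⟨ cong₂ _+_ (ℚ.∣p*q∣≡∣p∣*∣q∣ (f a) (g a - g b))
                                                                     (ℚ.∣p*q∣≡∣p∣*∣q∣ (g b) (f a - f b)) ⟩
        ∣ f a ∣ * ∣ g a - g b ∣ + ∣ g b ∣ * ∣ f a - f b ∣
          ≤⟨ ℚ.+-mono-≤
               (*-mono-≤ (ℚ.0≤∣p∣ (f a)) (bounded F a p q) (ℚ.0≤∣p∣ (g a - g b)) (lipschitz G a b p q r s))
               (*-mono-≤ (ℚ.0≤∣p∣ (g b)) (bounded G b r s) (ℚ.0≤∣p∣ (f a - f b)) (lipschitz F a b p q r s)) ⟩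
        M F * (L G * ∣ a - b ∣) + M G * (L F * ∣ a - b ∣)
          ≡⟨ solve 5 (λ m n l k d → m :* (l :* d) :+ n :* (k :* d) := (m :* l :+ n :* k) :* d)
               refl (M F) (M G) (L G) (L F) ∣ a - b ∣ ⟩
        (M F * L G + M G * L F) * ∣ a - b ∣             ∎
    }
    where open ℚ.≤-Reasoning

  lip-neg : ∀ {f} → Lip f → Lip (λ a → - f a)
  lip-neg {f} F = record
    { M = M F ; L = L F ; 0≤M = 0≤M F ; 0≤L = 0≤L F
    ; bounded = λ a p q → subst (_≤ M F) (sym (ℚ.∣-p∣≡∣p∣ (f a))) (bounded F a p q)
    ; lipschitz = λ a b p q r s → subst (_≤ L F * ∣ a - b ∣) (sym (Estimates.neg-dist (f a) (f b)))
        (lipschitz F a b p q r s)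
    }

  open GaussianPowers

  lip-re : 0ℚ ≤ T → ∀ k → Lip (λ t → reᴾ t 1ℚ k)
  lip-im : 0ℚ ≤ T → ∀ k → Lip (λ t → imᴾ t 1ℚ k)
  lip-re 0≤T zero    = lip-const 1ℚ
  lip-re 0≤T (suc k) = lip-+ (lip-* (lip-id 0≤T) (lip-re 0≤T k))
                             (lip-neg (lip-* (lip-const 1ℚ) (lip-im 0≤T k)))
  lip-im 0≤T zero    = lip-const 0ℚ
  lip-im 0≤T (suc k) = lip-+ (lip-* (lip-id 0≤T) (lip-im 0≤T k)) (lip-* (lip-const 1ℚ) (lip-re 0≤T k))

-- Bisection for a decidable predicate.

module Bisection {P : ℚ → Set} (P? : Decidable P) {T : ℚ} (0≤T : 0ℚ ℚ.≤ T)
                 (¬P0 : ¬ P 0ℚ) (PT : P T) where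
  open ≡ using (refl)
  open import Data.Rational.Base using (_+_; _*_; _-_; -_; ∣_∣; _<_; _≤_)
  open RationalLemmas
  open Sequences
  open +-*-Solver

  -- `P` may change its truth value many times between the ends; what matters is that ends with
  -- opposite truth values approach each other.
  record Bracket : Set where
    constructor bracket
    field
      lo hi : ℚ
      lo≤hi : lo ≤ hi
      ¬Plo  : ¬ P lo
      Phi   : P hi

  open Bracket

  middle : Bracket → ℚ
  middle b = ½ * (lo b + hi b)

  lo≤middle : ∀ b → lo b ≤ middle b
  lo≤middle b = ≤-by (½ * (hi b - lo b)) (0≤* (ℚ.nonNegative⁻¹ ½) (≤⇒0≤- (lo≤hi b)))
    (solve 2 (λ l h → con ½ :* (l :+ h) := l :+ con ½ :* (h :- l)) refl (lo b) (hi b))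

  middle≤hi : ∀ b → middle b ≤ hi b
  middle≤hi b = ≤-by (½ * (hi b - lo b)) (0≤* (ℚ.nonNegative⁻¹ ½) (≤⇒0≤- (lo≤hi b)))
    (solve 2 (λ l h → h := con ½ :* (l :+ h) :+ con ½ :* (h :- l)) refl (lo b) (hi b))

  halve : (b : Bracket) → Dec (P (middle b)) → Bracket
  halve b (yes p) = bracket (lo b) (middle b) (lo≤middle b) (¬Plo b) p
  halve b (no ¬p) = bracket (middle b) (hi b) (middle≤hi b) ¬p (Phi b)

  brackets : ℕ → Bracket
  brackets zero    = bracket 0ℚ T 0≤T ¬P0 PT
  brackets (suc n) = halve (brackets n) (P? (middle (brackets n)))

  width : ℕ → ℚ
  width n = hi (brackets n) - lo (brackets n)

  halve-width : ∀ b d → hi (halve b d) - lo (halve b d) ≡ ½ * (hi b - lo b)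
  halve-width b (yes _) = solve 2 (λ l h → con ½ :* (l :+ h) :- l := con ½ :* (h :- l)) refl (lo b) (hi b)
  halve-width b (no _)  = solve 2 (λ l h → h :- con ½ :* (l :+ h) := con ½ :* (h :- l)) refl (lo b) (hi b)

  null-width : Null width
  null-width = null-halving (≤⇒0≤- 0≤T) (λ n → halve-width (brackets n) (P? (middle (brackets n))))

  0≤width : ∀ n → 0ℚ ≤ width n
  0≤width n = ≤⇒0≤- (lo≤hi (brackets n))

  halve-lo : ∀ b d → lo b ≤ lo (halve b d)
  halve-lo b (yes _) = ℚ.≤-refl
  halve-lo b (no _)  = lo≤middle b

  halve-hi : ∀ b d → hi (halve b d) ≤ hi b
  halve-hi b (yes _) = middle≤hi b
  halve-hi b (no _)  = ℚ.≤-refl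

  lo-mono : ∀ m k → lo (brackets m) ≤ lo (brackets (k ℕ.+ m))
  lo-mono m zero    = ℚ.≤-refl
  lo-mono m (suc k) = ℚ.≤-trans (lo-mono m k) (halve-lo (brackets (k ℕ.+ m)) (P? (middle (brackets (k ℕ.+ m)))))

  hi-mono : ∀ m k → hi (brackets (k ℕ.+ m)) ≤ hi (brackets m)
  hi-mono m zero    = ℚ.≤-refl
  hi-mono m (suc k) = ℚ.≤-trans (halve-hi (brackets (k ℕ.+ m)) (P? (middle (brackets (k ℕ.+ m))))) (hi-mono m k)

  split : ∀ {m n} → m ℕ.≤ n → ∃[ k ] k ℕ.+ m ≡ n
  split {m} {n} m≤n = n ℕ.∸ m , ℕ.m∸n+n≡m m≤n

  0≤lo : ∀ n → 0ℚ ≤ lo (brackets n)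
  0≤lo n = subst (λ n → 0ℚ ≤ lo (brackets n)) (ℕ.+-identityʳ n) (lo-mono 0 n)

  hi≤T : ∀ n → hi (brackets n) ≤ T
  hi≤T n = subst (λ n → hi (brackets n) ≤ T) (ℕ.+-identityʳ n) (hi-mono 0 n)

  within : ∀ {N n} → N ℕ.≤ n → lo (brackets N) ≤ hi (brackets n) × hi (brackets n) ≤ hi (brackets N)
  within {N} N≤n with k , refl ← split N≤n =
    ℚ.≤-trans (lo-mono N k) (lo≤hi (brackets (k ℕ.+ N))) , hi-mono N k

  dist≤width : ∀ {N m n} → N ℕ.≤ m → N ℕ.≤ n → ∣ hi (brackets m) - hi (brackets n) ∣ ≤ width N
  dist≤width {N} {m} {n} N≤m N≤n =
    ∣∣≤ (ℚ.+-mono-≤ (proj₂ (within N≤m)) (ℚ.neg-antimono-≤ (proj₁ (within N≤n))))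
        (subst (_≤ width N)
          (solve 2 (λ a b → b :- a := :- (a :- b)) refl (hi (brackets m)) (hi (brackets n)))
          (ℚ.+-mono-≤ (proj₂ (within N≤n)) (ℚ.neg-antimono-≤ (proj₁ (within N≤m)))))

  -- The upper ends are taken, so that `P` holds at every stage of the approximation.
  limit : ℝ
  limit = mkℝ (λ n → hi (brackets n)) λ ε 0<ε →
    let after N small = null-width ε 0<ε in
    N , λ m n N≤m N≤n → ℚ.≤-<-trans (dist≤width N≤m N≤n)
      (subst (_< ε) (ℚ.0≤p⇒∣p∣≡p (0≤width N)) (small N ℕ.≤-refl))

-- Approximation of cot (π / p).

module RootOfUnity (p : ℕ) (2≤p : 2 ℕ.≤ p) where
  open ≡ using (refl; sym; trans)
  open import Data.Rational.Base using (_+_; _*_; _-_; -_; ∣_∣; _<_; _≤_)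
  open RationalLemmas
  open Sequences
  open GaussianPowers
  open +-*-Solver

  p̂ T : ℚ
  p̂ = fromℕ p
  -- A safe upper end of the search, since cot (π / p) < p / π.
  T = p̂ + p̂

  0<p̂ : 0ℚ < p̂
  0<p̂ = ℚ.<-≤-trans (ℚ.positive⁻¹ 1ℚ) (subst (_≤ p̂) fromℕ-1 (fromℕ-mono-≤ (ℕ.≤-trans (ℕ.n≤1+n 1) 2≤p)))

  0≤T : 0ℚ ≤ T
  0≤T = 0≤+ (0≤fromℕ p) (0≤fromℕ p)

  open Lipschitz T using (module Lip; lip-im)

  -- The argument of t + i is less than π / p.
  Low : ℚ → Set
  Low t = ∀ (j : Fin p) → 0ℚ < imᴾ t 1ℚ (suc (toℕ j))

  low? : Decidable Low
  low? t = Fin.all? (λ j → 0ℚ ℚ.<? imᴾ t 1ℚ (suc (toℕ j)))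

  -- The second power of i is -1, whose imaginary part is not positive.
  ¬low-0 : ¬ Low 0ℚ
  ¬low-0 low = ℚ.<-irrefl refl (subst (λ k → 0ℚ < imᴾ 0ℚ 1ℚ (suc k)) (Fin.toℕ-fromℕ< 2≤p) (low (fromℕ< 2≤p)))

  private
    slope : ∀ k → k ℕ.≤ p → 0ℚ < reᴾ T 1ℚ k × 0ℚ ≤ imᴾ T 1ℚ k × p̂ * imᴾ T 1ℚ k ≤ fromℕ k * reᴾ T 1ℚ k
    slope zero _ = ℚ.positive⁻¹ 1ℚ , ℚ.≤-refl ,
      ℚ.≤-reflexive (trans (ℚ.*-zeroʳ p̂) (sym (trans (ℚ.*-identityʳ (fromℕ 0)) fromℕ-0)))
    slope (suc k) k<p = 0<x′ , 0≤y′ , py′≤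
      where
      open ℚ.≤-Reasoning
      x = reᴾ T 1ℚ k
      y = imᴾ T 1ℚ k
      k̂ = fromℕ k
      ih = slope k (ℕ.<⇒≤ k<p)
      0<x = proj₁ ih
      0≤x = ℚ.<⇒≤ 0<x
      0≤y = proj₁ (proj₂ ih)
      py≤kx = proj₂ (proj₂ ih)
      k+1≤p : k̂ + 1ℚ ≤ p̂
      k+1≤p = subst (_≤ p̂) (fromℕ-suc k) (fromℕ-mono-≤ k<p)
      y≤x : y ≤ x
      y≤x = ℚ.*-cancelˡ-≤-pos p̂ {{ℚ.positive 0<p̂}} (ℚ.≤-trans py≤kx
        (ℚ.*-monoʳ-≤-nonNeg x {{ℚ.nonNegative 0≤x}} (fromℕ-mono-≤ (ℕ.<⇒≤ k<p))))
      1≤p : 1ℚ ≤ p̂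
      1≤p = ℚ.≤-trans (≤-by k̂ (0≤fromℕ k) (ℚ.+-comm k̂ 1ℚ)) k+1≤p
      0<x′ : 0ℚ < T * x - 1ℚ * y
      0<x′ = <-by (x + ((p̂ - 1ℚ) * x + (p̂ - 1ℚ) * x + (x - y)))
        (ℚ.+-mono-<-≤ 0<x (0≤+ (0≤+ q q) (≤⇒0≤- y≤x)))
        (solve 3 (λ p x y → (p :+ p) :* x :- con 1ℚ :* y :=
            con 0ℚ :+ (x :+ ((p :- con 1ℚ) :* x :+ (p :- con 1ℚ) :* x :+ (x :- y)))) refl p̂ x y)
        where q = 0≤* (≤⇒0≤- 1≤p) 0≤x
      0≤y′ : 0ℚ ≤ T * y + 1ℚ * x
      0≤y′ = 0≤+ (0≤* 0≤T 0≤y) (0≤* (ℚ.nonNegative⁻¹ 1ℚ) 0≤x)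
      py′≤ : p̂ * (T * y + 1ℚ * x) ≤ fromℕ (suc k) * (T * x - 1ℚ * y)
      py′≤ = ≤-by (T * (k̂ * x - p̂ * y) + (p̂ * (x - y) + (p̂ - (k̂ + 1ℚ)) * y))
        (0≤+ (0≤* 0≤T (≤⇒0≤- py≤kx))
          (0≤+ (0≤* (0≤fromℕ p) (≤⇒0≤- y≤x)) (0≤* (≤⇒0≤- k+1≤p) 0≤y)))
        (trans (cong (_* (T * x - 1ℚ * y)) (fromℕ-suc k))
          (solve 4 (λ p k x y → (k :+ con 1ℚ) :* ((p :+ p) :* x :- con 1ℚ :* y) :=
              p :* ((p :+ p) :* y :+ con 1ℚ :* x) :+
              ((p :+ p) :* (k :* x :- p :* y) :+ (p :* (x :- y) :+ (p :- (k :+ con 1ℚ)) :* y)))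
            refl p̂ k̂ x y))

  low-T : Low T
  low-T j = subst (0ℚ <_) (ℚ.+-comm (1ℚ * x) (T * y))
    (ℚ.+-mono-<-≤ (subst (0ℚ <_) (sym (ℚ.*-identityˡ x)) (proj₁ s)) (0≤* 0≤T (proj₁ (proj₂ s))))
    where
    s = slope (toℕ j) (ℕ.<⇒≤ (Fin.toℕ<n j))
    x = reᴾ T 1ℚ (toℕ j)
    y = imᴾ T 1ℚ (toℕ j)

  open Bisection low? 0≤T ¬low-0 low-T

  -- This is cot (π / p).
  t : ℝ
  t = limit

  tₙ : ℕ → ℚ
  tₙ = ℝ.seq t

  0≤tₙ : ∀ n → 0ℚ ≤ tₙ n
  0≤tₙ n = ℚ.≤-trans (0≤lo n) (Bracket.lo≤hi (brackets n))

  tₙ≤T : ∀ n → tₙ n ≤ T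
  tₙ≤T = hi≤T

  private
    -- If (t + i)ʲ⁺¹ is nearly real, then its neighbours can only have positive
    -- imaginary parts if it is nearly zero.
    escape : ∀ {t} j → 0ℚ ≤ t → t ≤ T → 0ℚ ≤ imᴾ t 1ℚ j → 0ℚ < imᴾ t 1ℚ (suc j) →
             0ℚ < imᴾ t 1ℚ (suc (suc j)) → ¬ ((T + 1ℚ) * imᴾ t 1ℚ (suc j) < 1ℚ)
    escape {t} j 0≤t t≤T 0≤v 0<y 0<y′ small = ℚ.<-irrefl refl (begin-strict
      1ℚ                                ≤⟨ 1≤norm {t} {1ℚ} (≤-by (t * t) (0≤square t) (ℚ.+-comm (t * t) 1ℚ)) (suc j) ⟩
      x * x + y * y                     ≤⟨ ≤-by _ (0≤* 0≤ty-x (ℚ.<⇒≤ 0<y′))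
                                            (solve 3 (λ t x y → t :* y :* (t :* y) :+ y :* y :=
                                              x :* x :+ y :* y :+ (t :* y :- x) :* (t :* y :+ con 1ℚ :* x)) refl t x y) ⟩
      t * y * (t * y) + y * y           ≤⟨ ≤-by _ (0≤+ (0≤* (0≤* (≤⇒0≤- t≤T) (0≤+ 0≤T 0≤t)) (0≤square y))
                                                       (0≤* 0≤T (0≤+ (0≤square y) (0≤square y))))
                                            (solve 3 (λ T t y → (T :+ con 1ℚ) :* y :* ((T :+ con 1ℚ) :* y) :=
                                              t :* y :* (t :* y) :+ y :* y :+
                                              ((T :- t) :* (T :+ t) :* (y :* y) :+ T :* (y :* y :+ y :* y))) refl T t y) ⟩
      (T + 1ℚ) * y * ((T + 1ℚ) * y)     ≤⟨ ℚ.*-monoˡ-≤-nonNeg ((T + 1ℚ) * y)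
                                            {{ℚ.nonNegative (0≤* (0≤+ 0≤T (ℚ.nonNegative⁻¹ 1ℚ)) (ℚ.<⇒≤ 0<y))}} (ℚ.<⇒≤ small) ⟩
      (T + 1ℚ) * y * 1ℚ                 ≡⟨ ℚ.*-identityʳ _ ⟩
      (T + 1ℚ) * y                      <⟨ small ⟩
      1ℚ                                ∎)
      where
      open ℚ.≤-Reasoning
      x = reᴾ t 1ℚ (suc j)
      y = imᴾ t 1ℚ (suc j)
      u = reᴾ t 1ℚ j
      v = imᴾ t 1ℚ j
      -- Compare imaginary parts in (t - i) (t + i)ʲ⁺¹ = (t² + 1) (t + i)ʲ. Together with t y + x >
      -- 0 from the next power this gives x² ≤ t² y².
      0≤ty-x : 0ℚ ≤ t * y - x
      0≤ty-x = subst (0ℚ ≤_) (solve 3 (λ t u v → (t :* t :+ con 1ℚ) :* v :=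
          t :* (t :* v :+ con 1ℚ :* u) :- (t :* u :- con 1ℚ :* v)) refl t u v)
        (0≤* (0≤+ (0≤square t) (ℚ.nonNegative⁻¹ 1ℚ)) 0≤v)

    0≤im-low : ∀ {t} → Low t → ∀ j → j ℕ.≤ p → 0ℚ ≤ imᴾ t 1ℚ j
    0≤im-low low zero    _   = ℚ.≤-refl
    0≤im-low {t} low (suc j) j<p = ℚ.<⇒≤
      (subst (λ k → 0ℚ < imᴾ t 1ℚ (suc k)) (Fin.toℕ-fromℕ< j<p) (low (fromℕ< j<p)))

    -- At the lower end the imaginary part is not positive, and the upper end is only `width n`
    -- away.
    near : ∀ n (j : Fin p) → ¬ (0ℚ < imᴾ (Bracket.lo (brackets n)) 1ℚ (suc (toℕ j))) →
           imᴾ (tₙ n) 1ℚ (suc (toℕ j)) ≤ Lip.L (lip-im 0≤T (suc (toℕ j))) * width n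
    near n j ≮ = begin
      f hi                     ≡⟨ solve 2 (λ a b → a := b :+ (a :- b)) refl (f hi) (f lo) ⟩
      f lo + (f hi - f lo)     ≤⟨ ℚ.+-mono-≤ (ℚ.≮⇒≥ ≮) (p≤∣p∣ (f hi - f lo)) ⟩
      0ℚ + ∣ f hi - f lo ∣     ≡⟨ ℚ.+-identityˡ _ ⟩
      ∣ f hi - f lo ∣          ≤⟨ Lip.lipschitz (lip-im 0≤T (suc (toℕ j))) hi lo (0≤tₙ n) (tₙ≤T n)
                                    (0≤lo n) (ℚ.≤-trans (Bracket.lo≤hi (brackets n)) (tₙ≤T n)) ⟩
      L * ∣ hi - lo ∣          ≡⟨ cong (L *_) (ℚ.0≤p⇒∣p∣≡p (0≤width n)) ⟩
      L * width n              ∎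
      where
      open ℚ.≤-Reasoning
      f : ℚ → ℚ
      f s = imᴾ s 1ℚ (suc (toℕ j))
      hi = Bracket.hi (brackets n)
      lo = Bracket.lo (brackets n)
      L = Lip.L (lip-im 0≤T (suc (toℕ j)))

  -- `Low` fails at the lower end for some j, so at the upper end the power j + 1 has imaginary part
  -- near 0. It has to be the p-th power, because for j + 1 < p both neighbours have nonnegative,
  -- respectively positive, imaginary part and `escape` applies. As j may vary with the stage, the
  -- estimates are made for all j at once.
  null-im : Null (λ n → imᴾ (tₙ n) 1ℚ p)
  null-im ε 0<ε = eventually-map step (eventually-∀ λ j →
      eventually-× (null-*-const (L j) null-width ε 0<ε)
                   (null-*-const (T + 1ℚ) (null-*-const (L j) null-width) 1ℚ (ℚ.positive⁻¹ 1ℚ)))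
    where
    open ℚ.≤-Reasoning
    L : Fin p → ℚ
    L j = Lip.L (lip-im 0≤T (suc (toℕ j)))
    step : ∀ n → (∀ j → ∣ L j * width n ∣ < ε × ∣ (T + 1ℚ) * (L j * width n) ∣ < 1ℚ) →
           ∣ imᴾ (tₙ n) 1ℚ p ∣ < ε
    step n small = conclude (Fin.¬∀⟶∃¬ p (λ j → 0ℚ < imᴾ (Bracket.lo (brackets n)) 1ℚ (suc (toℕ j)))
        (λ j → 0ℚ ℚ.<? imᴾ (Bracket.lo (brackets n)) 1ℚ (suc (toℕ j))) (Bracket.¬Plo (brackets n)))
      where
      low = Bracket.Phi (brackets n)
      conclude : ∃[ j ] ¬ (0ℚ < imᴾ (Bracket.lo (brackets n)) 1ℚ (suc (toℕ j))) → ∣ imᴾ (tₙ n) 1ℚ p ∣ < ε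
      conclude (j , ≮) = cases (suc (toℕ j) ℕ.≟ p)
        where
        y = imᴾ (tₙ n) 1ℚ (suc (toℕ j))
        cases : Dec (suc (toℕ j) ≡ p) → ∣ imᴾ (tₙ n) 1ℚ p ∣ < ε
        cases (yes j+1≡p) = subst (λ k → ∣ imᴾ (tₙ n) 1ℚ k ∣ < ε) j+1≡p (begin-strict
          ∣ y ∣               ≡⟨ ℚ.0≤p⇒∣p∣≡p (ℚ.<⇒≤ (low j)) ⟩
          y                   ≤⟨ near n j ≮ ⟩
          L j * width n       ≤⟨ p≤∣p∣ _ ⟩
          ∣ L j * width n ∣   <⟨ proj₁ (small j) ⟩
          ε                   ∎)
        cases (no j+1≢p) = contradiction (begin-strict
          (T + 1ℚ) * y                   ≤⟨ ℚ.*-monoˡ-≤-nonNeg (T + 1ℚ)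
                                              {{ℚ.nonNegative (0≤+ 0≤T (ℚ.nonNegative⁻¹ 1ℚ))}} (near n j ≮) ⟩
          (T + 1ℚ) * (L j * width n)     ≤⟨ p≤∣p∣ _ ⟩
          ∣ (T + 1ℚ) * (L j * width n) ∣ <⟨ proj₂ (small j) ⟩
          1ℚ                             ∎)
          (escape (toℕ j) (0≤tₙ n) (tₙ≤T n) (0≤im-low low (toℕ j) (ℕ.<⇒≤ (Fin.toℕ<n j))) (low j)
            (subst (λ k → 0ℚ < imᴾ (tₙ n) 1ℚ (suc k)) (Fin.toℕ-fromℕ< j+1<p) (low (fromℕ< j+1<p))))
          where
          j+1<p : suc (toℕ j) ℕ.< p
          j+1<p = ℕ.≤∧≢⇒< (Fin.toℕ<n j) j+1≢p

-- A primitive p-th root of unity in ℂ.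

module ComplexPowers where
  open ≡ using (refl)
  open import Data.Rational.Base using (_+_; _*_; _-_)
  open GaussianPowers
  open ℂ

  infixr 8 _^_
  _^_ : ℂ → ℕ → ℂ
  z ^ zero  = Complex.1ℂ
  z ^ suc k = z Complex.* z ^ k

  re-^ : ∀ z k n → ℝ.seq (re (z ^ k)) n ≡ reᴾ (ℝ.seq (re z) n) (ℝ.seq (im z) n) k
  im-^ : ∀ z k n → ℝ.seq (im (z ^ k)) n ≡ imᴾ (ℝ.seq (re z) n) (ℝ.seq (im z) n) k
  re-^ z zero    n = refl
  re-^ z (suc k) n = cong₂ (λ x y → ℝ.seq (re z) n * x - ℝ.seq (im z) n * y) (re-^ z k n) (im-^ z k n)
  im-^ z zero    n = refl
  im-^ z (suc k) n = cong₂ (λ x y → ℝ.seq (re z) n * y + ℝ.seq (im z) n * x) (re-^ z k n) (im-^ z k n)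

-- The stages cₙ + sₙ i of ζ satisfy ζᵖ = 1 only in the limit, so geometric sums do not vanish at
-- finite stages; null-solution says that a solution X + Y i of (ζ − 1) Z = m (ζᵖ − 1) has X → 0.
record PrimitiveRootOfUnity (p : ℕ) : Set where
  open GaussianPowers
  open ComplexPowers
  field
    ζ       : ℂ
    ζ^-+    : ∀ j k l → j ℕ.+ k ≡ l → ζ ^ l Complex.≈ ζ ^ j Complex.* ζ ^ k
    ζ^-wrap : ∀ l → ζ ^ l Complex.≈ ζ ^ (l ℕ.+ p)
    ζ≉1     : ¬ (ζ ^ 1 Complex.≈ Complex.1ℂ)

  cₙ = ℝ.seq (ℂ.re ζ)
  sₙ = ℝ.seq (ℂ.im ζ)

  field
    null-solution : ∀ m (X Y : ℕ → ℚ) →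
      (∀ n → cₙ n ℚ.* X n ℚ.- sₙ n ℚ.* Y n ≡ X n ℚ.+ m ℚ.* (reᴾ (cₙ n) (sₙ n) p ℚ.- 1ℚ)) →
      (∀ n → sₙ n ℚ.* X n ℚ.+ cₙ n ℚ.* Y n ≡ Y n ℚ.+ m ℚ.* imᴾ (cₙ n) (sₙ n) p) →
      Sequences.Null X

module PrimitiveRoot (p : ℕ) (2≤p : 2 ℕ.≤ p) where
  open ≡ using (refl; sym; trans)
  open import Data.Rational.Base using (_+_; _*_; _-_; -_; ∣_∣; _<_; _≤_)
  open RationalLemmas
  open Sequences
  open GaussianPowers
  open ComplexPowers
  open +-*-Solver
  open RootOfUnity p 2≤p public using (t; tₙ; T; 0≤T; 0≤tₙ; tₙ≤T; null-im)

  private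
    1≤N : ∀ n → 1ℚ ≤ norm (tₙ n) 1ℚ
    1≤N n = ≤-by (tₙ n * tₙ n) (0≤square (tₙ n)) (ℚ.+-comm (tₙ n * tₙ n) 1ℚ)

    0<N : ∀ n → 0ℚ < norm (tₙ n) 1ℚ
    0<N n = ℚ.<-≤-trans (ℚ.positive⁻¹ 1ℚ) (1≤N n)

  abstract
    wₙ : ℕ → ℚ
    wₙ n = (ℚ.1/ norm (tₙ n) 1ℚ) {{ℚ.>-nonZero (0<N n)}}

    wN≡1 : ∀ n → wₙ n * norm (tₙ n) 1ℚ ≡ 1ℚ
    wN≡1 n = ℚ.*-inverseˡ (norm (tₙ n) 1ℚ) {{ℚ.>-nonZero (0<N n)}}

    0≤wₙ : ∀ n → 0ℚ ≤ wₙ n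
    0≤wₙ n = ℚ.<⇒≤ (Estimates.recip-pos (norm (tₙ n) 1ℚ) (0<N n))

  ≤1 : ∀ {w N} → 0ℚ ≤ w → 1ℚ ≤ N → w * N ≡ 1ℚ → w ≤ 1ℚ
  ≤1 {w} {N} 0≤w 1≤N wN = subst₂ _≤_ (ℚ.*-identityʳ w) wN (ℚ.*-monoˡ-≤-nonNeg w {{ℚ.nonNegative 0≤w}} 1≤N)

  -- 1 / (a² + 1) and 1 / (b² + 1) are at most 1, which makes their distance at most that of a² and
  -- b²; so the modulus of convergence of t² serves here.
  w : ℝ
  w = mkℝ wₙ λ ε 0<ε → let M , small = ℝ.cauchy (t Real.* t) ε 0<ε in
    M , λ m n M≤m M≤n → ℚ.≤-<-trans (le m n) (small m n M≤m M≤n)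
    where
    open ℚ.≤-Reasoning
    w≤1 : ∀ n → wₙ n ≤ 1ℚ
    w≤1 n = ≤1 (0≤wₙ n) (1≤N n) (wN≡1 n)
    ∣w∣≤1 : ∀ n → ∣ wₙ n ∣ ≤ 1ℚ
    ∣w∣≤1 n = subst (_≤ 1ℚ) (sym (ℚ.0≤p⇒∣p∣≡p (0≤wₙ n))) (w≤1 n)
    le : ∀ m n → ∣ wₙ m - wₙ n ∣ ≤ ∣ tₙ m * tₙ m - tₙ n * tₙ n ∣
    le m n = begin
      ∣ v - u ∣                                   ≡⟨ cong ∣_∣ (cong₂ _-_
          (trans (sym (ℚ.*-identityʳ v)) (cong (v *_) (sym (wN≡1 n))))
          (trans (sym (ℚ.*-identityʳ u)) (cong (u *_) (sym (wN≡1 m))))) ⟩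
      ∣ v * (u * (b * b + 1ℚ * 1ℚ)) - u * (v * (a * a + 1ℚ * 1ℚ)) ∣
                                                  ≡⟨ cong ∣_∣ (solve 4 (λ a b u v →
          v :* (u :* (b :* b :+ con 1ℚ :* con 1ℚ)) :- u :* (v :* (a :* a :+ con 1ℚ :* con 1ℚ))
          := (u :* v) :* :- (a :* a :- b :* b)) refl a b u v) ⟩
      ∣ u * v * - (a * a - b * b) ∣               ≡⟨ ℚ.∣p*q∣≡∣p∣*∣q∣ (u * v) (- (a * a - b * b)) ⟩
      ∣ u * v ∣ * ∣ - (a * a - b * b) ∣           ≡⟨ cong₂ _*_ (ℚ.∣p*q∣≡∣p∣*∣q∣ u v) (ℚ.∣-p∣≡∣p∣ (a * a - b * b)) ⟩
      ∣ u ∣ * ∣ v ∣ * ∣ a * a - b * b ∣           ≤⟨ ℚ.*-monoʳ-≤-nonNeg ∣ a * a - b * b ∣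
                                                      {{ℚ.∣-∣-nonNeg (a * a - b * b)}}
                                                      (*-mono-≤ (ℚ.0≤∣p∣ u) (∣w∣≤1 n) (ℚ.0≤∣p∣ v) (∣w∣≤1 m)) ⟩
      1ℚ * ∣ a * a - b * b ∣                      ≡⟨ ℚ.*-identityˡ _ ⟩
      ∣ a * a - b * b ∣                           ∎
      where
      a = tₙ m
      b = tₙ n
      v = wₙ m
      u = wₙ n

  -- This is (t + i) / (t - i).
  ζ : ℂ
  ζ = (w Real.* (t Real.* t Real.- Real.1ℝ)) +i (w Real.* (t Real.+ t))

  cₙ sₙ : ℕ → ℚ
  cₙ n = ℝ.seq (ℂ.re ζ) n
  sₙ n = ℝ.seq (ℂ.im ζ) n

  -- Every stage lies exactly on the unit circle, so the powers stay bounded by 1 although ζᵖ = 1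
  -- holds only in the limit.
  norm-ζ : ∀ n → norm (cₙ n) (sₙ n) ≡ 1ℚ
  norm-ζ n = trans
    (solve 2 (λ w t → w :* (t :* t :- con 1ℚ) :* (w :* (t :* t :- con 1ℚ)) :+ w :* (t :+ t) :* (w :* (t :+ t))
        := w :* (t :* t :+ con 1ℚ :* con 1ℚ) :* (w :* (t :* t :+ con 1ℚ :* con 1ℚ))) refl (wₙ n) (tₙ n))
    (cong₂ _*_ (wN≡1 n) (wN≡1 n))

  ∣reᴾ∣≤1 : ∀ k n → ∣ reᴾ (cₙ n) (sₙ n) k ∣ ≤ 1ℚ
  ∣reᴾ∣≤1 k n = norm≤1⇒re≤1 {_} {imᴾ (cₙ n) (sₙ n) k} (ℚ.≤-reflexive (norm≡1 {cₙ n} {sₙ n} (norm-ζ n) k))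

  ∣imᴾ∣≤1 : ∀ k n → ∣ imᴾ (cₙ n) (sₙ n) k ∣ ≤ 1ℚ
  ∣imᴾ∣≤1 k n = norm≤1⇒im≤1 {reᴾ (cₙ n) (sₙ n) k} (ℚ.≤-reflexive (norm≡1 {cₙ n} {sₙ n} (norm-ζ n) k))

  -- The components of ζᵖ − 1.
  αₙ βₙ : ℕ → ℚ
  αₙ n = reᴾ (cₙ n) (sₙ n) p - 1ℚ
  βₙ n = imᴾ (cₙ n) (sₙ n) p

  private
    module _ (n : ℕ) where
      S : SquarePower (wₙ n) (tₙ n) p
      S = squarePower {wₙ n} {tₙ n} (0≤wₙ n) (wN≡1 n) p
      open SquarePower S
      X Y : ℚ
      X = reᴾ (tₙ n) 1ℚ p
      Y = imᴾ (tₙ n) 1ℚ p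

      -- By `unit` the left side equals `scale`, the reciprocal of a number that is at least 1.
      scaled≤1 : norm (scale * X) (scale * Y) ≤ 1ℚ
      scaled≤1 = subst (_≤ 1ℚ)
        (trans (trans (sym (ℚ.*-identityʳ scale)) (cong (scale *_) (sym unit)))
          (solve 3 (λ s x y → s :* (s :* (x :* x :+ y :* y)) := s :* x :* (s :* x) :+ s :* y :* (s :* y))
            refl scale X Y))
        (≤1 {N = norm X Y} 0≤scale (1≤norm {tₙ n} {1ℚ} (1≤N n) p) unit)

      -- With Z = X + i Y = (t + i)ᵖ, the number ζᵖ - 1 is `scale` times Z² - |Z|² = 2 i Y Z. Both
      -- components thus contain the factor Y, which tends to 0.
      α≡ : αₙ n ≡ (- (scale * Y + scale * Y)) * Y
      α≡ = trans (cong₂ _-_ re≡ (sym unit)) (solve 3 (λ s x y →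
        s :* (x :* x :- y :* y) :- s :* (x :* x :+ y :* y) := :- (s :* y :+ s :* y) :* y) refl scale X Y)

      β≡ : βₙ n ≡ (scale * X + scale * X) * Y
      β≡ = trans im≡ (solve 3 (λ s x y → s :* (x :* y :+ x :* y) := (s :* x :+ s :* x) :* y) refl scale X Y)

      ∣2a∣≤2 : ∀ {a} → ∣ a ∣ ≤ 1ℚ → ∣ a + a ∣ ≤ 1ℚ + 1ℚ
      ∣2a∣≤2 {a} le = ℚ.≤-trans (ℚ.∣p+q∣≤∣p∣+∣q∣ a a) (ℚ.+-mono-≤ le le)

      2sX≤2 : ∣ scale * X + scale * X ∣ ≤ 1ℚ + 1ℚ
      2sX≤2 = ∣2a∣≤2 (norm≤1⇒re≤1 {scale * X} {scale * Y} scaled≤1)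

      2sY≤2 : ∣ - (scale * Y + scale * Y) ∣ ≤ 1ℚ + 1ℚ
      2sY≤2 = subst (_≤ 1ℚ + 1ℚ) (sym (ℚ.∣-p∣≡∣p∣ (scale * Y + scale * Y)))
        (∣2a∣≤2 (norm≤1⇒im≤1 {scale * X} {scale * Y} scaled≤1))

  null-α : Null αₙ
  null-α = null-cong α≡ (null-* _ (1ℚ + 1ℚ) (ℚ.positive⁻¹ (1ℚ + 1ℚ)) 2sY≤2 null-im)

  null-β : Null βₙ
  null-β = null-cong β≡ (null-* _ (1ℚ + 1ℚ) (ℚ.positive⁻¹ (1ℚ + 1ℚ)) 2sX≤2 null-im)

  -- (ζ − 1) Z = m (ζᵖ − 1) is solved for the real part of Z, since 1 / (ζ − 1) = −(1 + ti) / 2.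
  solve-re : ∀ n m X Y → cₙ n * X - sₙ n * Y ≡ X + m * αₙ n → sₙ n * X + cₙ n * Y ≡ Y + m * βₙ n →
             X ≡ (- (½ * m)) * (αₙ n - tₙ n * βₙ n)
  solve-re n m X Y eq₁ eq₂ = begin
    X                                                                 ≡⟨ identity ⟩
    - ½ * ((cₙ n * X - sₙ n * Y - X) - tₙ n * (sₙ n * X + cₙ n * Y - Y)) ≡⟨ cong₂ (λ u v → - ½ * (u - tₙ n * v))
        (trans (cong (_- X) eq₁) (solve 2 (λ x y → x :+ y :- x := y) refl X (m * αₙ n)))
        (trans (cong (_- Y) eq₂) (solve 2 (λ x y → x :+ y :- x := y) refl Y (m * βₙ n))) ⟩
    - ½ * (m * αₙ n - tₙ n * (m * βₙ n))                              ≡⟨ solve 4 (λ m a t b →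
        :- con ½ :* (m :* a :- t :* (m :* b)) := :- (con ½ :* m) :* (a :- t :* b)) refl m (αₙ n) (tₙ n) (βₙ n) ⟩
    - (½ * m) * (αₙ n - tₙ n * βₙ n)                                  ∎
    where
    open ≡.≡-Reasoning
    *wN≡ : ∀ x → x * (wₙ n * norm (tₙ n) 1ℚ) ≡ x
    *wN≡ x = trans (cong (x *_) (wN≡1 n)) (ℚ.*-identityʳ x)
    identity : X ≡ - ½ * ((cₙ n * X - sₙ n * Y - X) - tₙ n * (sₙ n * X + cₙ n * Y - Y))
    identity = begin
      X                                                               ≡⟨ solve 3 (λ x y t →
          x := con ½ :* x :+ con ½ :* x :+ con ½ :* (t :* y) :- con ½ :* (t :* y)) refl X Y (tₙ n) ⟩
      -- Inserting the factor 1 = w (t² + 1) at these two places turns the claim into a polynomial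
      -- identity.
      ½ * X + ½ * X + ½ * (tₙ n * Y) - ½ * (tₙ n * Y)                 ≡⟨ cong₂ (λ u v →
          ½ * X + ½ * u + ½ * v - ½ * (tₙ n * Y)) (*wN≡ X) (*wN≡ (tₙ n * Y)) ⟨
      ½ * X + ½ * (X * (wₙ n * norm (tₙ n) 1ℚ)) + ½ * (tₙ n * Y * (wₙ n * norm (tₙ n) 1ℚ)) - ½ * (tₙ n * Y)
                                                                      ≡⟨ solve 4 (λ w t x y →
          con ½ :* x :+ con ½ :* (x :* (w :* (t :* t :+ con 1ℚ :* con 1ℚ)))
            :+ con ½ :* (t :* y :* (w :* (t :* t :+ con 1ℚ :* con 1ℚ))) :- con ½ :* (t :* y)
          := :- con ½ :* ((w :* (t :* t :- con 1ℚ) :* x :- w :* (t :+ t) :* y :- x)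
               :- t :* (w :* (t :+ t) :* x :+ w :* (t :* t :- con 1ℚ) :* y :- y)))
          refl (wₙ n) (tₙ n) X Y ⟩
      - ½ * ((cₙ n * X - sₙ n * Y - X) - tₙ n * (sₙ n * X + cₙ n * Y - Y)) ∎

  null⇒≈ : ∀ x y {u} → Null u → (∀ n → ℝ.seq x n - ℝ.seq y n ≡ u n) → x Real.≈ y
  null⇒≈ x y null eq ε 0<ε with after N small ← null ε 0<ε =
    N , λ n N≤n → subst (λ a → ∣ a ∣ < ε) (sym (eq n)) (small n N≤n)

  ζ^-+ : ∀ j k l → j ℕ.+ k ≡ l → ζ ^ l Complex.≈ ζ ^ j Complex.* ζ ^ k
  ζ^-+ j k l eq =
    null⇒≈ (ℂ.re (ζ ^ l)) (ℂ.re (ζ ^ j Complex.* ζ ^ k)) null-0 (λ n → trans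
      (cong₂ _-_ (re-^ ζ l n) (trans (cong₂ _-_ (cong₂ _*_ (re-^ ζ j n) (re-^ ζ k n))
                                                (cong₂ _*_ (im-^ ζ j n) (im-^ ζ k n)))
        (trans (sym (reᴾ-+ (cₙ n) (sₙ n) j k)) (cong (reᴾ (cₙ n) (sₙ n)) eq))))
      (ℚ.+-inverseʳ (reᴾ (cₙ n) (sₙ n) l))) ,
    null⇒≈ (ℂ.im (ζ ^ l)) (ℂ.im (ζ ^ j Complex.* ζ ^ k)) null-0 (λ n → trans
      (cong₂ _-_ (im-^ ζ l n) (trans (cong₂ _+_ (cong₂ _*_ (re-^ ζ j n) (im-^ ζ k n))
                                                (cong₂ _*_ (im-^ ζ j n) (re-^ ζ k n)))
        (trans (sym (imᴾ-+ (cₙ n) (sₙ n) j k)) (cong (imᴾ (cₙ n) (sₙ n)) eq))))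
      (ℚ.+-inverseʳ (imᴾ (cₙ n) (sₙ n) l)))

  ζ^-wrap : ∀ l → ζ ^ l Complex.≈ ζ ^ (l ℕ.+ p)
  ζ^-wrap l =
    null⇒≈ (ℂ.re (ζ ^ l)) (ℂ.re (ζ ^ (l ℕ.+ p)))
      (null-+ (null-* (λ n → - x n) 1ℚ (ℚ.positive⁻¹ 1ℚ)
                (λ n → subst (_≤ 1ℚ) (sym (ℚ.∣-p∣≡∣p∣ (x n))) (∣reᴾ∣≤1 l n)) null-α)
              (null-* y 1ℚ (ℚ.positive⁻¹ 1ℚ) (∣imᴾ∣≤1 l) null-β))
      (λ n → trans (cong₂ _-_ (re-^ ζ l n) (trans (re-^ ζ (l ℕ.+ p) n) (reᴾ-+ (cₙ n) (sₙ n) l p)))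
        (solve 4 (λ x y a b → x :- (x :* a :- y :* b) := :- x :* (a :- con 1ℚ) :+ y :* b) refl
          (x n) (y n) (reᴾ (cₙ n) (sₙ n) p) (βₙ n))) ,
    null⇒≈ (ℂ.im (ζ ^ l)) (ℂ.im (ζ ^ (l ℕ.+ p)))
      (null-+ (null-* (λ n → - x n) 1ℚ (ℚ.positive⁻¹ 1ℚ)
                (λ n → subst (_≤ 1ℚ) (sym (ℚ.∣-p∣≡∣p∣ (x n))) (∣reᴾ∣≤1 l n)) null-β)
              (null-* (λ n → - y n) 1ℚ (ℚ.positive⁻¹ 1ℚ)
                (λ n → subst (_≤ 1ℚ) (sym (ℚ.∣-p∣≡∣p∣ (y n))) (∣imᴾ∣≤1 l n)) null-α))
      (λ n → trans (cong₂ _-_ (im-^ ζ l n) (trans (im-^ ζ (l ℕ.+ p) n) (imᴾ-+ (cₙ n) (sₙ n) l p)))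
        (solve 4 (λ x y a b → y :- (x :* b :+ y :* a) := :- x :* b :+ :- y :* (a :- con 1ℚ)) refl
          (x n) (y n) (reᴾ (cₙ n) (sₙ n) p) (βₙ n)))
    where
    x y : ℕ → ℚ
    x n = reᴾ (cₙ n) (sₙ n) l
    y n = imᴾ (cₙ n) (sₙ n) l

  -- 1 - Re ζ = 2 w = 2 / (t² + 1) stays away from 0, because t ≤ T.
  ζ≉1 : ¬ (ζ ^ 1 Complex.≈ Complex.1ℂ)
  ζ≉1 (re≈ , _) = far (re≈ r (Estimates.recip-pos K 0<K))
    where
    open ℚ.≤-Reasoning
    K r : ℚ
    K = T * T + 1ℚ
    0<K : 0ℚ < K
    0<K = ℚ.+-mono-≤-< (0≤square T) (ℚ.positive⁻¹ 1ℚ)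
    r = (ℚ.1/ K) {{ℚ.>-nonZero 0<K}}
    far : ¬ (∃[ N ] ∀ n → N ℕ.≤ n → ∣ ℝ.seq (ℂ.re (ζ ^ 1)) n - 1ℚ ∣ < r)
    far (N , small) = ℚ.<-irrefl refl (begin-strict
      1ℚ                  ≡⟨ wN≡1 N ⟨
      v * norm (tₙ N) 1ℚ  ≤⟨ ℚ.*-monoˡ-≤-nonNeg v {{ℚ.nonNegative (0≤wₙ N)}}
                              (ℚ.+-monoˡ-≤ 1ℚ (Estimates.square-mono (0≤tₙ N) (tₙ≤T N))) ⟩
      v * K               ≤⟨ ≤-by (v * K) 0≤vK (solve 1 (λ a → a :* con 1ℚ :+ a :* con 1ℚ := a :+ a) refl (v * K)) ⟩
      v * K * 1ℚ + v * K * 1ℚ ≡⟨ solve 2 (λ a k → a :* k :* con 1ℚ :+ a :* k :* con 1ℚ := k :* (a :+ a)) refl v K ⟩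
      K * (v + v)         ≡⟨ cong (K *_) (trans (solve 2 (λ w n → w :+ w := :- (w :* (n :- con 1ℚ :- con 1ℚ) :- w :* n)) refl v (norm (tₙ N) 1ℚ))
                              (cong -_ (cong₂ _-_ (cong (v *_) (solve 1 (λ t →
                                 t :* t :+ con 1ℚ :* con 1ℚ :- con 1ℚ :- con 1ℚ := t :* t :- con 1ℚ) refl (tₙ N))) (wN≡1 N)))) ⟩
      K * - (cₙ N - 1ℚ)   ≤⟨ ℚ.*-monoˡ-≤-nonNeg K {{ℚ.nonNegative (ℚ.<⇒≤ 0<K)}} (-p≤∣p∣ (cₙ N - 1ℚ)) ⟩
      K * ∣ cₙ N - 1ℚ ∣   ≡⟨ cong (λ a → K * ∣ a - 1ℚ ∣) (solve 2 (λ c s → c := c :* con 1ℚ :- s :* con 0ℚ) refl (cₙ N) (sₙ N)) ⟩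
      K * ∣ cₙ N * 1ℚ - sₙ N * 0ℚ - 1ℚ ∣ <⟨ ℚ.*-monoʳ-<-pos K {{ℚ.positive 0<K}} (small N ℕ.≤-refl) ⟩
      K * r               ≡⟨ ℚ.*-inverseʳ K {{ℚ.>-nonZero 0<K}} ⟩
      1ℚ                  ∎)
      where
      v = wₙ N
      0≤vK : 0ℚ ≤ v * K
      0≤vK = 0≤* (0≤wₙ N) (ℚ.<⇒≤ 0<K)

  null-solution : ∀ m (X Y : ℕ → ℚ) → (∀ n → cₙ n * X n - sₙ n * Y n ≡ X n + m * αₙ n) →
                  (∀ n → sₙ n * X n + cₙ n * Y n ≡ Y n + m * βₙ n) → Null X
  null-solution m X Y eq₁ eq₂ = null-cong
    (λ n → trans (solve-re n m (X n) (Y n) (eq₁ n) (eq₂ n))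
      (solve 4 (λ r a t b → r :* (a :- t :* b) := r :* (a :+ :- t :* b)) refl (- (½ * m)) (αₙ n) (tₙ n) (βₙ n)))
    (null-*-const (- (½ * m)) (null-+ null-α (null-* (λ n → - tₙ n) (T + 1ℚ)
      (ℚ.+-mono-≤-< 0≤T (ℚ.positive⁻¹ 1ℚ))
      (λ n → subst (_≤ T + 1ℚ) (sym (trans (ℚ.∣-p∣≡∣p∣ (tₙ n)) (ℚ.0≤p⇒∣p∣≡p (0≤tₙ n))))
        (ℚ.≤-trans (tₙ≤T n) (≤-by 1ℚ (ℚ.nonNegative⁻¹ 1ℚ) refl))) null-β)))

primitiveRootOfUnity : ∀ p → 2 ℕ.≤ p → PrimitiveRootOfUnity p
primitiveRootOfUnity p 2≤p = record
  { ζ = ζ ; ζ^-+ = ζ^-+ ; ζ^-wrap = ζ^-wrap ; ζ≉1 = ζ≉1 ; null-solution = null-solution }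
  where open PrimitiveRoot p 2≤p

-- The additive group of a finite ring and its coordinates modulo p.

module FiniteRingProperties (R : FiniteRing c ℓ) where
  open FiniteRing R
  open Inverse enumeration public using (to; from; strictlyInverseˡ; strictlyInverseʳ; to-cong; from-cong)
  open RingProperties ring
  open SemiringMult semiring
    using (×-congʳ; ×-homo-+; ×-assocˡ; ×-homo-1; ×-comm-*; ×-assoc-*; ×-congˡ)
    renaming (_×_ to _·_) public
  open import Relation.Binary.Reasoning.Setoid setoid

  any? : ∀ {P : Pred Carrier κ} → P Respects _≈_ → Decidable P → Dec (∃[ x ] P x)
  any? resp P? = map′ (λ (i , p) → to i , p)
    (λ (x , p) → from x , resp (sym (strictlyInverseˡ x)) p)
    (Fin.any? (P? ∘ to))

  all-elements : ∀ {P : Pred Carrier κ} → P Respects _≈_ → All P elements → ∀ x → P x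
  all-elements resp ps x = resp (strictlyInverseˡ x) (All.lookup (All.map⁻ ps) (∈-allFin (from x)))

  -- Translation by x permutes R, hence adding size · x to the sum of all elements does not change
  -- it.
  size·≈0 : ∀ x → size · x ≈ 0#
  size·≈0 x = begin
    size · x                                   ≈⟨ sum-replicate size ⟨
    sum {size} (λ _ → x)                       ≈⟨ xyx⁻¹≈y (sum to) _ ⟨
    sum to + sum {size} (λ _ → x) - sum to     ≈⟨ +-congʳ (∑-distrib-+ to (λ _ → x)) ⟨
    sum (λ i → to i + x) - sum to              ≈⟨ +-congʳ (sum-cong-≋ (λ i → sym (strictlyInverseˡ (to i + x)))) ⟩
    sum (λ i → to (from (to i + x))) - sum to  ≈⟨ +-congʳ (sum-permute to shift) ⟨
    sum to - sum to                            ≈⟨ -‿inverseʳ (sum to) ⟩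
    0#                                         ∎
    where
    open CommutativeMonoidSum +-commutativeMonoid using (sum; sum-replicate; ∑-distrib-+; sum-permute; sum-cong-≋)
    undo : ∀ {u v} i → u + v ≈ 0# → from (to (from (to i + u)) + v) ≡ i
    undo {u} {v} i u+v≈0 = ≡.trans (from-cong (begin
      to (from (to i + u)) + v   ≈⟨ +-congʳ (strictlyInverseˡ (to i + u)) ⟩
      to i + u + v               ≈⟨ +-assoc (to i) u v ⟩
      to i + (u + v)             ≈⟨ +-congˡ u+v≈0 ⟩
      to i + 0#                  ≈⟨ +-identityʳ (to i) ⟩
      to i                       ∎)) (strictlyInverseʳ i)
    shift : Perm.Permutation size size
    shift = Perm.permutation (λ i → from (to i + x)) (λ i → from (to i - x))
      (λ i → undo i (-‿inverseˡ x)) (λ i → undo i (-‿inverseʳ x))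

  ·-+ : ∀ x y n → n · (x + y) ≈ n · x + n · y
  ·-+ x y n = begin
    n · (x + y)                    ≈⟨ ×-congʳ n (+-cong (*-identityˡ x) (*-identityˡ y)) ⟨
    n · (1# * x + 1# * y)          ≈⟨ ×-congʳ n (distribˡ 1# x y) ⟨
    n · (1# * (x + y))             ≈⟨ ×-assoc-* n 1# (x + y) ⟨
    n · 1# * (x + y)               ≈⟨ distribˡ (n · 1#) x y ⟩
    n · 1# * x + n · 1# * y        ≈⟨ +-cong (×-assoc-* n 1# x) (×-assoc-* n 1# y) ⟩
    n · (1# * x) + n · (1# * y)    ≈⟨ +-cong (×-congʳ n (*-identityˡ x)) (×-congʳ n (*-identityˡ y)) ⟩
    n · x + n · y                  ∎

  -- An additive map to ℤ / p with representatives in [0, p).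
  record AdditiveCoordinate (p : ℕ) (e : Carrier) : Set (c ⊔ ℓ) where
    field
      ν      : Carrier → ℕ
      ν<p    : ∀ x → ν x ℕ.< p
      ν-cong : ∀ {x y} → x ≈ y → ν x ≡ ν y
      ν-+    : ∀ x y → ν x ℕ.+ ν y ≡ ν (x + y) ⊎ ν x ℕ.+ ν y ≡ ν (x + y) ℕ.+ p
      ν-0    : ν 0# ≡ 0
      ν-e    : ν e ≡ 1

  -- R is a vector space over 𝔽_p, and a linear functional with value 1 at `e` is wanted. Its kernel
  -- is a maximal subgroup `N` avoiding `e`, and `ν x` is the k with x - k e in `N`.
  module Coordinate {p : ℕ} (prime-p : Prime p) (p·≈0 : ∀ x → p · x ≈ 0#) {e : Carrier} (e≉0 : ¬ (e ≈ 0#)) where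

    private
      instance
        p≢0 : ℕ.NonZero p
        p≢0 = prime⇒nonZero prime-p

      1<p : 1 ℕ.< p
      1<p = ℕ.nonTrivial⇒n>1 p {{prime⇒nonTrivial prime-p}}

      p-1+1 : suc (ℕ.pred p) ≡ p
      p-1+1 = ℕ.suc-pred p

    n·0≈0 : ∀ n → n · 0# ≈ 0#
    n·0≈0 zero    = refl
    n·0≈0 (suc n) = trans (+-identityˡ (n · 0#)) (n·0≈0 n)

    [kp]·≈0 : ∀ k x → (k ℕ.* p) · x ≈ 0#
    [kp]·≈0 k x = trans (sym (×-assocˡ x k p)) (trans (×-congʳ k (p·≈0 x)) (n·0≈0 k))

    ·-mod : ∀ k x → k · x ≈ (k % p) · x
    ·-mod k x = begin
      k · x                                 ≈⟨ ×-congˡ (m≡m%n+[m/n]*n k p) ⟩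
      (k % p ℕ.+ k ℕ./ p ℕ.* p) · x           ≈⟨ ×-homo-+ x (k % p) (k ℕ./ p ℕ.* p) ⟩
      (k % p) · x + (k ℕ./ p ℕ.* p) · x       ≈⟨ +-congˡ ([kp]·≈0 (k ℕ./ p) x) ⟩
      (k % p) · x + 0#                      ≈⟨ +-identityʳ ((k % p) · x) ⟩
      (k % p) · x                           ∎

    -‿·  : ∀ x → ℕ.pred p · x ≈ - x
    -‿· x = +-inverseʳ-unique x (ℕ.pred p · x) (trans (×-congˡ p-1+1) (p·≈0 x))

    -- Bézout's identity may produce −1 instead of 1, whence the square.
    inverse : ∀ k → 0 ℕ.< k → k ℕ.< p → ∃[ m ] ∀ x → m · (k · x) ≈ x
    inverse k 0<k k<p with coprime-Bézout (prime⇒coprime prime-p {{ℕ.>-nonZero 0<k}} k<p)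
    ... | Bézout.-+ y m eq = m , λ x → begin
      m · (k · x)                  ≈⟨ ×-assocˡ x m k ⟩
      (m ℕ.* k) · x                ≈⟨ ×-congˡ eq ⟨
      x + (y ℕ.* p) · x            ≈⟨ +-congˡ ([kp]·≈0 y x) ⟩
      x + 0#                       ≈⟨ +-identityʳ x ⟩
      x                            ∎
    ... | Bézout.+- y m eq = m ℕ.* k ℕ.* m , λ x → begin
      (m ℕ.* k ℕ.* m) · (k · x)    ≈⟨ ×-assocˡ (k · x) (m ℕ.* k) m ⟨
      (m ℕ.* k) · (m · (k · x))    ≈⟨ ×-congʳ (m ℕ.* k) (mk· x) ⟩
      (m ℕ.* k) · (- x)            ≈⟨ ×-assocˡ (- x) m k ⟨
      m · (k · (- x))              ≈⟨ mk· (- x) ⟩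
      - - x                        ≈⟨ -‿involutive x ⟩
      x                            ∎
      where
      mk· : ∀ x → m · (k · x) ≈ - x
      mk· x = +-inverseʳ-unique x (m · (k · x))
        (trans (+-congˡ (×-assocˡ x m k)) (trans (×-congˡ eq) ([kp]·≈0 y x)))

    record Subgroup : Set (c ⊔ Level.suc ℓ) where
      field
        Mem  : Pred Carrier ℓ
        resp : Mem Respects _≈_
        dec  : Decidable Mem
        has0 : Mem 0#
        has+ : ∀ {x y} → Mem x → Mem y → Mem (x + y)

      has· : ∀ k {x} → Mem x → Mem (k · x)
      has· zero    _ = has0
      has· (suc k) m = has+ m (has· k m)

      has- : ∀ {x} → Mem x → Mem (- x)
      has- {x} m = resp (-‿· x) (has· (ℕ.pred p) m)

      divide : ∀ k → 0 ℕ.< k → k ℕ.< p → ∀ {x} → Mem (k · x) → Mem x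
      divide k 0<k k<p {x} m = let q , q· = inverse k 0<k k<p in resp (q· x) (has· q m)

    open Subgroup

    trivial : Subgroup
    trivial = record
      { Mem = _≈ 0# ; resp = λ x≈y → trans (sym x≈y) ; dec = _≈? 0# ; has0 = refl
      ; has+ = λ p q → trans (+-cong p q) (+-identityʳ 0#) }

    +-interchange : ∀ a b c d → (a + b) + (c + d) ≈ (a + c) + (b + d)
    +-interchange a b c d = begin
      a + b + (c + d)     ≈⟨ +-assoc a b (c + d) ⟩
      a + (b + (c + d))   ≈⟨ +-congˡ (+-assoc b c d) ⟨
      a + (b + c + d)     ≈⟨ +-congˡ (+-congʳ (+-comm b c)) ⟩
      a + (c + b + d)     ≈⟨ +-congˡ (+-assoc c b d) ⟩
      a + (c + (b + d))   ≈⟨ +-assoc a c (b + d) ⟨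
      a + c + (b + d)     ∎

    -- The subgroup generated by `M` and `y`. Writing x + k · y in place of x - k · y makes no
    -- difference, as negatives are multiples.
    adjoin : Subgroup → Carrier → Subgroup
    adjoin M y = record
      { Mem  = λ x → ∃[ k ] Mem M (x + k · y)
      ; resp = λ x≈z (k , m) → k , resp M (+-congʳ x≈z) m
      -- Only k modulo p matters, so a search through `Fin p` decides membership.
      ; dec  = λ x → map′ (λ (i , m) → toℕ i , m)
                 (λ (k , m) → fromℕ< (m%n<n k p) , resp M (+-congˡ (trans (·-mod k y)
                   (×-congˡ (≡.sym (Fin.toℕ-fromℕ< (m%n<n k p)))))) m)
                 (Fin.any? {n = p} (λ i → dec M (x + toℕ i · y)))
      ; has0 = 0 , resp M (sym (+-identityʳ 0#)) (has0 M)
      ; has+ = λ {x} {z} (k , m) (l , n) → k ℕ.+ l , resp M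
          (trans (+-interchange x (k · y) z (l · y)) (+-congˡ (sym (×-homo-+ y k l)))) (has+ M m n)
      }

    ⊆adjoin : ∀ M y {x} → Mem M x → Mem (adjoin M y) x
    ⊆adjoin M y {x} m = 0 , resp M (sym (+-identityʳ x)) m

    ∈adjoin : ∀ M y → Mem (adjoin M y) y
    ∈adjoin M y = ℕ.pred p , resp M (sym (trans (×-congˡ p-1+1) (p·≈0 y))) (has0 M)

    private
      -- The sign is chosen so that membership of y + k · g in `N` says that y is congruent to k e.
      g : Carrier
      g = - e

      g≉0 : ¬ (g ≈ 0#)
      g≉0 g≈0 = e≉0 (trans (sym (-‿involutive e)) (trans (-‿cong g≈0) -0#≈0#))

    -- A subgroup maximal among those not containing g; its cosets are represented by the multiples of g.
    saturate : ∀ xs M → ¬ Mem M g → Σ[ N ∈ Subgroup ] (∀ {x} → Mem M x → Mem N x) × ¬ Mem N g ×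
               All (λ y → Mem N y ⊎ (∃[ k ] Mem N (g + k · y))) xs
    saturate [] M g∉M = M , (λ m → m) , g∉M , []
    saturate (y ∷ ys) M g∉M with dec (adjoin M y) g
    ... | yes (k , m) = let N , M⊆N , g∉N , all = saturate ys M g∉M in
      N , M⊆N , g∉N , inj₂ (k , M⊆N m) ∷ all
    ... | no g∉M+y = let N , M⊆N , g∉N , all = saturate ys (adjoin M y) g∉M+y in
      N , (λ m → M⊆N (⊆adjoin M y m)) , g∉N , inj₁ (M⊆N (∈adjoin M y)) ∷ all

    private
      saturated : Σ[ N ∈ Subgroup ] (∀ {x} → Mem trivial x → Mem N x) × ¬ Mem N g ×
                  All (λ y → Mem N y ⊎ (∃[ k ] Mem N (g + k · y))) elements
      saturated = saturate elements trivial g≉0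

      N : Subgroup
      N = proj₁ saturated

      g∉N : ¬ Mem N g
      g∉N = proj₁ (proj₂ (proj₂ saturated))

      dichotomy : ∀ y → Mem N y ⊎ (∃[ k ] Mem N (g + k · y))
      dichotomy = all-elements
        (λ { x≈y (inj₁ m) → inj₁ (resp N x≈y m)
           ; x≈y (inj₂ (k , m)) → inj₂ (k , resp N (+-congˡ (×-congʳ k x≈y)) m) })
        (proj₂ (proj₂ (proj₂ saturated)))

      -- If g + k · y lies in `N`, then k is invertible modulo p, since otherwise g would lie in
      -- `N`; multiplication by an inverse q of k gives y + q · g in `N`.
      coordinate : ∀ y → ∃[ k ] k ℕ.< p × Mem N (y + k · g)
      coordinate y with dichotomy y
      ... | inj₁ m = 0 , ℕ.<-trans ℕ.z<s 1<p , resp N (sym (+-identityʳ y)) m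
      ... | inj₂ (k , m) with k % p in k%p≡
      ...   | zero = contradiction
                (resp N (trans (+-congˡ (trans (·-mod k y) (×-congˡ k%p≡))) (+-identityʳ g)) m) g∉N
      ...   | suc k′ = let q , q· = inverse (suc k′) ℕ.z<s (≡.subst (ℕ._< p) k%p≡ (m%n<n k p)) in
        q % p , m%n<n q p , resp N (begin
          q · (g + k · y)               ≈⟨ ·-+ g (k · y) q ⟩
          q · g + q · (k · y)           ≈⟨ +-cong (·-mod q g) (×-congʳ q (trans (·-mod k y) (×-congˡ k%p≡))) ⟩
          (q % p) · g + q · (suc k′ · y) ≈⟨ +-congˡ (q· y) ⟩
          (q % p) · g + y               ≈⟨ +-comm ((q % p) · g) y ⟩
          y + (q % p) · g               ∎) (has· N q m)

      -- The difference of two such elements is (k - j) · g, and k - j is invertible modulo p, which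
      -- would put g into `N`.
      smaller : ∀ {j k y} → j ℕ.< k → k ℕ.< p → Mem N (y + j · g) → ¬ Mem N (y + k · g)
      smaller {j} {k} {y} j<k k<p m n = g∉N (divide N d 0<d (ℕ.≤-<-trans (ℕ.m∸n≤m k j) k<p)
          (resp N difference (has+ N n (has- N m))))
        where
        d = k ℕ.∸ j
        0<d : 0 ℕ.< d
        0<d = ℕ.m<n⇒0<n∸m j<k
        difference : (y + k · g) - (y + j · g) ≈ d · g
        difference = begin
          (y + k · g) - (y + j · g)                 ≈⟨ +-congʳ (+-congˡ (×-congˡ (≡.sym (ℕ.m+[n∸m]≡n (ℕ.<⇒≤ j<k))))) ⟩
          (y + (j ℕ.+ d) · g) - (y + j · g)         ≈⟨ +-congʳ (+-congˡ (×-homo-+ g j d)) ⟩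
          (y + (j · g + d · g)) - (y + j · g)       ≈⟨ +-congʳ (+-assoc y (j · g) (d · g)) ⟨
          (y + j · g + d · g) - (y + j · g)         ≈⟨ xyx⁻¹≈y (y + j · g) (d · g) ⟩
          d · g                                     ∎

      unique : ∀ {j k x y} → x ≈ y → j ℕ.< p → k ℕ.< p → Mem N (x + j · g) → Mem N (y + k · g) → j ≡ k
      unique {j} {k} x≈y j<p k<p m n with ℕ.<-cmp j k
      ... | tri< j<k _ _ = contradiction n (smaller j<k k<p (resp N (+-congʳ x≈y) m))
      ... | tri≈ _ j≡k _ = j≡k
      ... | tri> _ _ k<j = contradiction (resp N (+-congʳ x≈y) m) (smaller k<j j<p n)

    ν : Carrier → ℕ
    ν x = proj₁ (coordinate x)

    ν<p : ∀ x → ν x ℕ.< p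
    ν<p x = proj₁ (proj₂ (coordinate x))

    ν-cong : ∀ {x y} → x ≈ y → ν x ≡ ν y
    ν-cong {x} {y} x≈y = unique x≈y (ν<p x) (ν<p y) (proj₂ (proj₂ (coordinate x))) (proj₂ (proj₂ (coordinate y)))

    ν-determined : ∀ {x k} → k ℕ.< p → Mem N (x + k · g) → ν x ≡ k
    ν-determined {x} k<p m = unique refl (ν<p x) k<p (proj₂ (proj₂ (coordinate x))) m

    ν-e : ν e ≡ 1
    ν-e = ν-determined 1<p (resp N (sym (trans (+-congˡ (×-homo-1 g)) (-‿inverseʳ e))) (has0 N))

    ν-0 : ν 0# ≡ 0
    ν-0 = ν-determined (ℕ.<-trans ℕ.z<s 1<p) (resp N (sym (+-identityʳ 0#)) (has0 N))

    ν-+ : ∀ x y → ν x ℕ.+ ν y ≡ ν (x + y) ⊎ ν x ℕ.+ ν y ≡ ν (x + y) ℕ.+ p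
    ν-+ x y with ν x ℕ.+ ν y ℕ.<? p
    ... | yes s<p = inj₁ (≡.sym (ν-determined s<p sum∈N))
      where
      sum∈N : Mem N (x + y + (ν x ℕ.+ ν y) · g)
      sum∈N = resp N (trans (+-interchange x (ν x · g) y (ν y · g)) (+-congˡ (sym (×-homo-+ g (ν x) (ν y)))))
        (has+ N (proj₂ (proj₂ (coordinate x))) (proj₂ (proj₂ (coordinate y))))
    ... | no s≮p = inj₂ (≡.trans (≡.sym (ℕ.m∸n+n≡m p≤s)) (≡.cong (ℕ._+ p) (≡.sym (ν-determined r<p r∈N))))
      where
      s = ν x ℕ.+ ν y
      p≤s : p ℕ.≤ s
      p≤s = ℕ.≮⇒≥ s≮p
      r = s ℕ.∸ p
      r<p : r ℕ.< p
      r<p = ≡.subst (r ℕ.<_) (ℕ.m+n∸n≡m p p) (ℕ.∸-monoˡ-< (ℕ.+-mono-< (ν<p x) (ν<p y)) p≤s)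
      r∈N : Mem N (x + y + r · g)
      r∈N = resp N (begin
          (x + ν x · g) + (y + ν y · g)     ≈⟨ +-interchange x (ν x · g) y (ν y · g) ⟩
          x + y + (ν x · g + ν y · g)       ≈⟨ +-congˡ (×-homo-+ g (ν x) (ν y)) ⟨
          x + y + s · g                     ≈⟨ +-congˡ (×-congˡ (≡.sym (ℕ.m∸n+n≡m p≤s))) ⟩
          x + y + (r ℕ.+ p) · g             ≈⟨ +-congˡ (trans (×-homo-+ g r p) (trans (+-congˡ (p·≈0 g)) (+-identityʳ (r · g)))) ⟩
          x + y + r · g                     ∎)
        (has+ N (proj₂ (proj₂ (coordinate x))) (proj₂ (proj₂ (coordinate y))))

    additiveCoordinate : AdditiveCoordinate p e
    additiveCoordinate = record
      { ν = ν ; ν<p = ν<p ; ν-cong = ν-cong ; ν-+ = ν-+ ; ν-0 = ν-0 ; ν-e = ν-e }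

  -- Primitive idempotents and the characteristic of a finite simple ring.

  record PrimitiveIdempotent : Set (c ⊔ ℓ) where
    field
      e       : Carrier
      e≉0     : ¬ (e ≈ 0#)
      idem    : e * e ≈ e
      -- That is, e R is a minimal right ideal: each of its nonzero elements generates it.
      minimal : ∀ y → e * y ≈ y → ¬ (y ≈ 0#) → ∃[ r ] y * r ≈ e

  module Simple (simple : IsSimple R) where

    -- The x with a R x = 0 form a two-sided ideal. If it had a nonzero element, it would contain 1,
    -- and a would be 0.
    prime-ring : ∀ {a x} → ¬ (a ≈ 0#) → ¬ (x ≈ 0#) → ∃[ r ] ¬ (a * r * x ≈ 0#)
    prime-ring {a} {x} a≉0 x≉0 with any? {P = λ r → ¬ (a * r * x ≈ 0#)}
        (λ r≈s ≉0 ≈0 → ≉0 (trans (*-congʳ (*-congˡ r≈s)) ≈0)) (λ r → ¬? (a * r * x ≈? 0#))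
    ... | yes found = found
    ... | no none = contradiction
        (trans (sym (trans (*-identityʳ (a * 1#)) (*-identityʳ a))) (simple annihilator x ax≈0 x≉0 1# 1#)) a≉0
      where
      ax≈0 : ∀ r → a * r * x ≈ 0#
      ax≈0 r = decidable-stable (a * r * x ≈? 0#) (λ ≉0 → none (r , ≉0))
      annihilator : TwoSidedIdeal ring _
      annihilator = record
        { member    = λ y → ∀ r → a * r * y ≈ 0#
        ; resp      = λ y≈z ay≈0 r → trans (*-congˡ (sym y≈z)) (ay≈0 r)
        ; 0-closed  = λ r → zeroʳ (a * r)
        ; +-closed  = λ {y} {z} p q r → trans (distribˡ (a * r) y z) (trans (+-cong (p r) (q r)) (+-identityʳ 0#))
        ; *-closedˡ = λ b {y} p r → trans (sym (*-assoc (a * r) b y)) (trans (*-congʳ (*-assoc a r b)) (p (r * b)))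
        ; *-closedʳ = λ b {y} p r → trans (sym (*-assoc (a * r) y b)) (trans (*-congʳ (p r)) (zeroˡ b))
        }

    _∈_R : Rel Carrier _
    x ∈ a R = ∃[ r ] x ≈ a * r

    ∈R-trans : ∀ {x y z} → x ∈ y R → y ∈ z R → x ∈ z R
    ∈R-trans {z = z} (r , x≈yr) (s , y≈zs) = s * r , trans x≈yr (trans (*-congʳ y≈zs) (*-assoc z s r))

    ∈R? : ∀ x a → Dec (x ∈ a R)
    ∈R? x a = any? (λ r≈s x≈ar → trans x≈ar (*-congˡ r≈s)) (λ r → x ≈? a * r)

    -- One pass is enough, because the candidate ideal only shrinks: an x outside it stays outside,
    -- and an x to which the search moves generates an ideal containing the final one.
    descend : ∀ xs b → ¬ (b ≈ 0#) → ∃[ a ] ¬ (a ≈ 0#) × a ∈ b R ×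
              All (λ x → ¬ (x ≈ 0#) → x ∈ a R → a ∈ x R) xs
    descend [] b b≉0 = b , b≉0 , (1# , sym (*-identityʳ b)) , []
    descend (x ∷ xs) b b≉0 with x ≈? 0# | ∈R? x b
    ... | no x≉0 | yes x∈b = let a , a≉0 , a∈x , all = descend xs x x≉0 in
      a , a≉0 , ∈R-trans a∈x x∈b , (λ _ _ → a∈x) ∷ all
    ... | yes x≈0 | _ = let a , a≉0 , a∈b , all = descend xs b b≉0 in
      a , a≉0 , a∈b , (λ x≉0 → contradiction x≈0 x≉0) ∷ all
    ... | no _ | no x∉b = let a , a≉0 , a∈b , all = descend xs b b≉0 in
      a , a≉0 , a∈b , (λ _ x∈a → contradiction (∈R-trans x∈a a∈b) x∉b) ∷ all

    minimal-right-ideal : ∃[ a ] ¬ (a ≈ 0#) × (∀ x → ¬ (x ≈ 0#) → x ∈ a R → a ∈ x R)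
    minimal-right-ideal with a , a≉0 , _ , all ← descend elements 1# 1≉0 =
      a , a≉0 , all-elements
        (λ x≈y h y≉0 (r , y≈ar) → let s , a≈xs = h (y≉0 ∘ trans (sym x≈y)) (r , trans x≈y y≈ar) in
          s , trans a≈xs (*-congʳ x≈y)) all

    -- Brauer's lemma: if x maps a minimal right ideal J onto itself, then the e ∈ J with
    -- x e = x is idempotent, as left multiplication by x is injective on J.
    primitiveIdempotent : PrimitiveIdempotent
    primitiveIdempotent = record { e = e ; e≉0 = e≉0 ; idem = idem ; minimal = min-e }
      where
      a = proj₁ minimal-right-ideal
      a≉0 = proj₁ (proj₂ minimal-right-ideal)
      min = proj₂ (proj₂ minimal-right-ideal)
      r = proj₁ (prime-ring a≉0 a≉0)
      ara≉0 = proj₂ (prime-ring a≉0 a≉0)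
      xa∋a = min (a * r * a) ara≉0 (r * a , *-assoc a r a)
      s = proj₁ xa∋a
      a≈xas = proj₂ xa∋a
      x = a * r
      -- Since a = x a s, this element satisfies x e = x a s r = a r = x.
      e = a * (s * r)
      xe≈x : x * e ≈ x
      xe≈x = begin
        x * (a * (s * r))   ≈⟨ *-assoc x a (s * r) ⟨
        x * a * (s * r)     ≈⟨ *-assoc (x * a) s r ⟨
        x * a * s * r       ≈⟨ *-congʳ a≈xas ⟨
        a * r               ∎
      injective : ∀ y → y ∈ a R → x * y ≈ 0# → y ≈ 0#
      injective y y∈a xy≈0 = decidable-stable (y ≈? 0#) λ y≉0 →
        let t , a≈yt = min y y≉0 y∈a in ara≉0 (begin
          x * a         ≈⟨ *-congˡ a≈yt ⟩
          x * (y * t)   ≈⟨ *-assoc x y t ⟨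
          x * y * t     ≈⟨ *-congʳ xy≈0 ⟩
          0# * t        ≈⟨ zeroˡ t ⟩
          0#            ∎)
      idem : e * e ≈ e
      idem = x∙y⁻¹≈ε⇒x≈y (e * e) e (injective (e * e - e) (s * r * e - s * r , ee-e∈) x[ee-e]≈0)
        where
        ee-e∈ : e * e - e ≈ a * (s * r * e - s * r)
        ee-e∈ = sym (begin
          a * (s * r * e - s * r)              ≈⟨ distribˡ a (s * r * e) (- (s * r)) ⟩
          a * (s * r * e) + a * - (s * r)      ≈⟨ +-cong (sym (*-assoc a (s * r) e)) (sym (-‿distribʳ-* a (s * r))) ⟩
          e * e - e                            ∎)
        x[ee-e]≈0 : x * (e * e - e) ≈ 0#
        x[ee-e]≈0 = begin
          x * (e * e - e)          ≈⟨ distribˡ x (e * e) (- e) ⟩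
          x * (e * e) + x * - e    ≈⟨ +-cong (trans (sym (*-assoc x e e)) (*-congʳ xe≈x)) (sym (-‿distribʳ-* x e)) ⟩
          x * e - x * e            ≈⟨ -‿inverseʳ (x * e) ⟩
          0#                       ∎
      e≉0 : ¬ (e ≈ 0#)
      e≉0 e≈0 = ara≉0 (begin
        x * a         ≈⟨ *-congʳ xe≈x ⟨
        x * e * a     ≈⟨ *-congʳ (*-congˡ e≈0) ⟩
        x * 0# * a    ≈⟨ *-congʳ (zeroʳ x) ⟩
        0# * a        ≈⟨ zeroˡ a ⟩
        0#            ∎)
      min-e : ∀ y → e * y ≈ y → ¬ (y ≈ 0#) → ∃[ t ] y * t ≈ e
      min-e y ey≈y y≉0 =
        let t , a≈yt = min y y≉0 (s * r * y , trans (sym ey≈y) (*-assoc a (s * r) y)) in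
        t * (s * r) , trans (sym (*-assoc y t (s * r))) (*-congʳ (sym a≈yt))

    torsion : ℕ → TwoSidedIdeal ring (c ⊔ ℓ)
    torsion n = record
      { member    = λ x → Lift c (n · x ≈ 0#)
      ; resp      = λ x≈y (lift p) → lift (trans (×-congʳ n (sym x≈y)) p)
      ; 0-closed  = lift (trans (×-congʳ n (sym (zeroˡ 0#))) (trans (sym (×-assoc-* n 0# 0#)) (zeroʳ (n · 0#))))
      ; +-closed  = λ {x} {y} (lift p) (lift q) → lift (trans (·-+ x y n) (trans (+-cong p q) (+-identityʳ 0#)))
      ; *-closedˡ = λ a {x} (lift p) → lift (trans (sym (×-comm-* n a x)) (trans (*-congˡ p) (zeroʳ a)))
      ; *-closedʳ = λ a {x} (lift p) → lift (trans (sym (×-assoc-* n x a)) (trans (*-congʳ p) (zeroˡ a)))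
      }

    -- Prime factors of `size` are removed one by one as long as the remaining product still kills
    -- 1. The first p that cannot be removed kills a nonzero multiple of 1, so its torsion ideal is
    -- everything.
    characteristic : ∃[ p ] Prime p × (∀ x → p · x ≈ 0#)
    characteristic = go (PrimeFactorisation.factors f) (PrimeFactorisation.factorsPrime f)
      (≡.subst (λ n → n · 1# ≈ 0#) (PrimeFactorisation.isFactorisation f) (size·≈0 1#))
      where
      f = factorise size {{size≢0}}
      go : ∀ ps → All Prime ps → ℕ.product ps · 1# ≈ 0# → ∃[ p ] Prime p × (∀ x → p · x ≈ 0#)
      go [] _ eq = contradiction (trans (sym (×-homo-1 1#)) eq) 1≉0
      go (p ∷ ps) (prime-p ∷ primes) eq with ℕ.product ps · 1# ≈? 0#
      ... | yes eq′ = go ps primes eq′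
      ... | no ≉0 = p , prime-p , λ x → lower (simple (torsion p) (ℕ.product ps · 1#)
                      (lift (trans (×-assocˡ 1# p (ℕ.product ps)) eq)) ≉0 x)

-- Enumeration of the finite rings of bounded size by operation tables.

module FiniteRingTables where

  Op₁ Op₂ : ℕ → Set
  Op₁ n = Fin n → Fin n
  Op₂ n = Fin n → Fin n → Fin n

  Laws : ∀ {n} → Op₂ n → Op₂ n → Op₁ n → Fin n → Fin n → Set
  Laws _⊕_ _⊛_ ⊖_ 0̂ 1̂ =
      (∀ i j k → ((i ⊕ j) ⊕ k) ≡ (i ⊕ (j ⊕ k)))
    × (∀ i j → (i ⊕ j) ≡ (j ⊕ i))
    × (∀ i → (0̂ ⊕ i) ≡ i)
    × (∀ i → ((⊖ i) ⊕ i) ≡ 0̂)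
    × (∀ i j k → ((i ⊛ j) ⊛ k) ≡ (i ⊛ (j ⊛ k)))
    × (∀ i → (1̂ ⊛ i) ≡ i)
    × (∀ i → (i ⊛ 1̂) ≡ i)
    × (∀ i j k → (i ⊛ (j ⊕ k)) ≡ ((i ⊛ j) ⊕ (i ⊛ k)))
    × (∀ i j k → ((j ⊕ k) ⊛ i) ≡ ((j ⊛ i) ⊕ (k ⊛ i)))
    × ¬ (1̂ ≡ 0̂)

  laws? : ∀ {n} add mul neg z o → Dec (Laws {n} add mul neg z o)
  laws? {n} _⊕_ _⊛_ ⊖_ 0̂ 1̂ =
      ∀³ (λ i j k → ((i ⊕ j) ⊕ k) Fin.≟ (i ⊕ (j ⊕ k)))
    ×-dec ∀² (λ i j → (i ⊕ j) Fin.≟ (j ⊕ i))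
    ×-dec Fin.all? (λ i → (0̂ ⊕ i) Fin.≟ i)
    ×-dec Fin.all? (λ i → ((⊖ i) ⊕ i) Fin.≟ 0̂)
    ×-dec ∀³ (λ i j k → ((i ⊛ j) ⊛ k) Fin.≟ (i ⊛ (j ⊛ k)))
    ×-dec Fin.all? (λ i → (1̂ ⊛ i) Fin.≟ i)
    ×-dec Fin.all? (λ i → (i ⊛ 1̂) Fin.≟ i)
    ×-dec ∀³ (λ i j k → (i ⊛ (j ⊕ k)) Fin.≟ ((i ⊛ j) ⊕ (i ⊛ k)))
    ×-dec ∀³ (λ i j k → ((j ⊕ k) ⊛ i) Fin.≟ ((j ⊛ i) ⊕ (k ⊛ i)))
    ×-dec ¬? (1̂ Fin.≟ 0̂)
    where
    ∀² : {P : Fin n → Fin n → Set} → (∀ i j → Dec (P i j)) → Dec (∀ i j → P i j)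
    ∀² P? = Fin.all? (λ i → Fin.all? (P? i))
    ∀³ : {P : Fin n → Fin n → Fin n → Set} → (∀ i j k → Dec (P i j k)) → Dec (∀ i j k → P i j k)
    ∀³ P? = Fin.all? (λ i → ∀² (P? i))

  tableRing : ∀ {n} add mul neg z o → Laws {n} add mul neg z o → FiniteRing 0ℓ 0ℓ
  tableRing {n} add mul neg z o
    (+-assoc , +-comm , +-identityˡ , -inverseˡ , *-assoc , *-identityˡ , *-identityʳ , distribˡ , distribʳ , 1≢0) =
    record
    { ring = record
      { Carrier = Fin n ; _≈_ = _≡_ ; _+_ = add ; _*_ = mul ; -_ = neg ; 0# = z ; 1# = o
      ; isRing = record
        { +-isAbelianGroup = record
          { isGroup = record
            { isMonoid = record
              { isSemigroup = record
                { isMagma = record { isEquivalence = ≡.isEquivalence ; ∙-cong = ≡.cong₂ add }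
                ; assoc = +-assoc }
              ; identity = +-identityˡ , λ i → ≡.trans (+-comm i z) (+-identityˡ i) }
            ; inverse = -inverseˡ , λ i → ≡.trans (+-comm i (neg i)) (-inverseˡ i)
            ; ⁻¹-cong = ≡.cong neg }
          ; comm = +-comm }
        ; *-cong = ≡.cong₂ mul
        ; *-assoc = *-assoc
        ; *-identity = *-identityˡ , *-identityʳ
        ; distrib = distribˡ , distribʳ } }
    ; 1≉0 = 1≢0
    ; size = n
    ; enumeration = Identity.inverse (≡.setoid (Fin n)) }

  Code : ℕ → Set
  Code n = Fin ((n ℕ.^ n) ℕ.^ n) × Fin ((n ℕ.^ n) ℕ.^ n) × Fin (n ℕ.^ n) × Fin n × Fin n

  codes : ∀ n → List (Code n)
  codes n = cartesianProduct (allFin _) (cartesianProduct (allFin _)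
    (cartesianProduct (allFin _) (cartesianProduct (allFin n) (allFin n))))

  ∈-codes : ∀ {n} (x : Code n) → x ∈ᴸ codes n
  ∈-codes (a , m , s , z , o) = ∈-cartesianProduct⁺ (∈-allFin a) (∈-cartesianProduct⁺ (∈-allFin m)
    (∈-cartesianProduct⁺ (∈-allFin s) (∈-cartesianProduct⁺ (∈-allFin z) (∈-allFin o))))

  decode₂ : ∀ {n} → Fin ((n ℕ.^ n) ℕ.^ n) → Op₂ n
  decode₂ a i = finToFun (finToFun a i)

  encode₂ : ∀ {n} → Op₂ n → Fin ((n ℕ.^ n) ℕ.^ n)
  encode₂ f = funToFin (λ i → funToFin (f i))

  decode₂-encode₂ : ∀ {n} (f : Op₂ n) i j → decode₂ (encode₂ f) i j ≡ f i j
  decode₂-encode₂ f i j = ≡.trans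
    (≡.cong (λ a → finToFun a j) (Fin.finToFun-funToFin (λ i → funToFin (f i)) i))
    (Fin.finToFun-funToFin (f i) j)

  CodeLaws : ∀ {n} → Code n → Set
  CodeLaws (a , m , s , z , o) = Laws (decode₂ a) (decode₂ m) (finToFun s) z o

  codeLaws? : ∀ {n} (x : Code n) → Dec (CodeLaws x)
  codeLaws? (a , m , s , z , o) = laws? (decode₂ a) (decode₂ m) (finToFun s) z o

  decoded : ∀ {n} (x : Code n) → Dec (CodeLaws x) → List (FiniteRing 0ℓ 0ℓ)
  decoded (a , m , s , z , o) (yes laws) = tableRing (decode₂ a) (decode₂ m) (finToFun s) z o laws ∷ []
  decoded _                   (no _)     = []

  ringsOfSize : ℕ → List (FiniteRing 0ℓ 0ℓ)
  ringsOfSize n = concatMap (λ x → decoded x (codeLaws? x)) (codes n)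

  ringsOfSize≤ : ℕ → List (FiniteRing 0ℓ 0ℓ)
  ringsOfSize≤ M = concatMap ringsOfSize (upTo (suc M))

  module _ (R : FiniteRing c ℓ) where
    open FiniteRing R
    open FiniteRingProperties R

    private
      to-injective : ∀ {i j} → to i ≈ to j → i ≡ j
      to-injective {i} {j} eq = ≡.trans (≡.sym (strictlyInverseʳ i)) (≡.trans (from-cong eq) (strictlyInverseʳ j))

      -- The operations are arbitrary ones that `to` carries to those of R, because decoded tables
      -- agree with the original operations only pointwise.
      module _ (add mul : Op₂ size) (neg : Op₁ size) (z o : Fin size)
               (to-add : ∀ i j → to (add i j) ≈ to i + to j)
               (to-mul : ∀ i j → to (mul i j) ≈ to i * to j)
               (to-neg : ∀ i → to (neg i) ≈ - to i)
               (to-z : to z ≈ 0#) (to-o : to o ≈ 1#) where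

        transported-laws : Laws add mul neg z o
        transported-laws =
          (λ i j k → to-injective (trans (trans (to-add (add i j) k) (+-congʳ (to-add i j)))
            (trans (+-assoc (to i) (to j) (to k))
              (sym (trans (to-add i (add j k)) (+-congˡ (to-add j k))))))) ,
          (λ i j → to-injective (trans (to-add i j) (trans (+-comm (to i) (to j)) (sym (to-add j i))))) ,
          (λ i → to-injective (trans (to-add z i) (trans (+-congʳ to-z) (+-identityˡ (to i))))) ,
          (λ i → to-injective (trans (to-add (neg i) i) (trans (+-congʳ (to-neg i))
            (trans (-‿inverseˡ (to i)) (sym to-z))))) ,
          (λ i j k → to-injective (trans (trans (to-mul (mul i j) k) (*-congʳ (to-mul i j)))
            (trans (*-assoc (to i) (to j) (to k))
              (sym (trans (to-mul i (mul j k)) (*-congˡ (to-mul j k))))))) ,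
          (λ i → to-injective (trans (to-mul o i) (trans (*-congʳ to-o) (*-identityˡ (to i))))) ,
          (λ i → to-injective (trans (to-mul i o) (trans (*-congˡ to-o) (*-identityʳ (to i))))) ,
          (λ i j k → to-injective (trans (trans (to-mul i (add j k)) (*-congˡ (to-add j k)))
            (trans (distribˡ (to i) (to j) (to k))
              (sym (trans (to-add (mul i j) (mul i k)) (+-cong (to-mul i j) (to-mul i k))))))) ,
          (λ i j k → to-injective (trans (trans (to-mul (add j k) i) (*-congʳ (to-add j k)))
            (trans (distribʳ (to i) (to j) (to k))
              (sym (trans (to-add (mul j i) (mul k i)) (+-cong (to-mul j i) (to-mul k i))))))) ,
          (λ o≡z → 1≉0 (trans (sym to-o) (trans (to-cong o≡z) to-z)))

        ≅tableRing : ∀ laws → R ≅ tableRing add mul neg z o laws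
        ≅tableRing laws = from , record
          { isRingMonomorphism = record
            { isRingHomomorphism = record
              { isSemiringHomomorphism = record
                { isNearSemiringHomomorphism = record
                  { +-isMonoidHomomorphism = record
                    { isMagmaHomomorphism = record
                      { isRelHomomorphism = record { cong = from-cong }
                      ; homo = λ x y → from-homo (trans (to-add (from x) (from y))
                          (+-cong (strictlyInverseˡ x) (strictlyInverseˡ y))) }
                    ; ε-homo = from-homo to-z }
                  ; *-homo = λ x y → from-homo (trans (to-mul (from x) (from y))
                      (*-cong (strictlyInverseˡ x) (strictlyInverseˡ y))) }
                ; 1#-homo = from-homo to-o }
              ; -‿homo = λ x → from-homo (trans (to-neg (from x)) (-‿cong (strictlyInverseˡ x))) }
            ; injective = λ {x} {y} eq → trans (sym (strictlyInverseˡ x)) (trans (to-cong eq) (strictlyInverseˡ y)) }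
          ; surjective = λ i → to i , λ {x} x≈ → ≡.trans (from-cong x≈) (strictlyInverseʳ i) }
          where
          from-homo : ∀ {x i} → to i ≈ x → from x ≡ i
          from-homo {x} {i} eq = ≡.trans (from-cong (sym eq)) (strictlyInverseʳ i)

      add mul : Op₂ size
      add i j = from (to i + to j)
      mul i j = from (to i * to j)

      neg : Op₁ size
      neg i = from (- to i)

      code : Code size
      code = encode₂ add , encode₂ mul , funToFin neg , from 0# , from 1#

      to-add : ∀ i j → to (decode₂ (encode₂ add) i j) ≈ to i + to j
      to-add i j = trans (to-cong (decode₂-encode₂ add i j)) (strictlyInverseˡ (to i + to j))

      to-mul : ∀ i j → to (decode₂ (encode₂ mul) i j) ≈ to i * to j
      to-mul i j = trans (to-cong (decode₂-encode₂ mul i j)) (strictlyInverseˡ (to i * to j))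

      to-neg : ∀ i → to (finToFun (funToFin neg) i) ≈ - to i
      to-neg i = trans (to-cong (Fin.finToFun-funToFin neg i)) (strictlyInverseˡ (- to i))

      in-decoded : (d : Dec (CodeLaws code)) → Any (R ≅_) (decoded code d)
      in-decoded (yes laws) = here (≅tableRing _ _ _ _ _ to-add to-mul to-neg
        (strictlyInverseˡ 0#) (strictlyInverseˡ 1#) laws)
      in-decoded (no ¬laws) = contradiction (transported-laws _ _ _ _ _ to-add to-mul to-neg
        (strictlyInverseˡ 0#) (strictlyInverseˡ 1#)) ¬laws

    ∈ringsOfSize≤ : ∀ {M} → size ℕ.≤ M → Any (R ≅_) (ringsOfSize≤ M)
    ∈ringsOfSize≤ size≤M = Any.concatMap⁺ ringsOfSize (lose (∈-upTo⁺ (ℕ.s≤s size≤M))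
      (Any.concatMap⁺ _ (lose (∈-codes code) (in-decoded _))))

-- Finite sums over tuples and over the ring.

module _ (R : FiniteRing c ℓ) where
  open FiniteRing R using (Carrier; elements)

  tuples : ∀ k → List (Fin k → Carrier)
  tuples zero = Vector.[] ∷ []
  tuples (suc k) = cartesianProductWith Vector._∷_ elements (tuples k)

  private
    tails : ∀ d → Σ[ xs ∈ List (Fin d → Carrier) ] Salem.points R (suc d) ≡ cartesianProductWith Vector._∷_ elements xs
    tails d = _ , ≡.refl

    -- The function local to points depends on d both as a module parameter and as its argument.
    -- Abstracting suc d separates the two, which makes an induction on the latter possible.
    go≡tuples : ∀ w d → _ ≡ tuples d
    tails≡tuples : ∀ d → proj₁ (tails d) ≡ tuples d
    tails≡tuples d with suc d
    ... | w = go≡tuples w d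
    go≡tuples w zero = ≡.refl
    go≡tuples w (suc d) = cong (cartesianProductWith Vector._∷_ elements) (go≡tuples w d)

  points≡tuples : ∀ d → Salem.points R d ≡ tuples d
  points≡tuples zero = ≡.refl
  points≡tuples (suc d) = cong (cartesianProductWith Vector._∷_ elements) (tails≡tuples d)

module Indicators where
  open import Data.Rational.Base using (_+_; _*_; _≤_)
  open ≡ using (refl; sym; trans)

  [_] : Dec A → ℚ
  [ yes _ ] = 1ℚ
  [ no _ ]  = 0ℚ

  []-yes : (a? : Dec A) → A → [ a? ] ≡ 1ℚ
  []-yes (yes _) _ = refl
  []-yes (no ¬a) a = contradiction a ¬a

  []-no : (a? : Dec A) → ¬ A → [ a? ] ≡ 0ℚ
  []-no (yes a) ¬a = contradiction a ¬a
  []-no (no _)  _  = refl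

  []-mono : (a? : Dec A) (b? : Dec B) → (A → B) → [ a? ] ≤ [ b? ]
  []-mono (yes a) b? f = ℚ.≤-reflexive (sym ([]-yes b? (f a)))
  []-mono (no _) (yes _) _ = ℚ.nonNegative⁻¹ 1ℚ
  []-mono (no _) (no _)  _ = ℚ.≤-refl

  []-cong : (a? : Dec A) (b? : Dec B) → (A → B) → (B → A) → [ a? ] ≡ [ b? ]
  []-cong (yes a) b? f _ = sym ([]-yes b? (f a))
  []-cong (no ¬a) b? _ g = sym ([]-no b? (¬a ∘ g))

  []-split : (a? : Dec A) (b? : Dec B) → [ a? ] ≡ [ a? ×-dec b? ] + [ a? ×-dec ¬? b? ]
  []-split (yes _) (yes _) = refl
  []-split (yes _) (no _)  = refl
  []-split (no _)  (yes _) = refl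
  []-split (no _)  (no _)  = refl

  []-* : (a? : Dec A) {x y : ℚ} → (A → x ≡ y) → [ a? ] * x ≡ [ a? ] * y
  []-* (yes a) f = cong (1ℚ *_) (f a)
  []-* (no _) {x} {y} _ = trans (ℚ.*-zeroˡ x) (sym (ℚ.*-zeroˡ y))

  Σᴸ : (A → ℚ) → List A → ℚ
  Σᴸ f []       = 0ℚ
  Σᴸ f (x ∷ xs) = f x + Σᴸ f xs

  Σᴸ-cong : ∀ {f g : A → ℚ} → f ≗ g → Σᴸ f ≗ Σᴸ g
  Σᴸ-cong eq []       = refl
  Σᴸ-cong eq (x ∷ xs) = cong₂ _+_ (eq x) (Σᴸ-cong eq xs)

  Σᴸ-++ : ∀ (f : A → ℚ) xs ys → Σᴸ f (xs ++ ys) ≡ Σᴸ f xs + Σᴸ f ys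
  Σᴸ-++ f []       ys = sym (ℚ.+-identityˡ (Σᴸ f ys))
  Σᴸ-++ f (x ∷ xs) ys = trans (cong (f x +_) (Σᴸ-++ f xs ys)) (sym (ℚ.+-assoc (f x) (Σᴸ f xs) (Σᴸ f ys)))

  Σᴸ-map : ∀ (f : B → ℚ) (g : A → B) xs → Σᴸ f (map g xs) ≡ Σᴸ (f ∘ g) xs
  Σᴸ-map f g []       = refl
  Σᴸ-map f g (x ∷ xs) = cong (f (g x) +_) (Σᴸ-map f g xs)

  Σᴸ-*ˡ : ∀ r (f : A → ℚ) xs → Σᴸ (λ x → r * f x) xs ≡ r * Σᴸ f xs
  Σᴸ-*ˡ r f []       = sym (ℚ.*-zeroʳ r)
  Σᴸ-*ˡ r f (x ∷ xs) = trans (cong (r * f x +_) (Σᴸ-*ˡ r f xs)) (sym (ℚ.*-distribˡ-+ r (f x) (Σᴸ f xs)))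

  Σᴸ-cartesianProductWith : ∀ {C : Set κ} (f : C → ℚ) (g : A → B → C) xs ys →
    Σᴸ f (cartesianProductWith g xs ys) ≡ Σᴸ (λ x → Σᴸ (λ y → f (g x y)) ys) xs
  Σᴸ-cartesianProductWith f g []       ys = refl
  Σᴸ-cartesianProductWith f g (x ∷ xs) ys =
    trans (Σᴸ-++ f (map (g x) ys) (cartesianProductWith g xs ys))
      (cong₂ _+_ (Σᴸ-map f (g x) ys) (Σᴸ-cartesianProductWith f g xs ys))

  Σᴸ-filter : ∀ (f : A → ℚ) {P : Pred A κ} (P? : Decidable P) xs →
              Σᴸ f (filter P? xs) ≡ Σᴸ (λ x → [ P? x ] * f x) xs
  Σᴸ-filter f P? [] = refl
  Σᴸ-filter f P? (x ∷ xs) with P? x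
  ... | yes _ = cong₂ _+_ (sym (ℚ.*-identityˡ (f x))) (Σᴸ-filter f P? xs)
  ... | no _  = trans (Σᴸ-filter f P? xs)
    (sym (trans (cong (_+ _) (ℚ.*-zeroˡ (f x))) (ℚ.+-identityˡ _)))

  Σᴸ-length : ∀ (xs : List A) → Σᴸ (λ _ → 1ℚ) xs ≡ RationalLemmas.fromℕ (length xs)
  Σᴸ-length []       = sym RationalLemmas.fromℕ-0
  Σᴸ-length (x ∷ xs) = trans (cong (1ℚ +_) (Σᴸ-length xs))
    (trans (ℚ.+-comm 1ℚ (RationalLemmas.fromℕ (length xs))) (sym (RationalLemmas.fromℕ-suc (length xs))))

module RingSums (R : FiniteRing c ℓ) where
  open FiniteRing R using (Carrier; _≈_; _≈?_; size; elements)
  open FiniteRingProperties R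
  open import Data.Rational.Base using (_+_; _*_; _≤_)
  open RationalLemmas
  open Indicators
  open ≡ using (refl; sym; trans)
  open CommutativeMonoidSum ℚ.+-0-commutativeMonoid using (sum; sum-cong-≗; ∑-distrib-+; ∑-comm; sum-permute)
  open SemiringSum (CommutativeRing.semiring ℚ.+-*-commutativeRing) using (*-distribˡ-sum)

  ∑ : (Carrier → ℚ) → ℚ
  ∑ f = sum (λ i → f (to i))

  private
    Congruent : (Carrier → ℚ) → Set _
    Congruent f = ∀ {x y} → x ≈ y → f x ≡ f y

  ∑-cong : ∀ {f g} → (∀ x → f x ≡ g x) → ∑ f ≡ ∑ g
  ∑-cong eq = sum-cong-≗ (λ i → eq (to i))

  ∑-+ : ∀ f g → ∑ (λ x → f x + g x) ≡ ∑ f + ∑ g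
  ∑-+ f g = ∑-distrib-+ (f ∘ to) (g ∘ to)

  ∑-*ˡ : ∀ r f → ∑ (λ x → r * f x) ≡ r * ∑ f
  ∑-*ˡ r f = sym (*-distribˡ-sum r (f ∘ to))

  ∑-*ʳ : ∀ r f → ∑ (λ x → f x * r) ≡ ∑ f * r
  ∑-*ʳ r f = trans (∑-cong (λ x → ℚ.*-comm (f x) r)) (trans (∑-*ˡ r f) (ℚ.*-comm r (∑ f)))

  ∑-swap : ∀ (f : Carrier → Carrier → ℚ) → ∑ (λ x → ∑ (f x)) ≡ ∑ (λ y → ∑ (λ x → f x y))
  ∑-swap f = ∑-comm (λ i j → f (to i) (to j))

  -- A comparison at the representatives `to i` alone, which is where `bounds` supplies the Salem
  -- estimates.
  ∑-mono-to : ∀ {f g} → (∀ i → f (to i) ≤ g (to i)) → ∑ f ≤ ∑ g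
  ∑-mono-to {f} {g} le = go size (f ∘ to) (g ∘ to) le
    where
    go : ∀ n (u v : Fin n → ℚ) → (∀ i → u i ≤ v i) → sum u ≤ sum v
    go zero    u v le = ℚ.≤-refl
    go (suc n) u v le = ℚ.+-mono-≤ (le Fin.zero) (go n (u ∘ Fin.suc) (v ∘ Fin.suc) (le ∘ Fin.suc))

  ∑-mono : ∀ {f g} → (∀ x → f x ≤ g x) → ∑ f ≤ ∑ g
  ∑-mono {f} {g} le = ∑-mono-to {f} {g} (λ i → le (to i))

  ∑-reindex : ∀ {f} → Congruent f → (φ φ⁻¹ : Carrier → Carrier) →
              (∀ {x y} → x ≈ y → φ x ≈ φ y) → (∀ {x y} → x ≈ y → φ⁻¹ x ≈ φ⁻¹ y) →
              (∀ x → φ (φ⁻¹ x) ≈ x) → (∀ x → φ⁻¹ (φ x) ≈ x) → ∑ (f ∘ φ) ≡ ∑ f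
  ∑-reindex {f} f-cong φ φ⁻¹ φ-cong φ⁻¹-cong φφ⁻¹ φ⁻¹φ = sym (trans
    (sum-permute (f ∘ to) π)
    (sum-cong-≗ (λ i → f-cong (strictlyInverseˡ (φ (to i))))))
    where
    open FiniteRing R using () renaming (trans to ≈-trans)
    π : Perm.Permutation size size
    π = Perm.permutation (λ i → from (φ (to i))) (λ i → from (φ⁻¹ (to i)))
      (λ i → ≡.trans (from-cong (≈-trans (φ-cong (strictlyInverseˡ _)) (φφ⁻¹ (to i)))) (strictlyInverseʳ i))
      (λ i → ≡.trans (from-cong (≈-trans (φ⁻¹-cong (strictlyInverseˡ _)) (φ⁻¹φ (to i)))) (strictlyInverseʳ i))

  Σᴸ-elements : ∀ f → Σᴸ f elements ≡ ∑ f
  Σᴸ-elements f = trans (cong (Σᴸ f) (List.map-tabulate (λ i → i) to)) (go size to)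
    where
    go : ∀ n (g : Fin n → Carrier) → Σᴸ f (tabulate g) ≡ sum (f ∘ g)
    go zero    g = refl
    go (suc n) g = cong (f (g Fin.zero) +_) (go n (g ∘ Fin.suc))

  module _ {P : Pred Carrier κ} (P? : Decidable P) where

    indices : List (Fin size)
    indices = filter (P? ∘ to) (allFin size)

    card : ℕ
    card = length indices

    ∑-card : ∑ (λ x → [ P? x ]) ≡ fromℕ card
    ∑-card = sym (begin
      fromℕ card                                          ≡⟨ Σᴸ-length indices ⟨
      Σᴸ (λ _ → 1ℚ) indices                               ≡⟨ Σᴸ-filter (λ _ → 1ℚ) (P? ∘ to) (allFin size) ⟩
      Σᴸ (λ i → [ P? (to i) ] * 1ℚ) (allFin size)         ≡⟨ Σᴸ-cong (λ i → ℚ.*-identityʳ [ P? (to i) ]) (allFin size) ⟩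
      Σᴸ (λ i → [ P? (to i) ]) (allFin size)              ≡⟨ Σᴸ-map (λ x → [ P? x ]) to (allFin size) ⟨
      Σᴸ (λ x → [ P? x ]) elements                        ≡⟨ Σᴸ-elements (λ x → [ P? x ]) ⟩
      ∑ (λ x → [ P? x ])                                  ∎)
      where open ≡.≡-Reasoning

  ∑-single : ∀ a r → ∑ (λ x → [ x ≈? a ] * r) ≡ r
  ∑-single a r = trans (∑-*ʳ r (λ x → [ x ≈? a ])) (trans (cong (_* r) one) (ℚ.*-identityˡ r))
    where
    go : ∀ n (k : Fin n) → sum (λ i → [ i Fin.≟ k ]) ≡ 1ℚ
    go (suc n) Fin.zero    = cong (1ℚ +_) (zeros n)
      where
      zeros : ∀ m → sum {m} (λ _ → 0ℚ) ≡ 0ℚ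
      zeros zero    = refl
      zeros (suc m) = trans (ℚ.+-identityˡ _) (zeros m)
    go (suc n) (Fin.suc k) = trans (ℚ.+-identityˡ _) (trans
      (sum-cong-≗ (λ i → []-cong (Fin.suc i Fin.≟ Fin.suc k) (i Fin.≟ k) Fin.suc-injective (cong Fin.suc))) (go n k))
    one : ∑ (λ x → [ x ≈? a ]) ≡ 1ℚ
    one = trans (sum-cong-≗ (λ i → []-cong (to i ≈? a) (i Fin.≟ from a)
        (λ to≈a → ≡.trans (≡.sym (strictlyInverseʳ i)) (from-cong to≈a))
        (λ { refl → strictlyInverseˡ a }))) (go size (from a))

-- Units, and the size of H and of its fibres.

module Units (R : FiniteRing c ℓ) where
  open FiniteRing R
  open FiniteRingProperties R
  open RingSums R
  open RationalLemmas using (fromℕ; fromℕ-1; fromℕ-*; fromℕ-cancel-≤; fromℕ-+)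
  open Indicators
  open MonoidSum *-monoid using () renaming (sum to product)
  open import Relation.Binary.Reasoning.Setoid setoid

  Unit : Pred Carrier (c ⊔ ℓ)
  Unit x = ∃[ y ] x * y ≈ 1#

  unit-resp : Unit Respects _≈_
  unit-resp x≈y (z , xz≈1) = z , trans (*-congʳ (sym x≈y)) xz≈1

  unit? : Decidable Unit
  unit? x = any? (λ y≈z xy≈1 → trans (*-congˡ (sym y≈z)) xy≈1) (λ y → x * y ≈? 1#)

  -- If y had no right inverse, the injection r ↦ y r would miss 1.
  dedekind-finite : ∀ {x y} → x * y ≈ 1# → y * x ≈ 1#
  dedekind-finite {x} {y} xy≈1 with unit? y
  ... | yes (z , yz≈1) = trans (*-congˡ (begin
      x             ≈⟨ *-identityʳ x ⟨
      x * 1#        ≈⟨ *-congˡ yz≈1 ⟨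
      x * (y * z)   ≈⟨ *-assoc x y z ⟨
      x * y * z     ≈⟨ *-congʳ xy≈1 ⟩
      1# * z        ≈⟨ *-identityˡ z ⟩
      z             ∎)) yz≈1
  ... | no ∄z = contradiction (Fin.injective⇒≤ {f = extended} (λ {i} {j} → injective i j)) ℕ.1+n≰n
    where
    extended : Fin (suc size) → Fin size
    extended Fin.zero    = from 1#
    extended (Fin.suc i) = from (y * to i)
    from-injective : ∀ {u v} → from u ≡ from v → u ≈ v
    from-injective {u} {v} eq = trans (sym (strictlyInverseˡ u)) (trans (to-cong eq) (strictlyInverseˡ v))
    injective : ∀ i j → extended i ≡ extended j → i ≡ j
    injective Fin.zero    Fin.zero    _  = ≡.refl
    injective Fin.zero    (Fin.suc j) eq = contradiction (to j , sym (from-injective eq)) ∄z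
    injective (Fin.suc i) Fin.zero    eq = contradiction (to i , from-injective eq) ∄z
    injective (Fin.suc i) (Fin.suc j) eq = cong Fin.suc (≡.trans (≡.sym (strictlyInverseʳ i))
      (≡.trans (from-cong (begin
        to i               ≈⟨ cancel (to i) ⟨
        x * (y * to i)     ≈⟨ *-congˡ (from-injective eq) ⟩
        x * (y * to j)     ≈⟨ cancel (to j) ⟩
        to j               ∎)) (strictlyInverseʳ j)))
      where
      cancel : ∀ r → x * (y * r) ≈ r
      cancel r = trans (sym (*-assoc x y r)) (trans (*-congʳ xy≈1) (*-identityˡ r))

  u : ℕ
  u = card unit?

  1≤u : 1 ℕ.≤ u
  1≤u = fromℕ-cancel-≤ (subst₂ ℚ._≤_ (≡.trans (∑-cong (λ x → ≡.sym (ℚ.*-identityʳ [ x ≈? 1# ])))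
      (≡.trans (∑-single 1# 1ℚ) (≡.sym fromℕ-1))) (∑-card unit?)
    (∑-mono (λ x → []-mono (x ≈? 1#) (unit? x) (λ x≈1 → 1# , trans (*-congʳ x≈1) (*-identityˡ 1#)))))

  solutions : ℕ → Carrier → ℚ
  solutions k x = Σᴸ (λ v → [ x * product v ≈? 1# ]) (tuples R k)

  Σᴸ-tuples : ∀ k (f : (Fin (suc k) → Carrier) → ℚ) →
              Σᴸ f (tuples R (suc k)) ≡ ∑ (λ y → Σᴸ (λ v → f (y Vector.∷ v)) (tuples R k))
  Σᴸ-tuples k f = ≡.trans (Σᴸ-cartesianProductWith f Vector._∷_ elements (tuples R k))
    (Σᴸ-elements (λ y → Σᴸ (λ v → f (y Vector.∷ v)) (tuples R k)))

  solutions-suc : ∀ k x → solutions (suc k) x ≡ ∑ (λ y → solutions k (x * y))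
  solutions-suc k x = ≡.trans (Σᴸ-tuples k (λ v → [ x * product v ≈? 1# ]))
    (∑-cong (λ y → Σᴸ-cong (λ v → []-cong (x * (y * product v) ≈? 1#) (x * y * product v ≈? 1#)
      (trans (*-assoc x y (product v))) (trans (sym (*-assoc x y (product v))))) (tuples R k)))

  solutions-1 : ∀ x → solutions 1 x ≡ [ unit? x ]
  solutions-1 x = ≡.trans (solutions-suc 0 x) (≡.trans (∑-cong (λ y → ≡.trans
      (ℚ.+-identityʳ [ x * y * 1# ≈? 1# ])
      ([]-cong (x * y * 1# ≈? 1#) (x * y ≈? 1#) (trans (sym (*-identityʳ (x * y)))) (trans (*-identityʳ (x * y))))))
    (go (unit? x)))
    where
    go : (d : Dec (Unit x)) → ∑ (λ y → [ x * y ≈? 1# ]) ≡ [ d ]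
    go (yes (z , xz≈1)) = ≡.trans (∑-cong (λ y → ≡.trans ([]-cong (x * y ≈? 1#) (y ≈? z)
        (λ xy≈1 → trans (sym (zx· y)) (trans (*-congˡ xy≈1) (*-identityʳ z)))
        (λ y≈z → trans (*-congˡ y≈z) xz≈1)) (≡.sym (ℚ.*-identityʳ [ y ≈? z ])))) (∑-single z 1ℚ)
      where
      zx· : ∀ y → z * (x * y) ≈ y
      zx· y = trans (sym (*-assoc z x y)) (trans (*-congʳ (dedekind-finite xz≈1)) (*-identityˡ y))
    go (no ¬unit) = ≡.trans (∑-cong (λ y → ≡.trans ([]-no (x * y ≈? 1#) (λ xy≈1 → ¬unit (y , xy≈1)))
        (≡.sym (ℚ.*-zeroˡ 0ℚ)))) (≡.trans (∑-*ˡ 0ℚ (λ _ → 0ℚ)) (ℚ.*-zeroˡ (∑ (λ _ → 0ℚ))))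

  unit-*⁻ˡ : ∀ {x y} → Unit (x * y) → Unit x
  unit-*⁻ˡ {x} {y} (z , xyz≈1) = y * z , trans (sym (*-assoc x y z)) xyz≈1

  unit-*⁻ʳ : ∀ {x y} → Unit (x * y) → Unit y
  unit-*⁻ʳ {x} {y} (z , xyz≈1) = z * x ,
    trans (sym (*-assoc y z x)) (dedekind-finite (trans (sym (*-assoc x y z)) xyz≈1))

  unit-* : ∀ {x y} → Unit x → Unit y → Unit (x * y)
  unit-* {x} {y} (x′ , xx′≈1) (y′ , yy′≈1) = y′ * x′ , (begin
    x * y * (y′ * x′)     ≈⟨ *-assoc x y (y′ * x′) ⟩
    x * (y * (y′ * x′))   ≈⟨ *-congˡ (*-assoc y y′ x′) ⟨
    x * (y * y′ * x′)     ≈⟨ *-congˡ (*-congʳ yy′≈1) ⟩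
    x * (1# * x′)         ≈⟨ *-congˡ (*-identityˡ x′) ⟩
    x * x′                ≈⟨ xx′≈1 ⟩
    1#                    ∎)

  -- Factors of a product equal to 1 are units. For a unit x, k of the k + 1 factors are free units
  -- and the remaining one is determined.
  solutions≡ : ∀ k x → solutions (suc k) x ≡ [ unit? x ] ℚ.* fromℕ (u ℕ.^ k)
  solutions≡ zero    x = ≡.trans (solutions-1 x)
    (≡.sym (≡.trans (cong ([ unit? x ] ℚ.*_) fromℕ-1) (ℚ.*-identityʳ [ unit? x ])))
  solutions≡ (suc k) x = ≡.trans (solutions-suc (suc k) x) (≡.trans
    (∑-cong (λ y → ≡.trans (solutions≡ k (x * y)) (cong (ℚ._* fromℕ (u ℕ.^ k)) (split y))))
    (≡.trans (∑-*ʳ (fromℕ (u ℕ.^ k)) (λ y → [ unit? x ] ℚ.* [ unit? y ]))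
    (≡.trans (cong (ℚ._* fromℕ (u ℕ.^ k)) (≡.trans (∑-*ˡ [ unit? x ] (λ y → [ unit? y ]))
        (cong ([ unit? x ] ℚ.*_) (∑-card unit?))))
    (≡.trans (ℚ.*-assoc [ unit? x ] (fromℕ u) (fromℕ (u ℕ.^ k)))
      (cong ([ unit? x ] ℚ.*_) (≡.sym (fromℕ-* u (u ℕ.^ k))))))))
    where
    split : ∀ y → [ unit? (x * y) ] ≡ [ unit? x ] ℚ.* [ unit? y ]
    split y with unit? x
    ... | yes ux = ≡.trans ([]-cong (unit? (x * y)) (unit? y) unit-*⁻ʳ (unit-* ux)) (≡.sym (ℚ.*-identityˡ [ unit? y ]))
    ... | no ¬ux = ≡.trans ([]-no (unit? (x * y)) (¬ux ∘ unit-*⁻ˡ)) (≡.sym (ℚ.*-zeroˡ [ unit? y ]))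

  module _ (k : ℕ) where
    open Salem R (suc (suc k)) using (H; points; module Subset)
    open Subset H using (members)

    -- With k = d - 2, the fibre of H over a first coordinate x has u ^ k points if x is a unit, and
    -- none otherwise.
    Σᴸ-H : ∀ (f : Carrier → ℚ) → Σᴸ (λ v → f (v Fin.zero)) members ≡
           fromℕ (u ℕ.^ k) ℚ.* ∑ (λ x → [ unit? x ] ℚ.* f x)
    Σᴸ-H f = ≡.trans (Σᴸ-filter (λ v → f (v Fin.zero)) (λ v → product v ≈? 1#) points)
      (≡.trans (cong (Σᴸ (λ v → [ product v ≈? 1# ] ℚ.* f (v Fin.zero))) (points≡tuples R (suc (suc k))))
      (≡.trans (Σᴸ-tuples (suc k) (λ v → [ product v ≈? 1# ] ℚ.* f (v Fin.zero)))
      (≡.trans (∑-cong fibre) (∑-*ˡ (fromℕ (u ℕ.^ k)) (λ x → [ unit? x ] ℚ.* f x)))))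
      where
      fibre : ∀ x → Σᴸ (λ v → [ x * product v ≈? 1# ] ℚ.* f x) (tuples R (suc k)) ≡
              fromℕ (u ℕ.^ k) ℚ.* ([ unit? x ] ℚ.* f x)
      fibre x = ≡.trans (Σᴸ-cong (λ v → ℚ.*-comm [ x * product v ≈? 1# ] (f x)) (tuples R (suc k)))
        (≡.trans (Σᴸ-*ˡ (f x) (λ v → [ x * product v ≈? 1# ]) (tuples R (suc k)))
        (≡.trans (cong (f x ℚ.*_) (solutions≡ k x))
          (solve 3 (λ f i n → f :* (i :* n) := n :* (i :* f)) ≡.refl (f x) [ unit? x ] (fromℕ (u ℕ.^ k)))))
        where open +-*-Solver

    card-H : Subset.card H ≡ u ℕ.^ k ℕ.* u
    card-H = ℕ.≤-antisym (fromℕ-cancel-≤ (ℚ.≤-reflexive eq)) (fromℕ-cancel-≤ (ℚ.≤-reflexive (≡.sym eq)))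
      where
      eq : fromℕ (Subset.card H) ≡ fromℕ (u ℕ.^ k ℕ.* u)
      eq = ≡.trans (≡.sym (Σᴸ-length members)) (≡.trans (Σᴸ-H (λ _ → 1ℚ)) (≡.trans
        (cong (fromℕ (u ℕ.^ k) ℚ.*_) (≡.trans (∑-cong (λ x → ℚ.*-identityʳ [ unit? x ])) (∑-card unit?)))
        (≡.sym (fromℕ-* (u ℕ.^ k) u))))

  -- The minimal right ideal J = e R: comparison with the units and with R.

  module PrimitiveIdeal (pidem : PrimitiveIdempotent) where
    open PrimitiveIdempotent pidem

    J : Pred Carrier ℓ
    J a = e * a ≈ a

    J? : Decidable J
    J? a = e * a ≈? a

    J-resp : J Respects _≈_
    J-resp a≈b ea≈a = trans (*-congˡ (sym a≈b)) (trans ea≈a a≈b)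

    J-+ : ∀ {a b} → J a → J b → J (a + b)
    J-+ {a} {b} p q = trans (distribˡ e a b) (+-cong p q)

    J-* : ∀ {a} r → J a → J (a * r)
    J-* {a} r p = trans (sym (*-assoc e a r)) (*-congʳ p)

    j : ℕ
    j = card J?

    f : Carrier
    f = 1# - e

    e+f≈1 : e + f ≈ 1#
    e+f≈1 = trans (+-comm e f) (trans (+-assoc 1# (- e) e) (trans (+-congˡ (-‿inverseˡ e)) (+-identityʳ 1#)))

    fe≈0 : f * e ≈ 0#
    fe≈0 = begin
      (1# - e) * e           ≈⟨ distribʳ e 1# (- e) ⟩
      1# * e + - e * e       ≈⟨ +-cong (*-identityˡ e) (trans (sym (-‿distribˡ-* e e)) (-‿cong idem)) ⟩
      e - e                  ≈⟨ -‿inverseʳ e ⟩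
      0#                     ∎
      where open RingProperties ring using (-‿distribˡ-*)

    ff≈f : f * f ≈ f
    ff≈f = begin
      f * f                  ≈⟨ +-identityˡ (f * f) ⟨
      0# + f * f             ≈⟨ +-congʳ fe≈0 ⟨
      f * e + f * f          ≈⟨ distribˡ f e f ⟨
      f * (e + f)            ≈⟨ *-congˡ e+f≈1 ⟩
      f * 1#                 ≈⟨ *-identityʳ f ⟩
      f                      ∎

    -- In block form with respect to e + f = 1 this is the triangular matrix with
    -- diagonal (a e, 1); minimality makes a e invertible in e R e.
    unit-a+f : ∀ a → J a → ¬ (a * e ≈ 0#) → Unit (a + f)
    unit-a+f a ea≈a ae≉0 = d + (f - d * (a * f)) , (begin
      v * (d + (f - d * (a * f)))               ≈⟨ distribˡ v d (f - d * (a * f)) ⟩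
      v * d + v * (f - d * (a * f))             ≈⟨ +-cong vd≈e (distribˡ v f (- (d * (a * f)))) ⟩
      e + (v * f + v * - (d * (a * f)))         ≈⟨ +-congˡ (+-cong vf≈ (begin
          v * - (d * (a * f))                     ≈⟨ -‿distribʳ-* v (d * (a * f)) ⟨
          - (v * (d * (a * f)))                   ≈⟨ -‿cong (*-assoc v d (a * f)) ⟨
          - (v * d * (a * f))                     ≈⟨ -‿cong (*-congʳ vd≈e) ⟩
          - (e * (a * f))                         ≈⟨ -‿cong (J-* f ea≈a) ⟩
          - (a * f)                               ∎)) ⟩
      e + (a * f + f - a * f)                   ≈⟨ +-congˡ (xyx⁻¹≈y (a * f) f) ⟩
      e + f                                     ≈⟨ e+f≈1 ⟩
      1#                                        ∎)
      where
      open RingProperties ring using (-‿distribʳ-*; xyx⁻¹≈y)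
      found : ∃[ r ] a * e * r ≈ e
      found = minimal (a * e) (J-* e ea≈a) ae≉0
      r d v : Carrier
      r = proj₁ found
      d = e * (r * e)
      v = a + f
      vd≈e : v * d ≈ e
      vd≈e = begin
        (a + f) * (e * (r * e))                 ≈⟨ *-assoc (a + f) e (r * e) ⟨
        (a + f) * e * (r * e)                   ≈⟨ *-congʳ (trans (distribʳ e a f) (trans (+-congˡ fe≈0) (+-identityʳ (a * e)))) ⟩
        a * e * (r * e)                         ≈⟨ *-assoc (a * e) r e ⟨
        a * e * r * e                           ≈⟨ *-congʳ (proj₂ found) ⟩
        e * e                                   ≈⟨ idem ⟩
        e                                       ∎
      vf≈ : v * f ≈ a * f + f
      vf≈ = trans (distribʳ f a f) (+-congˡ ff≈f)

    translate : ∀ t {g : Carrier → ℚ} → (∀ {x y} → x ≈ y → g x ≡ g y) → ∑ (λ x → g (x + t)) ≡ ∑ g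
    translate t g-cong = ∑-reindex g-cong (_+ t) (_- t) +-congʳ +-congʳ
      (λ x → trans (+-assoc x (- t) t) (trans (+-congˡ (-‿inverseˡ t)) (+-identityʳ x)))
      (λ x → trans (+-assoc x t (- t)) (trans (+-congˡ (-‿inverseʳ t)) (+-identityʳ x)))

    -- Translation by e takes {a ∈ J : a e = 0} into {a ∈ J : a e ≠ 0}, and translation
    -- by f takes the latter into the units.
    j≤2u : j ℕ.≤ u ℕ.+ u
    j≤2u = fromℕ-cancel-≤ (subst₂ ℚ._≤_ split (≡.sym (fromℕ-+ u u)) (ℚ.+-mono-≤ zero≤u nonzero≤u))
      where
      zero? : ∀ a → Dec (a * e ≈ 0#)
      zero? a = a * e ≈? 0#
      nonzero? : ∀ a → Dec (J a × ¬ (a * e ≈ 0#))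
      nonzero? a = J? a ×-dec ¬? (zero? a)
      nz-resp : ∀ {a b} → a ≈ b → J a × ¬ (a * e ≈ 0#) → J b × ¬ (b * e ≈ 0#)
      nz-resp a≈b (p , q) = J-resp a≈b p , q ∘ trans (*-congʳ a≈b)
      shift : ∀ a → J a × (a * e ≈ 0#) → J (a + e) × ¬ ((a + e) * e ≈ 0#)
      shift a (p , ae≈0) = J-+ p idem , λ eq → e≉0 (begin
        e                  ≈⟨ idem ⟨
        e * e              ≈⟨ +-identityˡ (e * e) ⟨
        0# + e * e         ≈⟨ +-congʳ ae≈0 ⟨
        a * e + e * e      ≈⟨ distribʳ e a e ⟨
        (a + e) * e        ≈⟨ eq ⟩
        0#                 ∎)
      split : ∑ (λ a → [ J? a ×-dec zero? a ]) ℚ.+ ∑ (λ a → [ nonzero? a ]) ≡ fromℕ j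
      split = ≡.trans (≡.sym (∑-+ (λ a → [ J? a ×-dec zero? a ]) (λ a → [ nonzero? a ])))
        (≡.trans (∑-cong (λ a → ≡.sym ([]-split (J? a) (zero? a)))) (∑-card J?))
      nonzero≤u : ∑ (λ a → [ nonzero? a ]) ℚ.≤ fromℕ u
      nonzero≤u = ℚ.≤-trans (∑-mono (λ a → []-mono (nonzero? a) (unit? (a + f)) (λ (p , q) → unit-a+f a p q)))
        (ℚ.≤-reflexive (≡.trans (translate f {λ a → [ unit? a ]} (λ x≈y → []-cong (unit? _) (unit? _)
          (unit-resp x≈y) (unit-resp (sym x≈y)))) (∑-card unit?)))
      zero≤u : ∑ (λ a → [ J? a ×-dec zero? a ]) ℚ.≤ fromℕ u
      zero≤u = ℚ.≤-trans (∑-mono (λ a → []-mono (J? a ×-dec zero? a) (nonzero? (a + e)) (shift a)))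
        (ℚ.≤-trans (ℚ.≤-reflexive (translate e {λ a → [ nonzero? a ]} (λ x≈y →
          []-cong (nonzero? _) (nonzero? _) (nz-resp x≈y) (nz-resp (sym x≈y))))) nonzero≤u)

    -- R acts faithfully on J, as the annihilator of J is a proper ideal.
    size≤j^j : IsSimple R → size ℕ.≤ j ℕ.^ j
    size≤j^j simple = Fin.injective⇒≤ {f = action} (λ {i} {k} → injective i k)
      where
      open Simple simple using (prime-ring)
      open RingProperties ring using (x∙y⁻¹≈ε⇒x≈y; -‿distribʳ-*)
      member : Fin j → Carrier
      member k = to (lookup (indices J?) k)
      member∈J : ∀ k → J (member k)
      member∈J k = proj₂ (∈-filter⁻ (J? ∘ to) {xs = allFin size} (∈-lookup {xs = indices J?} k))
      index : ∀ a → J a → Fin j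
      index a p = Any.index (∈-filter⁺ (J? ∘ to) (∈-allFin (from a)) (J-resp (sym (strictlyInverseˡ a)) p))
      member-index : ∀ a p → member (index a p) ≈ a
      member-index a p = trans (to-cong (≡.sym (Any.lookup-index
        (∈-filter⁺ (J? ∘ to) (∈-allFin (from a)) (J-resp (sym (strictlyInverseˡ a)) p))))) (strictlyInverseˡ a)
      act : Fin size → Fin j → Fin j
      act i k = index (member k * to i) (J-* (to i) (member∈J k))
      action : Fin size → Fin (j ℕ.^ j)
      action i = funToFin (act i)
      same : ∀ i k → action i ≡ action k → ∀ a → J a → a * to i ≈ a * to k
      same i k eq a p = begin
        a * to i                        ≈⟨ *-congʳ (member-index a p) ⟨
        member n * to i                 ≈⟨ member-index (member n * to i) (J-* (to i) (member∈J n)) ⟨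
        member (act i n)                ≡⟨ cong member act≡ ⟩
        member (act k n)                ≈⟨ member-index (member n * to k) (J-* (to k) (member∈J n)) ⟩
        member n * to k                 ≈⟨ *-congʳ (member-index a p) ⟩
        a * to k                        ∎
        where
        n : Fin j
        n = index a p
        act≡ : act i n ≡ act k n
        act≡ = ≡.trans (≡.sym (Fin.finToFun-funToFin (act i) n))
          (≡.trans (cong (λ m → Fin.finToFun m n) eq) (Fin.finToFun-funToFin (act k) n))
      injective : ∀ i k → action i ≡ action k → i ≡ k
      injective i k eq with to i - to k ≈? 0#
      ... | yes ≈0 = ≡.trans (≡.sym (strictlyInverseʳ i))
                       (≡.trans (from-cong (x∙y⁻¹≈ε⇒x≈y (to i) (to k) ≈0)) (strictlyInverseʳ k))
      ... | no ≉0 = let r , er≉0 = prime-ring e≉0 ≉0 in contradiction (begin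
        e * r * (to i - to k)                 ≈⟨ distribˡ (e * r) (to i) (- to k) ⟩
        e * r * to i + e * r * - to k         ≈⟨ +-cong (same i k eq (e * r) (J-* r idem)) (sym (-‿distribʳ-* (e * r) (to k))) ⟩
        e * r * to k - e * r * to k           ≈⟨ -‿inverseʳ (e * r * to k) ⟩
        0#                                    ∎) er≉0

-- From the Salem inequality of reals to inequalities of rationals.

module RealLemmas where
  open import Data.Rational.Base using (_+_; _*_; _-_; -_; ∣_∣; _<_; _≤_)
  open ≡ using (refl; sym; trans)
  open RationalLemmas
  open Sequences
  open Estimates using (half-pos; half+half; *-pos)
  open +-*-Solver

  ≈-refl : ∀ x → x Real.≈ x
  ≈-refl x ε 0<ε = 0 , λ n _ → subst (λ a → ∣ a ∣ < ε) (sym (ℚ.+-inverseʳ (ℝ.seq x n))) 0<ε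

  ≈-trans : ∀ x y z → x Real.≈ y → y Real.≈ z → x Real.≈ z
  ≈-trans x y z p q ε 0<ε =
    let M , close-xy = p _ (half-pos 0<ε)
        N , close-yz = q _ (half-pos 0<ε)
    in M ℕ.⊔ N , λ n le → ℚ.≤-<-trans
      (subst (λ a → ∣ a ∣ ≤ ∣ ℝ.seq x n - ℝ.seq y n ∣ + ∣ ℝ.seq y n - ℝ.seq z n ∣)
        (solve 3 (λ a b c → (a :- b) :+ (b :- c) := a :- c) refl (ℝ.seq x n) (ℝ.seq y n) (ℝ.seq z n))
        (ℚ.∣p+q∣≤∣p∣+∣q∣ (ℝ.seq x n - ℝ.seq y n) (ℝ.seq y n - ℝ.seq z n)))
      (subst (∣ ℝ.seq x n - ℝ.seq y n ∣ + ∣ ℝ.seq y n - ℝ.seq z n ∣ <_) (half+half ε)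
        (ℚ.+-mono-< (close-xy n (ℕ.m⊔n≤o⇒m≤o M N le)) (close-yz n (ℕ.m⊔n≤o⇒n≤o M N le))))

  re-sum : ∀ (ψ : A → ℂ) xs n → ℝ.seq (ℂ.re (Complex.sum (map ψ xs))) n ≡ Indicators.Σᴸ (λ x → ℝ.seq (ℂ.re (ψ x)) n) xs
  re-sum ψ []       n = refl
  re-sum ψ (x ∷ xs) n = cong (ℝ.seq (ℂ.re (ψ x)) n +_) (re-sum ψ xs n)

  -- A natural number in place of the real constant C; it makes the final bound on |R| a natural
  -- number depending on C alone.
  eventually-below : ∀ C → ∃[ B ] Eventually (λ n → ℝ.seq C n ≤ fromℕ B)
  eventually-below C = let b , _ , N , le = Real.eventually-bounded C in
    _ , after N λ n N≤n → ℚ.≤-trans (ℚ.≤-trans (p≤∣p∣ (ℝ.seq C n)) (le n N≤n)) (below-fromℕ b)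

  private
    -- A single stage of `salem-bound`: r is the approximate root of the squared modulus, w its
    -- error 1 / (n + 1), and s the approximate root of h. The squared modulus is at least (ρ X)²,
    -- so -ρ X is below r + w, and ρ cancels.
    bound-at : ∀ {ρ r w c b s ε X Y Z} (0<ρ : 0ℚ < ρ) → 0ℚ ≤ r + w → 0ℚ ≤ s → c ≤ b →
               (ρ * X - 0ℚ * Y) * (ρ * X - 0ℚ * Y) + Z * Z < (r + w) * (r + w) →
               r < c * ρ * s + ½ * ε * ρ → w ≤ ½ * ε * ρ → - X ≤ b * s + ε
    bound-at {ρ} {r} {w} {c} {b} {s} {ε} {X} {Y} {Z} 0<ρ 0≤r+w 0≤s c≤b q< r< w≤ =
      ℚ.*-cancelˡ-≤-pos ρ {{ℚ.positive 0<ρ}} (begin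
        ρ * - X                                   ≡⟨ solve 3 (λ ρ X Y → ρ :* :- X := :- (ρ :* X :- con 0ℚ :* Y)) refl ρ X Y ⟩
        - V                                       ≤⟨ ℚ.<⇒≤ (square-<⁻ {a = - V} 0≤r+w (ℚ.≤-<-trans
                                                      (≤-by (Z * Z) (0≤square Z) (solve 2 (λ V Z →
                                                        V :* V :+ Z :* Z := :- V :* :- V :+ Z :* Z) refl V Z)) q<)) ⟩
        r + w                                     ≤⟨ ℚ.+-mono-≤ (ℚ.<⇒≤ r<) w≤ ⟩
        c * ρ * s + ½ * ε * ρ + ½ * ε * ρ         ≤⟨ ≤-by ((b - c) * (ρ * s)) (0≤* (≤⇒0≤- c≤b) (0≤* (ℚ.<⇒≤ 0<ρ) 0≤s))
                                                      (solve 5 (λ ρ b c s ε → ρ :* (b :* s :+ ε) :=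
                                                        c :* ρ :* s :+ con ½ :* ε :* ρ :+ con ½ :* ε :* ρ :+ (b :- c) :* (ρ :* s))
                                                        refl ρ b c s ε) ⟩
        ρ * (b * s + ε)                           ∎)
      where
      open ℚ.≤-Reasoning
      V = ρ * X - 0ℚ * Y

  -- Only the real part with negative sign is retained: the sum over nonzero a needs no more.
  salem-bound : ∀ C ρ h F b → 0ℚ < ρ → Eventually (λ n → ℝ.seq C n ≤ b) →
    Complex.∣ Complex.fromℝ (Real.fromℚ ρ) Complex.* F ∣ Real.≤ C Real.* Real.fromℚ ρ Real.* Real.√ (Real.fromℚ h) →
    ∀ ε → 0ℚ < ε → Eventually (λ n → - ℝ.seq (ℂ.re F) n ≤ b * approxRoot n h + ε)
  salem-bound C ρ h F b 0<ρ C≤b salem ε 0<ε =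
    -- One half of ε covers the slack in `Real._≤_`, the other the error of the approximate root;
    -- the factor ρ anticipates the division by ρ.
    let δ = ½ * ε * ρ
        0<δ = *-pos (half-pos 0<ε) 0<ρ
        N , sal = salem δ 0<δ
        M , small = ApproxRoot.unit-small 0<δ
    in eventually-map
      (λ n (c≤b , r< , w≤) → bound-at {X = ℝ.seq (ℂ.re F) n} {ℝ.seq (ℂ.im F) n} {ℝ.seq (ℂ.im z) n} 0<ρ
        (0≤+ (ApproxRoot.approxRoot-nonNeg n (q n)) (ℚ.<⇒≤ (ApproxRoot.unit-pos n)))
        (ApproxRoot.approxRoot-nonNeg n h) c≤b (ApproxRoot.approxRoot-upper n (q n)) r< w≤)
      (eventually-× C≤b (eventually-× (after N sal) (after M small)))
    where
    z : ℂ
    z = Complex.fromℝ (Real.fromℚ ρ) Complex.* F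
    q : ℕ → ℚ
    q n = ℝ.seq (ℂ.re z) n * ℝ.seq (ℂ.re z) n + ℝ.seq (ℂ.im z) n * ℝ.seq (ℂ.im z) n

  -- The two errors of ½ leave h ≤ w b s + 1 with w = 2 v. Then 2 h ≤ 2 w b s + 2 ≤ s² + w² b² + 2,
  -- by (s - w b)² ≥ 0, and s² ≤ h.
  final-estimate : ∀ {h S j v b s ε} → h - h * S ≤ j * (b * s + ε) → h * S ≤ ½ → j * ε ≤ ½ →
    s * s ≤ h → 0ℚ ≤ b → 0ℚ ≤ s → j ≤ v + v → h ≤ (v + v) * (v + v) * (b * b) + (1ℚ + 1ℚ)
  final-estimate {h} {S} {j} {v} {b} {s} {ε} main hS jε s²≤h 0≤b 0≤s j≤2v =
    ≤-by (((s - w * b) * (s - w * b) + (h - s * s)) + (k + k))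
      (0≤+ (0≤+ (0≤square (s - w * b)) (≤⇒0≤- s²≤h)) (0≤+ 0≤k 0≤k))
      (solve 4 (λ h s w b → w :* w :* (b :* b) :+ (con 1ℚ :+ con 1ℚ) :=
          h :+ (((s :- w :* b) :* (s :- w :* b) :+ (h :- s :* s)) :+
            ((w :* (b :* s) :+ con 1ℚ :- h) :+ (w :* (b :* s) :+ con 1ℚ :- h)))) refl h s w b)
    where
    w k : ℚ
    w = v + v
    k = w * (b * s) + 1ℚ - h
    0≤k : 0ℚ ≤ k
    0≤k = subst (0ℚ ≤_)
      (solve 7 (λ h S j w b s ε →
          (j :* (b :* s :+ ε) :- (h :- h :* S)) :+ ((con ½ :- h :* S) :+ ((con ½ :- j :* ε) :+ (w :- j) :* (b :* s)))
          := w :* (b :* s) :+ con 1ℚ :- h) refl h S j w b s ε)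
      (0≤+ (≤⇒0≤- main) (0≤+ (≤⇒0≤- hS) (0≤+ (≤⇒0≤- jε) (0≤* (≤⇒0≤- j≤2v) (0≤* 0≤b 0≤s)))))

-- The characters ψ_a, their sums over H, and the bound on the number of units.

module Characters (R : FiniteRing c ℓ) (pidem : FiniteRingProperties.PrimitiveIdempotent R)
  {p : ℕ} (root : PrimitiveRootOfUnity p)
  (coordinate : FiniteRingProperties.AdditiveCoordinate R p (FiniteRingProperties.PrimitiveIdempotent.e pidem))
  (d′ : ℕ) where
  open FiniteRing R
  open FiniteRingProperties R
  open PrimitiveIdempotent pidem
  open RingSums R
  open Units R
  open PrimitiveIdeal pidem
  open RationalLemmas
  open Sequences
  open Indicators
  open RealLemmas
  open GaussianPowers
  open ComplexPowers
  open PrimitiveRootOfUnity root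
  open AdditiveCoordinate coordinate
  open import Data.Rational.Base using () renaming (_+_ to _⊕_; _*_ to _⊛_; _-_ to _⊖_; -_ to ⊖_; _≤_ to _≤ℚ_; _<_ to _<ℚ_; ∣_∣ to ∣_∣ℚ)

  k d : ℕ
  k = suc (suc d′)
  d = suc (suc k)

  open Salem R d using (Rᵈ; H; IsSalem; module Subset)
  open Subset H using (members)

  private
    ≈ᶜ-trans : ∀ x y z → x Complex.≈ y → y Complex.≈ z → x Complex.≈ z
    ≈ᶜ-trans x y z (p , q) (r , s) =
      ≈-trans (ℂ.re x) (ℂ.re y) (ℂ.re z) p r , ≈-trans (ℂ.im x) (ℂ.im y) (ℂ.im z) q s

    χ-cong : ∀ {x y} → x ≈ y → ζ ^ ν x Complex.≈ ζ ^ ν y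
    χ-cong {x} x≈y = subst (λ l → ζ ^ ν x Complex.≈ ζ ^ l) (ν-cong x≈y)
      (≈-refl (ℂ.re (ζ ^ ν x)) , ≈-refl (ℂ.im (ζ ^ ν x)))

    χ-+ : ∀ x y → ζ ^ ν (x + y) Complex.≈ ζ ^ ν x Complex.* ζ ^ ν y
    χ-+ x y with ν-+ x y
    ... | inj₁ eq = ζ^-+ (ν x) (ν y) (ν (x + y)) eq
    ... | inj₂ eq = ≈ᶜ-trans (ζ ^ ν (x + y)) (ζ ^ (ν (x + y) ℕ.+ p)) (ζ ^ ν x Complex.* ζ ^ ν y)
      (ζ^-wrap (ν (x + y))) (ζ^-+ (ν x) (ν y) (ν (x + y) ℕ.+ p) eq)

    χ-0 : ∀ {x} → x ≈ 0# → ζ ^ ν x Complex.≈ Complex.1ℂ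
    χ-0 {x} x≈0 = subst (λ l → ζ ^ ν x Complex.≈ ζ ^ l) (≡.trans (ν-cong x≈0) ν-0)
      (≈-refl (ℂ.re (ζ ^ ν x)) , ≈-refl (ℂ.im (ζ ^ ν x)))

  ψ : Carrier → Character Rᵈ
  ψ a = record
    { ⟦_⟧ = λ v → ζ ^ ν (a * v Fin.zero)
    ; isMonoidHomomorphism = record
      { isMagmaHomomorphism = record
        { isRelHomomorphism = record { cong = λ v≋w → χ-cong (*-congˡ (v≋w Fin.zero)) }
        ; homo = λ v w → ≈ᶜ-trans (ζ ^ ν (a * (v Fin.zero + w Fin.zero)))
            (ζ ^ ν (a * v Fin.zero + a * w Fin.zero))
            (ζ ^ ν (a * v Fin.zero) Complex.* ζ ^ ν (a * w Fin.zero))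
            (χ-cong (distribˡ a (v Fin.zero) (w Fin.zero)))
            (χ-+ (a * v Fin.zero) (a * w Fin.zero)) }
      ; ε-homo = χ-0 (zeroʳ a) } }

  -- Minimality gives r with a r = e, and at the constant tuple r the character takes the value χ(e)
  -- = ζ.
  ψ-nontrivial : ∀ {a} → J a → ¬ (a ≈ 0#) → Nontrivial (ψ a)
  ψ-nontrivial {a} a∈J a≉0 trivial =
    let r , ar≈e = minimal a a∈J a≉0 in
    ζ≉1 (subst (λ l → ζ ^ l Complex.≈ Complex.1ℂ) (≡.trans (ν-cong ar≈e) ν-e) (trivial (λ _ → r)))

  ideal-sum : (Carrier → ℚ) → ℚ
  ideal-sum g = ∑ (λ a → [ J? a ] ⊛ g a)

  J-translate : ∀ {g : Carrier → ℚ} → (∀ {a b} → a ≈ b → g a ≡ g b) → ideal-sum (λ a → g (a + e)) ≡ ideal-sum g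
  J-translate {g} g-cong = ≡.trans
    (∑-cong (λ a → cong (_⊛ g (a + e)) ([]-cong (J? a) (J? (a + e)) (λ p → J-+ p idem) (J-+⁻ a))))
    (translate e {λ a → [ J? a ] ⊛ g a} (λ a≈b →
      cong₂ _⊛_ ([]-cong (J? _) (J? _) (J-resp a≈b) (J-resp (sym a≈b))) (g-cong a≈b)))
    where
    J-+⁻ : ∀ a → J (a + e) → J a
    J-+⁻ a q = J-resp a+e-e (J-+ q (trans (sym (-‿distribʳ-* e e)) (-‿cong idem)))
      where
      open RingProperties ring using (-‿distribʳ-*)
      a+e-e : a + e - e ≈ a
      a+e-e = trans (+-assoc a e (- e)) (trans (+-congˡ (-‿inverseʳ e)) (+-identityʳ a))

  last? : ∀ b → Dec (suc (ν b) ≡ p)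
  last? b = suc (ν b) ℕ.≟ p

  -- Since ν e = 1, adding e raises the exponent by 1, except that p - 1 becomes 0.
  wrap : ∀ b → (¬ (suc (ν b) ≡ p) × suc (ν b) ≡ ν (b + e)) ⊎ (suc (ν b) ≡ p × ν (b + e) ≡ 0)
  wrap b with ν-+ b e
  ... | inj₁ eq = inj₁ ((λ last → ℕ.<-irrefl (≡.trans (≡.sym step) last) (ν<p (b + e))) , step)
    where
    step : suc (ν b) ≡ ν (b + e)
    step = ≡.trans (ℕ.+-comm 1 (ν b)) (≡.trans (cong (ν b ℕ.+_) (≡.sym ν-e)) eq)
  ... | inj₂ eq = inj₂ (last , ℕ.+-cancelʳ-≡ p (ν (b + e)) 0 (≡.trans (≡.sym step) last))
    where
    step : suc (ν b) ≡ ν (b + e) ℕ.+ p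
    step = ≡.trans (ℕ.+-comm 1 (ν b)) (≡.trans (cong (ν b ℕ.+_) (≡.sym ν-e)) eq)
    last : suc (ν b) ≡ p
    last = ℕ.≤-antisym (ν<p b) (subst (p ℕ.≤_) (≡.sym step) (ℕ.m≤n+m p (ν (b + e))))

  -- `pow` stands for the real or the imaginary parts of the powers of ζ at one stage, and γ for the
  -- failure of ζᵖ = 1 in that part. The failure shows up exactly where the exponent wraps around.
  shift : ∀ (pow : ℕ → ℚ) γ → pow p ≡ pow 0 ⊕ γ → ∀ b → pow (suc (ν b)) ≡ pow (ν (b + e)) ⊕ [ last? b ] ⊛ γ
  shift pow γ eq b with wrap b
  ... | inj₁ (¬last , step) = ≡.trans (cong pow step) (≡.sym (≡.trans
      (cong (λ i → pow (ν (b + e)) ⊕ i ⊛ γ) ([]-no (last? b) ¬last))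
      (≡.trans (cong (pow (ν (b + e)) ⊕_) (ℚ.*-zeroˡ γ)) (ℚ.+-identityʳ (pow (ν (b + e)))))))
  ... | inj₂ (last , ν≡0) = ≡.trans (cong pow last) (≡.trans eq (≡.sym (≡.trans
      (cong₂ (λ l i → pow l ⊕ i ⊛ γ) ν≡0 ([]-yes (last? b) last))
      (cong (pow 0 ⊕_) (ℚ.*-identityˡ γ)))))

  wraps : ℚ
  wraps = ideal-sum (λ b → [ last? b ])

  -- Multiplication by ζ translates the sum of χ over J by e, up to the wraps.
  shifted-sum : ∀ (g : Carrier → ℚ) (pow : ℕ → ℚ) γ → (∀ b → g b ≡ pow (suc (ν b))) → pow p ≡ pow 0 ⊕ γ →
                ideal-sum g ≡ ideal-sum (λ b → pow (ν b)) ⊕ wraps ⊛ γ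
  shifted-sum g pow γ g≡ eq = begin
    ideal-sum g                                                    ≡⟨ ∑-cong (λ b → ≡.trans
        (cong ([ J? b ] ⊛_) (≡.trans (g≡ b) (shift pow γ eq b)))
        (solve 4 (λ i a l g → i :* (a :+ l :* g) := i :* a :+ i :* l :* g) ≡.refl
          [ J? b ] (pow (ν (b + e))) [ last? b ] γ)) ⟩
    ∑ (λ b → [ J? b ] ⊛ pow (ν (b + e)) ⊕ [ J? b ] ⊛ [ last? b ] ⊛ γ)
                                                                   ≡⟨ ∑-+ (λ b → [ J? b ] ⊛ pow (ν (b + e)))
                                                                          (λ b → [ J? b ] ⊛ [ last? b ] ⊛ γ) ⟩
    ideal-sum (λ b → pow (ν (b + e))) ⊕ ∑ (λ b → [ J? b ] ⊛ [ last? b ] ⊛ γ)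
                                                                   ≡⟨ cong₂ _⊕_ (J-translate (λ a≈b → cong pow (ν-cong a≈b)))
                                                                          (∑-*ʳ γ (λ b → [ J? b ] ⊛ [ last? b ])) ⟩
    ideal-sum (λ b → pow (ν b)) ⊕ wraps ⊛ γ                        ∎
    where
    open ≡.≡-Reasoning
    open +-*-Solver

  ideal-sum-linear : ∀ r s g h → ideal-sum (λ b → r ⊛ g b ⊕ s ⊛ h b) ≡ r ⊛ ideal-sum g ⊕ s ⊛ ideal-sum h
  ideal-sum-linear r s g h = ≡.trans
    (∑-cong (λ b → solve 5 (λ i r s g h → i :* (r :* g :+ s :* h) := r :* (i :* g) :+ s :* (i :* h)) ≡.refl
      [ J? b ] r s (g b) (h b)))
    (≡.trans (∑-+ (λ b → r ⊛ ([ J? b ] ⊛ g b)) (λ b → s ⊛ ([ J? b ] ⊛ h b)))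
      (cong₂ _⊕_ (∑-*ˡ r (λ b → [ J? b ] ⊛ g b)) (∑-*ˡ s (λ b → [ J? b ] ⊛ h b))))
    where open +-*-Solver

  module _ (n : ℕ) where

    x y : Carrier → ℚ
    x b = reᴾ (cₙ n) (sₙ n) (ν b)
    y b = imᴾ (cₙ n) (sₙ n) (ν b)

    x-cong : ∀ {a b} → a ≈ b → x a ≡ x b
    x-cong a≈b = cong (reᴾ (cₙ n) (sₙ n)) (ν-cong a≈b)

    unit-sum : Carrier → ℚ
    unit-sum a = ∑ (λ v → [ unit? v ] ⊛ x (a * v))

    J-unit-translate : ∀ v → Unit v → ideal-sum (λ a → x (a * v)) ≡ ideal-sum x
    J-unit-translate v (v′ , vv′≈1) = ≡.trans
      (∑-cong (λ a → cong (_⊛ x (a * v)) ([]-cong (J? a) (J? (a * v)) (J-* v) (λ q → J-resp (undo a) (J-* v′ q)))))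
      (∑-reindex {λ a → [ J? a ] ⊛ x a}
        (λ a≈b → cong₂ _⊛_ ([]-cong (J? _) (J? _) (J-resp a≈b) (J-resp (sym a≈b))) (x-cong a≈b))
        (_* v) (_* v′) *-congʳ *-congʳ
        (λ a → trans (*-assoc a v′ v) (trans (*-congˡ (dedekind-finite vv′≈1)) (*-identityʳ a))) undo)
      where
      undo : ∀ a → a * v * v′ ≈ a
      undo a = trans (*-assoc a v v′) (trans (*-congˡ vv′≈1) (*-identityʳ a))

    unit-sum-0 : ∀ {a} → a ≈ 0# → unit-sum a ≡ fromℕ u
    unit-sum-0 {a} a≈0 = ≡.trans (∑-cong (λ v → ≡.trans
        (cong ([ unit? v ] ⊛_) (cong (reᴾ (cₙ n) (sₙ n)) (≡.trans (ν-cong (trans (*-congʳ a≈0) (zeroˡ v))) ν-0)))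
        (ℚ.*-identityʳ [ unit? v ])))
      (∑-card unit?)

    ideal-sum-unit-sum : ideal-sum unit-sum ≡ fromℕ u ⊛ ideal-sum x
    ideal-sum-unit-sum = begin
      ∑ (λ a → [ J? a ] ⊛ ∑ (λ v → [ unit? v ] ⊛ x (a * v)))       ≡⟨ ∑-cong (λ a → ∑-*ˡ [ J? a ] (λ v → [ unit? v ] ⊛ x (a * v))) ⟨
      ∑ (λ a → ∑ (λ v → [ J? a ] ⊛ ([ unit? v ] ⊛ x (a * v))))     ≡⟨ ∑-swap (λ a v → [ J? a ] ⊛ ([ unit? v ] ⊛ x (a * v))) ⟩
      ∑ (λ v → ∑ (λ a → [ J? a ] ⊛ ([ unit? v ] ⊛ x (a * v))))     ≡⟨ ∑-cong inner ⟩
      ∑ (λ v → [ unit? v ] ⊛ ideal-sum x)                          ≡⟨ ∑-*ʳ (ideal-sum x) (λ v → [ unit? v ]) ⟩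
      ∑ (λ v → [ unit? v ]) ⊛ ideal-sum x                          ≡⟨ cong (_⊛ ideal-sum x) (∑-card unit?) ⟩
      fromℕ u ⊛ ideal-sum x                                        ∎
      where
      open ≡.≡-Reasoning
      open +-*-Solver
      inner : ∀ v → ∑ (λ a → [ J? a ] ⊛ ([ unit? v ] ⊛ x (a * v))) ≡ [ unit? v ] ⊛ ideal-sum x
      inner v = ≡.trans (∑-cong (λ a → solve 3 (λ i j z → i :* (j :* z) := j :* (i :* z)) ≡.refl
          [ J? a ] [ unit? v ] (x (a * v))))
        (≡.trans (∑-*ˡ [ unit? v ] (λ a → [ J? a ] ⊛ x (a * v)))
          ([]-* (unit? v) (J-unit-translate v)))

  -- At every stage the sums X of real and Y of imaginary parts satisfy (ζ - 1) (X + Y i) = wraps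
  -- (ζᵖ - 1) exactly, so `null-solution` applies.
  null-ideal-sum : Null (λ n → ideal-sum (x n))
  null-ideal-sum = null-solution wraps (λ n → ideal-sum (x n)) (λ n → ideal-sum (y n))
    (λ n → ≡.trans (cong (cₙ n ⊛ ideal-sum (x n) ⊕_) (ℚ.neg-distribˡ-* (sₙ n) (ideal-sum (y n))))
      (≡.trans (≡.sym (ideal-sum-linear (cₙ n) (⊖ sₙ n) (x n) (y n)))
        (shifted-sum _ (reᴾ (cₙ n) (sₙ n)) (reᴾ (cₙ n) (sₙ n) p ⊖ 1ℚ)
          (λ b → cong (cₙ n ⊛ x n b ⊕_) (≡.sym (ℚ.neg-distribˡ-* (sₙ n) (y n b))))
          (solve 1 (λ r → r := con 1ℚ :+ (r :- con 1ℚ)) ≡.refl (reᴾ (cₙ n) (sₙ n) p)))))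
    (λ n → ≡.trans (≡.sym (ideal-sum-linear (sₙ n) (cₙ n) (x n) (y n)))
      (shifted-sum _ (imᴾ (cₙ n) (sₙ n)) (imᴾ (cₙ n) (sₙ n) p)
        (λ b → ℚ.+-comm (sₙ n ⊛ x n b) (cₙ n ⊛ y n b))
        (≡.sym (ℚ.+-identityˡ (imᴾ (cₙ n) (sₙ n) p)))))
    where open +-*-Solver

  re-ψ : ∀ n a → ℝ.seq (ℂ.re (Complex.sum (map (Character.⟦_⟧ (ψ a)) members))) n ≡ fromℕ (u ℕ.^ k) ⊛ unit-sum n a
  re-ψ n a = ≡.trans (re-sum (Character.⟦_⟧ (ψ a)) members n)
    (≡.trans (Σᴸ-cong (λ v → re-^ ζ (ν (a * v Fin.zero)) n) members) (Σᴸ-H k (λ b → x n (a * b))))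

  h : ℕ
  h = u ℕ.^ k ℕ.* u

  module _ (C : ℝ) (salem : IsSalem C H) where
    private
      Ĉ : ℕ
      Ĉ = proj₁ (eventually-below C)

      ρ : ℚ
      ρ = (ℤ.+ 1 ℚ./ (size ℕ.^ d)) {{ℕ.m^n≢0 size d {{size≢0}}}}

      0<ρ : 0ℚ <ℚ ρ
      0<ρ = ℚ.positive⁻¹ ρ {{ℚ.normalize-pos 1 (size ℕ.^ d) {{ℕ.m^n≢0 size d {{size≢0}}}}}}

      s : ℕ → ℚ
      s n = approxRoot n (fromℕ h)

      0≤s : ∀ n → 0ℚ ≤ℚ s n
      0≤s n = ApproxRoot.approxRoot-nonNeg n (fromℕ h)

      s²≤h : ∀ n → s n ⊛ s n ≤ℚ fromℕ h
      s²≤h n = subst (s n ⊛ s n ≤ℚ_) (ℚ.p≥q⇒p⊔q≡p (0≤fromℕ h)) (ApproxRoot.approxRoot-lower n (fromℕ h))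

      bound : ∀ {a} → J a → ¬ (a ≈ 0#) → ∀ ε → 0ℚ <ℚ ε →
              Eventually (λ n → ⊖ (fromℕ (u ℕ.^ k) ⊛ unit-sum n a) ≤ℚ fromℕ Ĉ ⊛ s n ⊕ ε)
      bound {a} a∈J a≉0 ε 0<ε = eventually-map
        (λ n → subst (λ z → ⊖ z ≤ℚ fromℕ Ĉ ⊛ s n ⊕ ε) (re-ψ n a))
        (salem-bound C ρ (fromℕ h) (Complex.sum (map (Character.⟦_⟧ (ψ a)) members)) (fromℕ Ĉ) 0<ρ
          (proj₂ (eventually-below C))
          (subst (λ q → Complex.∣ Complex.fromℝ (Real.fromℚ ρ) Complex.* Complex.sum (map (Character.⟦_⟧ (ψ a)) members) ∣
              Real.≤ C Real.* Real.fromℚ ρ Real.* Real.√ (Real.fromℚ q))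
            (≡.trans (≡.sym (fromℕ≡ (Subset.card H))) (cong fromℕ (card-H k)))
            (salem (ψ a) (ψ-nontrivial a∈J a≉0)))
          ε 0<ε)

      ĵ+1 : ℚ
      ĵ+1 = fromℕ j ⊕ 1ℚ

      0<ĵ+1 : 0ℚ <ℚ ĵ+1
      0<ĵ+1 = ℚ.+-mono-≤-< (0≤fromℕ j) (ℚ.positive⁻¹ 1ℚ)

      ε : ℚ
      -- Chosen to make j ε ≤ ½; with j + 1 the denominator is visibly positive.
      ε = ½ ⊛ (ℚ.1/ ĵ+1) {{ℚ.>-nonZero 0<ĵ+1}}

      0<ε : 0ℚ <ℚ ε
      0<ε = Estimates.*-pos (ℚ.positive⁻¹ ½) (Estimates.recip-pos ĵ+1 0<ĵ+1)

      jε≤½ : fromℕ j ⊛ ε ≤ℚ ½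
      jε≤½ = subst (fromℕ j ⊛ ε ≤ℚ_) (Estimates.cancel-recip ĵ+1 0<ĵ+1 ½)
        (ℚ.*-monoʳ-≤-nonNeg ε {{ℚ.nonNegative (ℚ.<⇒≤ 0<ε)}} (≤-by {fromℕ j} 1ℚ (ℚ.nonNegative⁻¹ 1ℚ) ≡.refl))

      -- Each a has its own starting stage, and finiteness of R provides a common one. The
      -- conditions on a are decided before a stage is chosen.
      bounds : Eventually (λ n → ∀ i → J (to i) → ¬ (to i ≈ 0#) →
                 ⊖ (fromℕ (u ℕ.^ k) ⊛ unit-sum n (to i)) ≤ℚ fromℕ Ĉ ⊛ s n ⊕ ε)
      bounds = eventually-∀ λ i → go i (J? (to i)) (to i ≈? 0#)
        where
        go : ∀ i → Dec (J (to i)) → Dec (to i ≈ 0#) → Eventually (λ n → J (to i) → ¬ (to i ≈ 0#) →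
               ⊖ (fromℕ (u ℕ.^ k) ⊛ unit-sum n (to i)) ≤ℚ fromℕ Ĉ ⊛ s n ⊕ ε)
        go i (yes i∈J) (no i≉0) = eventually-map (λ _ le _ _ → le) (bound i∈J i≉0 ε 0<ε)
        go i (no i∉J)  _         = after 0 λ _ _ i∈J → contradiction i∈J i∉J
        go i (yes _)   (yes i≈0) = after 0 λ _ _ _ i≉0 → contradiction i≈0 i≉0

      main : ∀ n → (∀ i → J (to i) → ¬ (to i ≈ 0#) →
               ⊖ (fromℕ (u ℕ.^ k) ⊛ unit-sum n (to i)) ≤ℚ fromℕ Ĉ ⊛ s n ⊕ ε) →
             fromℕ h ⊖ fromℕ h ⊛ ideal-sum (x n) ≤ℚ fromℕ j ⊛ (fromℕ Ĉ ⊛ s n ⊕ ε)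
      main n le = subst₂ _≤ℚ_
        (solve 2 (λ h S → h :+ :- (h :* S) := h :- h :* S) ≡.refl (fromℕ h) (ideal-sum (x n)))
        (solve 2 (λ h t → h :+ (t :+ :- h) := t) ≡.refl (fromℕ h) (fromℕ j ⊛ t))
        (ℚ.+-monoʳ-≤ (fromℕ h) (subst₂ _≤ℚ_ left right (∑-mono-to {lhs} {rhs} (λ i → pointwise (to i) (J? (to i)) (to i ≈? 0#) (le i)))))
        where
        open +-*-Solver
        t : ℚ
        t = fromℕ Ĉ ⊛ s n ⊕ ε
        0≤t : 0ℚ ≤ℚ t
        0≤t = 0≤+ (0≤* (0≤fromℕ Ĉ) (0≤s n)) (ℚ.<⇒≤ 0<ε)
        lhs rhs : Carrier → ℚ
        lhs a = [ J? a ] ⊛ ⊖ (fromℕ (u ℕ.^ k) ⊛ unit-sum n a)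
        rhs a = [ J? a ] ⊛ t ⊕ [ a ≈? 0# ] ⊛ ⊖ fromℕ h
        left : ∑ lhs ≡ ⊖ (fromℕ h ⊛ ideal-sum (x n))
        left = ≡.trans (∑-cong (λ a → solve 3 (λ i N f → i :* :- (N :* f) := :- N :* (i :* f)) ≡.refl
            [ J? a ] (fromℕ (u ℕ.^ k)) (unit-sum n a)))
          (≡.trans (∑-*ˡ (⊖ fromℕ (u ℕ.^ k)) (λ a → [ J? a ] ⊛ unit-sum n a))
          (≡.trans (cong (⊖ fromℕ (u ℕ.^ k) ⊛_) (ideal-sum-unit-sum n))
          (≡.trans (solve 3 (λ N u S → :- N :* (u :* S) := :- (N :* u :* S)) ≡.refl
              (fromℕ (u ℕ.^ k)) (fromℕ u) (ideal-sum (x n)))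
            (cong (λ z → ⊖ (z ⊛ ideal-sum (x n))) (≡.sym (fromℕ-* (u ℕ.^ k) u))))))
        right : ∑ rhs ≡ fromℕ j ⊛ t ⊕ ⊖ fromℕ h
        right = ≡.trans (∑-+ (λ a → [ J? a ] ⊛ t) (λ a → [ a ≈? 0# ] ⊛ ⊖ fromℕ h))
          (cong₂ _⊕_ (≡.trans (∑-*ʳ t (λ a → [ J? a ])) (cong (_⊛ t) (∑-card J?))) (∑-single 0# (⊖ fromℕ h)))
        pointwise : ∀ a (a∈J? : Dec (J a)) (a≈0? : Dec (a ≈ 0#)) →
                    (J a → ¬ (a ≈ 0#) → ⊖ (fromℕ (u ℕ.^ k) ⊛ unit-sum n a) ≤ℚ t) →
                    [ a∈J? ] ⊛ ⊖ (fromℕ (u ℕ.^ k) ⊛ unit-sum n a) ≤ℚ [ a∈J? ] ⊛ t ⊕ [ a≈0? ] ⊛ ⊖ fromℕ h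
        pointwise a (yes _) (yes a≈0) _ = ≤-by t 0≤t (≡.trans
          (solve 2 (λ t h → con 1ℚ :* t :+ con 1ℚ :* :- h := con 1ℚ :* :- h :+ t) ≡.refl t (fromℕ h))
          (cong (λ z → 1ℚ ⊛ ⊖ z ⊕ t) (≡.trans (fromℕ-* (u ℕ.^ k) u)
            (cong (fromℕ (u ℕ.^ k) ⊛_) (≡.sym (unit-sum-0 n a≈0))))))
        pointwise a (yes a∈J) (no a≉0) le = subst₂ _≤ℚ_ (≡.sym (ℚ.*-identityˡ _))
          (solve 2 (λ t h → t := con 1ℚ :* t :+ con 0ℚ :* :- h) ≡.refl t (fromℕ h)) (le a∈J a≉0)
        pointwise a (no a∉J) (yes a≈0) _ = contradiction (trans (*-congˡ a≈0) (trans (zeroʳ e) (sym a≈0))) a∉J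
        pointwise a (no _) (no _) _ = ℚ.≤-reflexive (solve 3 (λ f t h → con 0ℚ :* :- f := con 0ℚ :* t :+ con 0ℚ :* :- h)
          ≡.refl (fromℕ (u ℕ.^ k) ⊛ unit-sum n a) t (fromℕ h))

      h≤ : fromℕ h ≤ℚ (fromℕ u ⊕ fromℕ u) ⊛ (fromℕ u ⊕ fromℕ u) ⊛ (fromℕ Ĉ ⊛ fromℕ Ĉ) ⊕ (1ℚ ⊕ 1ℚ)
      h≤ = conclude (eventually-× bounds (null-*-const (fromℕ h) null-ideal-sum ½ (ℚ.positive⁻¹ ½)))
        where
        conclude : Eventually (λ n → (∀ i → J (to i) → ¬ (to i ≈ 0#) →
            ⊖ (fromℕ (u ℕ.^ k) ⊛ unit-sum n (to i)) ≤ℚ fromℕ Ĉ ⊛ s n ⊕ ε) × ∣ fromℕ h ⊛ ideal-sum (x n) ∣ℚ <ℚ ½) →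
          fromℕ h ≤ℚ (fromℕ u ⊕ fromℕ u) ⊛ (fromℕ u ⊕ fromℕ u) ⊛ (fromℕ Ĉ ⊛ fromℕ Ĉ) ⊕ (1ℚ ⊕ 1ℚ)
        -- The conclusion does not mention n, so one stage at which both estimates hold is enough.
        conclude (after n p) = let le , small = p n ℕ.≤-refl in
          final-estimate {S = ideal-sum (x n)} {v = fromℕ u} {s = s n} {ε = ε} (main n le)
            (ℚ.<⇒≤ (ℚ.≤-<-trans (p≤∣p∣ (fromℕ h ⊛ ideal-sum (x n))) small))
            jε≤½ (s²≤h n) (0≤fromℕ Ĉ) (0≤s n)
            (subst (fromℕ j ≤ℚ_) (fromℕ-+ u u) (fromℕ-mono-≤ j≤2u))

      hℕ≤ : h ℕ.≤ (u ℕ.+ u) ℕ.* (u ℕ.+ u) ℕ.* (Ĉ ℕ.* Ĉ) ℕ.+ 2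
      hℕ≤ = fromℕ-cancel-≤ (subst (fromℕ h ≤ℚ_) (≡.sym eq) h≤)
        where
        eq : fromℕ ((u ℕ.+ u) ℕ.* (u ℕ.+ u) ℕ.* (Ĉ ℕ.* Ĉ) ℕ.+ 2) ≡
             (fromℕ u ⊕ fromℕ u) ⊛ (fromℕ u ⊕ fromℕ u) ⊛ (fromℕ Ĉ ⊛ fromℕ Ĉ) ⊕ (1ℚ ⊕ 1ℚ)
        eq = ≡.trans (fromℕ-+ ((u ℕ.+ u) ℕ.* (u ℕ.+ u) ℕ.* (Ĉ ℕ.* Ĉ)) 2) (cong₂ _⊕_
          (≡.trans (fromℕ-* ((u ℕ.+ u) ℕ.* (u ℕ.+ u)) (Ĉ ℕ.* Ĉ)) (cong₂ _⊛_
            (≡.trans (fromℕ-* (u ℕ.+ u) (u ℕ.+ u)) (cong₂ _⊛_ (fromℕ-+ u u) (fromℕ-+ u u)))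
            (fromℕ-* Ĉ Ĉ)))
          (≡.trans (fromℕ-suc 1) (cong (_⊕ 1ℚ) fromℕ-1)))

    -- Here d > 3 enters: h is the power d - 1 ≥ 3 of u, whereas the right side of `hℕ≤` grows only
    -- like u². The summand 2 is at most 2 u².
    u≤ : u ℕ.≤ 4 ℕ.* (Ĉ ℕ.* Ĉ) ℕ.+ 2
    u≤ = ℕ.*-cancelˡ-≤ (u ℕ.* u) {{ℕ.>-nonZero 0<uu}} (begin
      u ℕ.* u ℕ.* u                                       ≤⟨ ℕ.*-monoˡ-≤ u (begin
          u ℕ.* u                                           ≡⟨ cong (u ℕ.*_) (ℕ.*-identityʳ u) ⟨
          u ℕ.* (u ℕ.* 1)                                   ≤⟨ ℕ.*-monoʳ-≤ u (ℕ.*-monoʳ-≤ u (ℕ.m^n>0 u {{ℕ.>-nonZero 1≤u}} d′)) ⟩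
          u ℕ.^ k                                           ∎) ⟩
      h                                                   ≤⟨ hℕ≤ ⟩
      (u ℕ.+ u) ℕ.* (u ℕ.+ u) ℕ.* (Ĉ ℕ.* Ĉ) ℕ.+ 2         ≡⟨ cong (ℕ._+ 2) (solve 2 (λ u Ĉ →
          (u :+ u) :* (u :+ u) :* (Ĉ :* Ĉ) := u :* u :* (con 4 :* (Ĉ :* Ĉ))) ≡.refl u Ĉ) ⟩
      u ℕ.* u ℕ.* (4 ℕ.* (Ĉ ℕ.* Ĉ)) ℕ.+ 2                 ≤⟨ ℕ.+-monoʳ-≤ (u ℕ.* u ℕ.* (4 ℕ.* (Ĉ ℕ.* Ĉ)))
                                                             (ℕ.*-monoˡ-≤ 2 0<uu) ⟩
      u ℕ.* u ℕ.* (4 ℕ.* (Ĉ ℕ.* Ĉ)) ℕ.+ u ℕ.* u ℕ.* 2     ≡⟨ ℕ.*-distribˡ-+ (u ℕ.* u) (4 ℕ.* (Ĉ ℕ.* Ĉ)) 2 ⟨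
      u ℕ.* u ℕ.* (4 ℕ.* (Ĉ ℕ.* Ĉ) ℕ.+ 2)                 ∎)
      where
      open ℕ.≤-Reasoning
      open Data.Nat.Solver.+-*-Solver
      0<uu : 0 ℕ.< u ℕ.* u
      0<uu = ℕ.*-mono-≤ 1≤u 1≤u

-- A bound on |R| in terms of C alone, and the conclusion.

unitBound sizeBound : ℝ → ℕ
unitBound C = 4 ℕ.* (Ĉ ℕ.* Ĉ) ℕ.+ 2
  where Ĉ = proj₁ (RealLemmas.eventually-below C)
-- From size ≤ j ^ j and j ≤ 2 u.
sizeBound C = (unitBound C ℕ.+ unitBound C) ℕ.^ (unitBound C ℕ.+ unitBound C)

salem⇒size≤ : ∀ (R : FiniteRing c ℓ) d′ C → IsSimple R →
              Salem.IsSalem R (4 ℕ.+ d′) C (Salem.H R (4 ℕ.+ d′)) → FiniteRing.size R ℕ.≤ sizeBound C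
salem⇒size≤ R d′ C simple salem = begin
  FiniteRing.size R    ≤⟨ size≤j^j simple ⟩
  j ℕ.^ j              ≤⟨ ℕ.^-monoˡ-≤ j j≤K ⟩
  K ℕ.^ j              ≤⟨ ℕ.^-monoʳ-≤ K {{ℕ.>-nonZero 0<K}} j≤K ⟩
  K ℕ.^ K              ∎
  where
  open ℕ.≤-Reasoning
  open FiniteRingProperties R
  open Simple simple
  open Units R
  open PrimitiveIdeal primitiveIdempotent
  p : ℕ
  p = proj₁ characteristic
  prime-p : Prime p
  prime-p = proj₁ (proj₂ characteristic)
  K : ℕ
  K = unitBound C ℕ.+ unitBound C
  u≤ : u ℕ.≤ unitBound C
  u≤ = Characters.u≤ R primitiveIdempotent
    (primitiveRootOfUnity p (ℕ.nonTrivial⇒n>1 p {{prime⇒nonTrivial prime-p}}))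
    (Coordinate.additiveCoordinate prime-p (proj₂ (proj₂ characteristic)) (PrimitiveIdempotent.e≉0 primitiveIdempotent))
    d′ C salem
  j≤K : j ℕ.≤ K
  j≤K = ℕ.≤-trans j≤2u (ℕ.+-mono-≤ u≤ u≤)
  0<K : 0 ℕ.< K
  0<K = ℕ.≤-trans (ℕ.≤-trans 1≤u u≤) (ℕ.m≤m+n (unitBound C) (unitBound C))

open import Data.Nat.Base using (_<_)

theorem2p21 : ∀ {c ℓ} (d : ℕ) → 3 < d → (C : ℝ) → Real.0ℝ Real.< C →
    FinitelyManyUpToIso {c} {ℓ} (λ R → IsSimple R × Salem.IsSalem R d C (Salem.H R d))
theorem2p21 (suc (suc (suc (suc d′)))) _ C _ =
  FiniteRingTables.ringsOfSize≤ (sizeBound C) ,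
  λ R (simple , salem) → FiniteRingTables.∈ringsOfSize≤ R (salem⇒size≤ R d′ C simple salem)
theorem2p21 0 ()
theorem2p21 1 (ℕ.s≤s ())
theorem2p21 2 (ℕ.s≤s (ℕ.s≤s ()))
theorem2p21 3 (ℕ.s≤s (ℕ.s≤s (ℕ.s≤s ())))
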